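{- (a) The polynomials $x^4+1$ and $x^4+2$ are $2$-superirreducible over $\mathbb{Q}$. (b) Every polynomial in the following sets that is irreducible over $\mathbb{Q}$ is $2$-superirreducible over $\mathbb{Q}$: (i) $x^4+p$ with $p$ prime and $p\equiv 7,11 \pmod{16}$; (ii) $x^4+2p$ with $p$ prime and $p\equiv \pm 3\pmod 8$; (iii) $x^4+4p$ and $x^4-p$ with $p$ prime and $p\equiv \pm 3, -5\pmod{16}$.
   Context: For a commutative integral domain $I$ and $k\in\mathbb{N}$, a polynomial $f\in I[x]$ is called $k$-superirreducible over $I$ if $f$ is irreducible in $I[x]$ and, for every non-constant polynomial $g\in I[x]$ of degree at most $k$, the composition $f(g(x))$ is irreducible in $I[x]$. -}

module Defs where

open import Data.Nat using (ℕ; zero; suc; _<_; _≤_)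
open import Data.Integer using (+_)
open import Data.Rational using (ℚ; 0ℚ; 1ℚ; _+_; _*_; -_; _/_)
open import Data.List using (List; []; _∷_)
open import Data.Product using (Σ; ∃; _×_)
open import Data.Sum using (_⊎_)
open import Relation.Nullary using (¬_)
open import Relation.Binary.PropositionalEquality using (_≡_; _≢_)

-- Polynomials in ℚ[x]: coefficient lists, lowest degree first.
-- Trailing zeros are allowed; equality of polynomials is coefficientwise (_≈ₚ_).
Poly : Set
Poly = List ℚ

coeff : Poly → ℕ → ℚ
coeff []       _       = 0ℚ
coeff (a ∷ f)  zero    = a
coeff (a ∷ f)  (suc n) = coeff f n

_≈ₚ_ : Poly → Poly → Set
f ≈ₚ g = ∀ n → coeff f n ≡ coeff g n

_+ₚ_ : Poly → Poly → Poly
[]      +ₚ g       = g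
(a ∷ f) +ₚ []      = a ∷ f
(a ∷ f) +ₚ (b ∷ g) = (a + b) ∷ (f +ₚ g)

_·ₚ_ : ℚ → Poly → Poly
c ·ₚ []      = []
c ·ₚ (a ∷ f) = (c * a) ∷ (c ·ₚ f)

_*ₚ_ : Poly → Poly → Poly
[]      *ₚ g = []
(a ∷ f) *ₚ g = (a ·ₚ g) +ₚ (0ℚ ∷ (f *ₚ g))

_∘ₚ_ : Poly → Poly → Poly
[]      ∘ₚ g = []
(a ∷ f) ∘ₚ g = (a ∷ []) +ₚ (g *ₚ (f ∘ₚ g))

oneₚ : Poly
oneₚ = 1ℚ ∷ []

IsZeroₚ : Poly → Set
IsZeroₚ f = ∀ n → coeff f n ≡ 0ℚ

IsUnitₚ : Poly → Set
IsUnitₚ f = ∃ λ g → (f *ₚ g) ≈ₚ oneₚ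

Irreducible : Poly → Set
Irreducible f = ¬ IsZeroₚ f × ¬ IsUnitₚ f
  × (∀ g h → f ≈ₚ (g *ₚ h) → IsUnitₚ g ⊎ IsUnitₚ h)

NonConstant : Poly → Set
NonConstant g = ∃ λ n → (1 ≤ n) × (coeff g n ≢ 0ℚ)

DegreeAtMost : ℕ → Poly → Set
DegreeAtMost k g = ∀ n → k < n → coeff g n ≡ 0ℚ

Superirreducible : ℕ → Poly → Set
Superirreducible k f = Irreducible f
  × (∀ g → NonConstant g → DegreeAtMost k g → Irreducible (f ∘ₚ g))

ℕtoℚ : ℕ → ℚ
ℕtoℚ n = + n / 1

x⁴+ : ℚ → Poly
x⁴+ c = c ∷ 0ℚ ∷ 0ℚ ∷ 0ℚ ∷ 1ℚ ∷ []

{-# OPTIONS --safe #-}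
module Submission where

-- Let f = y⁴ + c be irreducible and g quadratic.  Completing the square in g gives ξ = x + h with
-- ξ² = L(g) for a linear L, and ℚ[x] is free over ℚ[g] with basis 1, ξ.  If f(g) = G H, the norms
-- A² − L B² of G = A(g) + ξ B(g) and of H multiply to f², so by Euclid's lemma either G or H is a
-- unit or A² − L B² = γ² f with deg A = 2 and deg B ≤ 1.  In the last case the root −δ/ε of B gives
-- a rational point (δ/ε, w) on w² = t⁴ + c with t ≠ 0.  Such points are excluded by infinite
-- descent: with z² = x⁴ + c y⁴ the coprime factors of z² − x⁴ are fourth powers up to divisors of c,
-- all but one of the resulting equations fail modulo 16 (some only after one more factorisation),
-- and factoring the remaining one in the same way gives a smaller solution.  The same norm argument with g = x², applied to y + c and then to
-- y² + c, shows that x⁴ + 1 and x⁴ + 2 are irreducible.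

open import Defs
open import Level using (0ℓ)
open import Algebra.Bundles using (CommutativeRing)
import Algebra.Solver.Ring as RingSolver
open import Algebra.Solver.Ring.AlmostCommutativeRing using (fromCommutativeRing; _-Raw-AlmostCommutative⟶_)
open import Data.Empty using (⊥; ⊥-elim)
open import Data.List using (List; []; _∷_)
open import Data.List.Membership.Propositional using (_∈_)
open import Data.List.Relation.Unary.All using (All; all?; lookup)
open import Data.List.Relation.Unary.Any using (here; there)
open import Data.Maybe using (Maybe; just; nothing)
open import Data.Nat.Coprimality as Coprimality using (Coprime; coprime-divisor; coprime-/gcd)
open import Data.Nat.Primality using (Prime; prime[2]; ¬prime[1]; euclidsLemma; prime⇒irreducible; prime⇒nonZero)
open import Data.Product using (∃; _×_; _,_; proj₁; proj₂)
open import Data.Product.Properties using (≡-dec)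
open import Data.Sum as Sum using (_⊎_; inj₁; inj₂)
open import Relation.Binary using (tri<; tri≈; tri>)
open import Relation.Binary.PropositionalEquality
import Relation.Binary.Reasoning.Setoid as SetoidReasoning
open import Relation.Nullary using (¬_; Dec; yes; no)
open import Relation.Nullary.Decidable using (from-yes; _→-dec_; _×-dec_; _⊎-dec_; ¬?)

-- The norm argument replaces a computation in the field ℚ(θ) of a root θ of f: there f(g) factors
-- exactly when L(θ) is a square, and A² - L B² = γ² f is a polynomial witness of that. The curve w²
-- = t⁴ + c has genus 1, and the descent runs through its 2-isogenous companion. For c = 1, p, 2p
-- the even y = 2Y turns z² = x⁴ + c y⁴ into s⁴ = x² + 4c r⁴, and factoring again returns to s² = a⁴
-- + c b⁴. For c = 4p the companion is s⁴ = x² + p r⁴, which is the equation belonging to x⁴ - p;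
-- this is why these two families share their congruences and one descent. The conditions on p enter
-- only through residues: modulo 16 a square is 0, 1, 4 or 9 and a fourth power is 0 or 1. Trivial
-- points are the obstacle. For c = 1 the point t = 0, w = 1 exists, so the descent can only speak
-- of nonzero coordinates, and the norm equations with δ = 0 or ε = 0 are refuted from their
-- coefficients instead.

module Polynomials where

  open import Data.Nat as ℕ using (ℕ; zero; suc; _≤_; z≤n; s≤s)
  import Data.Nat.Properties as ℕ
  open import Data.Rational using (ℚ; 0ℚ; 1ℚ; ½; _+_; _*_; -_; 1/_; ≢-nonZero)
  open import Data.Rational.Properties using (+-identityˡ; +-identityʳ; +-assoc; +-comm; +-inverseˡ; +-inverseʳ; *-zeroˡ; *-zeroʳ; *-identityˡ; *-identityʳ; *-assoc; *-comm; *-distribˡ-+; *-distribʳ-+; *-inverseʳ; neg-distribˡ-*; 1≢0; +-*-commutativeRing; _≟_)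
  open import Data.Rational.Solver using (module +-*-Solver)

  -- The commutative ring ℚ[x] on coefficient lists up to trailing zeros.

  coeff-+ : ∀ f g n → coeff (f +ₚ g) n ≡ coeff f n + coeff g n
  coeff-+ [] g n = sym (+-identityˡ _)
  coeff-+ (a ∷ f) [] n = sym (+-identityʳ _)
  coeff-+ (a ∷ f) (b ∷ g) zero = refl
  coeff-+ (a ∷ f) (b ∷ g) (suc n) = coeff-+ f g n

  coeff-· : ∀ c f n → coeff (c ·ₚ f) n ≡ c * coeff f n
  coeff-· c [] n = sym (*-zeroʳ c)
  coeff-· c (a ∷ f) zero = refl
  coeff-· c (a ∷ f) (suc n) = coeff-· c f n

  -- A record, unlike the function type _≈ₚ_, lets Agda infer the two polynomials.
  record _≋_ (f g : Poly) : Set where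
    constructor ⟪_⟫
    field at : f ≈ₚ g
  open _≋_ public

  infix 4 _≋_

  ≋-refl : ∀ {f} → f ≋ f
  ≋-refl = ⟪ (λ n → refl) ⟫

  ≋-sym : ∀ {f g} → f ≋ g → g ≋ f
  ≋-sym e = ⟪ (λ n → sym (at e n)) ⟫

  ≋-trans : ∀ {f g h} → f ≋ g → g ≋ h → f ≋ h
  ≋-trans e e′ = ⟪ (λ n → trans (at e n) (at e′ n)) ⟫

  ∷-cong : ∀ {a b f g} → a ≡ b → f ≋ g → (a ∷ f) ≋ (b ∷ g)
  ∷-cong a≡b e = ⟪ (λ { zero → a≡b ; (suc n) → at e n }) ⟫

  ∷-tail : ∀ {a b f g} → (a ∷ f) ≋ (b ∷ g) → f ≋ g
  ∷-tail e = ⟪ (λ n → at e (suc n)) ⟫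

  +ₚ-cong : ∀ {f f′ g g′} → f ≋ f′ → g ≋ g′ → (f +ₚ g) ≋ (f′ +ₚ g′)
  +ₚ-cong {f} {f′} {g} {g′} e e′ = ⟪ (λ n → trans (coeff-+ f g n) (trans (cong₂ _+_ (at e n) (at e′ n)) (sym (coeff-+ f′ g′ n)))) ⟫

  ·ₚ-cong : ∀ {c d f g} → c ≡ d → f ≋ g → (c ·ₚ f) ≋ (d ·ₚ g)
  ·ₚ-cong {c} {d} {f} {g} c≡d e = ⟪ (λ n → trans (coeff-· c f n) (trans (cong₂ _*_ c≡d (at e n)) (sym (coeff-· d g n)))) ⟫

  +ₚ-assoc : ∀ f g h → ((f +ₚ g) +ₚ h) ≋ (f +ₚ (g +ₚ h))
  +ₚ-assoc f g h = ⟪ (λ n → begin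
    coeff ((f +ₚ g) +ₚ h) n               ≡⟨ coeff-+ (f +ₚ g) h n ⟩
    coeff (f +ₚ g) n + coeff h n          ≡⟨ cong (_+ coeff h n) (coeff-+ f g n) ⟩
    (coeff f n + coeff g n) + coeff h n   ≡⟨ +-assoc (coeff f n) _ _ ⟩
    coeff f n + (coeff g n + coeff h n)   ≡⟨ cong (coeff f n +_) (coeff-+ g h n) ⟨
    coeff f n + coeff (g +ₚ h) n          ≡⟨ coeff-+ f (g +ₚ h) n ⟨
    coeff (f +ₚ (g +ₚ h)) n               ∎) ⟫
    where open ≡-Reasoning

  +ₚ-comm : ∀ f g → (f +ₚ g) ≋ (g +ₚ f)
  +ₚ-comm f g = ⟪ (λ n → trans (coeff-+ f g n) (trans (+-comm (coeff f n) _) (sym (coeff-+ g f n)))) ⟫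

  +ₚ-identityʳ : ∀ f → (f +ₚ []) ≋ f
  +ₚ-identityʳ f = ⟪ (λ n → trans (coeff-+ f [] n) (+-identityʳ _)) ⟫

  -ₚ_ : Poly → Poly
  -ₚ f = (- 1ℚ) ·ₚ f

  +ₚ-inverseʳ : ∀ f → (f +ₚ (-ₚ f)) ≋ []
  +ₚ-inverseʳ f = ⟪ (λ n → trans (coeff-+ f (-ₚ f) n) (trans (cong (coeff f n +_) (coeff-· (- 1ℚ) f n))
      (solve 1 (λ a → a :+ con (- 1ℚ) :* a := con 0ℚ) refl (coeff f n)))) ⟫
    where open +-*-Solver

  ·ₚ-distrib-+ₚ : ∀ c f g → (c ·ₚ (f +ₚ g)) ≋ ((c ·ₚ f) +ₚ (c ·ₚ g))
  ·ₚ-distrib-+ₚ c f g = ⟪ (λ n → begin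
    coeff (c ·ₚ (f +ₚ g)) n                 ≡⟨ coeff-· c (f +ₚ g) n ⟩
    c * coeff (f +ₚ g) n                    ≡⟨ cong (c *_) (coeff-+ f g n) ⟩
    c * (coeff f n + coeff g n)             ≡⟨ *-distribˡ-+ c _ _ ⟩
    c * coeff f n + c * coeff g n           ≡⟨ cong₂ _+_ (coeff-· c f n) (coeff-· c g n) ⟨
    coeff (c ·ₚ f) n + coeff (c ·ₚ g) n     ≡⟨ coeff-+ (c ·ₚ f) (c ·ₚ g) n ⟨
    coeff ((c ·ₚ f) +ₚ (c ·ₚ g)) n          ∎) ⟫
    where open ≡-Reasoning

  ·ₚ-assoc : ∀ c d f → (c ·ₚ (d ·ₚ f)) ≋ ((c * d) ·ₚ f)
  ·ₚ-assoc c d f = ⟪ (λ n → trans (coeff-· c (d ·ₚ f) n) (trans (cong (c *_) (coeff-· d f n))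
      (trans (sym (*-assoc c d _)) (sym (coeff-· (c * d) f n))))) ⟫

  +ₚ-interchange : ∀ f g h k → ((f +ₚ g) +ₚ (h +ₚ k)) ≋ ((f +ₚ h) +ₚ (g +ₚ k))
  +ₚ-interchange f g h k = ⟪ (λ n → trans (four f g h k n)
      (trans (solve 4 (λ a b c d → (a :+ b) :+ (c :+ d) := (a :+ c) :+ (b :+ d)) refl (coeff f n) (coeff g n) (coeff h n) (coeff k n))
        (sym (four f h g k n)))) ⟫
    where
    open +-*-Solver
    four : ∀ f g h k n → coeff ((f +ₚ g) +ₚ (h +ₚ k)) n ≡ (coeff f n + coeff g n) + (coeff h n + coeff k n)
    four f g h k n = trans (coeff-+ (f +ₚ g) (h +ₚ k) n) (cong₂ _+_ (coeff-+ f g n) (coeff-+ h k n))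

  shift-cong : ∀ {f g} → f ≋ g → (0ℚ ∷ f) ≋ (0ℚ ∷ g)
  shift-cong = ∷-cong refl

  shift-[] : (0ℚ ∷ []) ≋ []
  shift-[] = ⟪ (λ { zero → refl ; (suc n) → refl }) ⟫

  ·ₚ-zeroˡ : ∀ f → (0ℚ ·ₚ f) ≋ []
  ·ₚ-zeroˡ f = ⟪ (λ n → trans (coeff-· 0ℚ f n) (*-zeroˡ (coeff f n))) ⟫

  ·ₚ-distribʳ : ∀ c d f → ((c + d) ·ₚ f) ≋ ((c ·ₚ f) +ₚ (d ·ₚ f))
  ·ₚ-distribʳ c d f = ⟪ (λ n → trans (coeff-· (c + d) f n) (trans (*-distribʳ-+ (coeff f n) c d)
      (trans (sym (cong₂ _+_ (coeff-· c f n) (coeff-· d f n))) (sym (coeff-+ (c ·ₚ f) (d ·ₚ f) n))))) ⟫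

  *ₚ-zeroʳ : ∀ f → (f *ₚ []) ≋ []
  *ₚ-zeroʳ [] = ≋-refl
  *ₚ-zeroʳ (a ∷ f) = ≋-trans (shift-cong (*ₚ-zeroʳ f)) shift-[]

  *ₚ-congʳ : ∀ f {g g′} → g ≋ g′ → (f *ₚ g) ≋ (f *ₚ g′)
  *ₚ-congʳ [] e = ≋-refl
  *ₚ-congʳ (a ∷ f) e = +ₚ-cong (·ₚ-cong refl e) (shift-cong (*ₚ-congʳ f e))

  -- The mirror image of the recursion that defines the product, which is what commutativity rests
  -- on.
  *ₚ-∷ʳ : ∀ f b g → (f *ₚ (b ∷ g)) ≋ ((b ·ₚ f) +ₚ (0ℚ ∷ (f *ₚ g)))
  *ₚ-∷ʳ [] b g = ≋-sym shift-[]
  *ₚ-∷ʳ (a ∷ f) b g = ∷-cong (trans (+-identityʳ _) (trans (*-comm a b) (sym (+-identityʳ _))))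
    (≋-trans (+ₚ-cong ≋-refl (*ₚ-∷ʳ f b g))
    (≋-trans (≋-sym (+ₚ-assoc (a ·ₚ g) (b ·ₚ f) _))
    (≋-trans (+ₚ-cong (+ₚ-comm (a ·ₚ g) (b ·ₚ f)) ≋-refl)
             (+ₚ-assoc (b ·ₚ f) (a ·ₚ g) _))))

  *ₚ-comm : ∀ f g → (f *ₚ g) ≋ (g *ₚ f)
  *ₚ-comm [] g = ≋-sym (*ₚ-zeroʳ g)
  *ₚ-comm (a ∷ f) g = ≋-trans (+ₚ-cong ≋-refl (shift-cong (*ₚ-comm f g))) (≋-sym (*ₚ-∷ʳ g a f))

  *ₚ-cong : ∀ {f f′ g g′} → f ≋ f′ → g ≋ g′ → (f *ₚ g) ≋ (f′ *ₚ g′)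
  *ₚ-cong {f} {f′} {g} {g′} e e′ = ≋-trans (*ₚ-congʳ f e′)
    (≋-trans (*ₚ-comm f g′) (≋-trans (*ₚ-congʳ g′ e) (*ₚ-comm g′ f′)))

  *ₚ-distribˡ : ∀ f g h → (f *ₚ (g +ₚ h)) ≋ ((f *ₚ g) +ₚ (f *ₚ h))
  *ₚ-distribˡ [] g h = ≋-refl
  *ₚ-distribˡ (a ∷ f) g h =
    ≋-trans (+ₚ-cong (·ₚ-distrib-+ₚ a g h) (shift-cong (*ₚ-distribˡ f g h)))
            (+ₚ-interchange (a ·ₚ g) (a ·ₚ h) (0ℚ ∷ (f *ₚ g)) (0ℚ ∷ (f *ₚ h)))

  *ₚ-distribʳ : ∀ f g h → ((g +ₚ h) *ₚ f) ≋ ((g *ₚ f) +ₚ (h *ₚ f))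
  *ₚ-distribʳ f g h = ≋-trans (*ₚ-comm (g +ₚ h) f)
    (≋-trans (*ₚ-distribˡ f g h) (+ₚ-cong (*ₚ-comm f g) (*ₚ-comm f h)))

  ·ₚ-*ₚ : ∀ c f g → ((c ·ₚ f) *ₚ g) ≋ (c ·ₚ (f *ₚ g))
  ·ₚ-*ₚ c [] g = ≋-refl
  ·ₚ-*ₚ c (a ∷ f) g = ≋-trans (+ₚ-cong (≋-sym (·ₚ-assoc c a g)) (∷-cong (sym (*-zeroʳ c)) (·ₚ-*ₚ c f g)))
    (≋-sym (·ₚ-distrib-+ₚ c (a ·ₚ g) (0ℚ ∷ (f *ₚ g))))

  shift-*ₚ : ∀ f g → ((0ℚ ∷ f) *ₚ g) ≋ (0ℚ ∷ (f *ₚ g))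
  shift-*ₚ f g = +ₚ-cong (·ₚ-zeroˡ g) ≋-refl

  *ₚ-assoc : ∀ f g h → ((f *ₚ g) *ₚ h) ≋ (f *ₚ (g *ₚ h))
  *ₚ-assoc [] g h = ≋-refl
  *ₚ-assoc (a ∷ f) g h = ≋-trans (*ₚ-distribʳ h (a ·ₚ g) (0ℚ ∷ (f *ₚ g)))
    (+ₚ-cong (·ₚ-*ₚ a g h) (≋-trans (shift-*ₚ (f *ₚ g) h) (shift-cong (*ₚ-assoc f g h))))

  *ₚ-identityˡ : ∀ f → (oneₚ *ₚ f) ≋ f
  *ₚ-identityˡ f = ≋-trans (+ₚ-cong {g = 0ℚ ∷ []} ⟪ (λ n → trans (coeff-· 1ℚ f n) (*-identityˡ _)) ⟫ shift-[]) (+ₚ-identityʳ f)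

  polyRing : CommutativeRing 0ℓ 0ℓ
  polyRing = record
    { Carrier = Poly ; _≈_ = _≋_ ; _+_ = _+ₚ_ ; _*_ = _*ₚ_ ; -_ = -ₚ_ ; 0# = [] ; 1# = oneₚ
    ; isCommutativeRing = record
      { isRing = record
        { +-isAbelianGroup = record
          { isGroup = record
            { isMonoid = record
              { isSemigroup = record
                { isMagma = record { isEquivalence = record { refl = ≋-refl ; sym = ≋-sym ; trans = ≋-trans } ; ∙-cong = +ₚ-cong }
                ; assoc = +ₚ-assoc }
              ; identity = (λ f → ≋-refl) , +ₚ-identityʳ }
            ; inverse = (λ f → ≋-trans (+ₚ-comm (-ₚ f) f) (+ₚ-inverseʳ f)) , +ₚ-inverseʳ
            ; ⁻¹-cong = ·ₚ-cong refl }
          ; comm = +ₚ-comm }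
        ; *-cong = *ₚ-cong
        ; *-assoc = *ₚ-assoc
        ; *-identity = *ₚ-identityˡ , (λ f → ≋-trans (*ₚ-comm f oneₚ) (*ₚ-identityˡ f))
        ; distrib = *ₚ-distribˡ , *ₚ-distribʳ }
      ; *-comm = *ₚ-comm } }

  -- Rationals act as coefficients of the ring solver, so that identities between polynomials may
  -- contain literals such as `con 1ℚ`.
  constMorphism : CommutativeRing.rawRing +-*-commutativeRing -Raw-AlmostCommutative⟶ fromCommutativeRing polyRing
  constMorphism = record
    { ⟦_⟧ = λ a → a ∷ []
    ; +-homo = λ a b → ≋-refl
    ; *-homo = λ a b → ∷-cong (sym (+-identityʳ (a * b))) ≋-refl
    ; -‿homo = λ a → ∷-cong (trans (cong -_ (sym (*-identityˡ a))) (neg-distribˡ-* 1ℚ a)) ≋-refl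
    ; 0-homo = shift-[]
    ; 1-homo = ≋-refl }

  constEqual : ∀ a b → Maybe ((a ∷ []) ≋ (b ∷ []))
  constEqual a b with a ≟ b
  ... | yes a≡b = just (∷-cong a≡b ≋-refl)
  ... | no _ = nothing

  module PolySolver = RingSolver (CommutativeRing.rawRing +-*-commutativeRing) (fromCommutativeRing polyRing) constMorphism constEqual
  module ≋-Reasoning = SetoidReasoning (CommutativeRing.setoid polyRing)

  -- Degrees and the absence of zero divisors.

  inverse : ∀ {a} → a ≢ 0ℚ → ∃ λ b → a * b ≡ 1ℚ
  inverse {a} a≢0 = 1/ a , *-inverseʳ a
    where instance _ = ≢-nonZero a≢0

  *-cancelˡ-0 : ∀ {a b} → a ≢ 0ℚ → a * b ≡ 0ℚ → b ≡ 0ℚ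
  *-cancelˡ-0 {a} {b} a≢0 ab≡0 with a⁻¹ , eq ← inverse a≢0 = begin
    b               ≡⟨ *-identityˡ b ⟨
    1ℚ * b          ≡⟨ cong (_* b) eq ⟨
    (a * a⁻¹) * b   ≡⟨ solve 3 (λ a b c → (a :* c) :* b := c :* (a :* b)) refl a b a⁻¹ ⟩
    a⁻¹ * (a * b)   ≡⟨ cong (a⁻¹ *_) ab≡0 ⟩
    a⁻¹ * 0ℚ        ≡⟨ *-zeroʳ a⁻¹ ⟩
    0ℚ              ∎
    where
    open ≡-Reasoning
    open +-*-Solver

  *-≢0 : ∀ {a b} → a ≢ 0ℚ → b ≢ 0ℚ → a * b ≢ 0ℚ
  *-≢0 a≢0 b≢0 ab≡0 = b≢0 (*-cancelˡ-0 a≢0 ab≡0)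

  square≡0 : ∀ {a} → a * a ≡ 0ℚ → a ≡ 0ℚ
  square≡0 {a} aa≡0 with a ≟ 0ℚ
  ... | yes a≡0 = a≡0
  ... | no a≢0 = *-cancelˡ-0 a≢0 aa≡0

  -- Degree less than `n`. The zero polynomial satisfies this for every `n`, so its degree needs no
  -- convention, and a bound can be lowered one coefficient at a time.
  Below : ℕ → Poly → Set
  Below n f = ∀ j → n ≤ j → coeff f j ≡ 0ℚ

  below-≋ : ∀ {n f g} → f ≋ g → Below n f → Below n g
  below-≋ e bf j n≤j = trans (sym (at e j)) (bf j n≤j)

  below-weaken : ∀ {m n f} → m ≤ n → Below m f → Below n f
  below-weaken m≤n bf j n≤j = bf j (ℕ.≤-trans m≤n n≤j)

  below-+ : ∀ {n} f g → Below n f → Below n g → Below n (f +ₚ g)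
  below-+ f g bf bg j n≤j = trans (coeff-+ f g j) (cong₂ _+_ (bf j n≤j) (bg j n≤j))

  below-· : ∀ {n} c f → Below n f → Below n (c ·ₚ f)
  below-· c f bf j n≤j = trans (coeff-· c f j) (trans (cong (c *_) (bf j n≤j)) (*-zeroʳ c))

  below-0 : ∀ {f} → Below 0 f → f ≋ []
  below-0 bf = ⟪ (λ n → bf n z≤n) ⟫

  below-tail : ∀ {n a f} → Below (suc n) (a ∷ f) → Below n f
  below-tail bf j n≤j = bf (suc j) (s≤s n≤j)

  below-step : ∀ {n} f → Below (suc n) f → coeff f n ≡ 0ℚ → Below n f
  below-step {n} f bf fn≡0 j n≤j with ℕ.m≤n⇒m<n∨m≡n n≤j
  ... | inj₁ n<j = bf j n<j
  ... | inj₂ refl = fn≡0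

  below-length : ∀ f → ∃ λ n → Below n f
  below-length [] = 0 , λ _ _ → refl
  below-length (a ∷ f) with n , bf ← below-length f = suc n , λ { (suc j) (s≤s n≤j) → bf j n≤j }

  downward-zero : ∀ {f} → (∀ n → Below (suc n) f → coeff f n ≡ 0ℚ) → f ≋ []
  downward-zero {f} step with n , bf ← below-length f = below-0 (go n bf)
    where
    go : ∀ n → Below n f → Below 0 f
    go zero bf = bf
    go (suc n) bf = go n (below-step f bf (step n bf))

  tail≋[] : ∀ {a f} → Below 1 (a ∷ f) → f ≋ []
  tail≋[] bf = below-0 (below-tail bf)

  coeff-∷-*ₚ : ∀ a f g n → coeff ((a ∷ f) *ₚ g) n ≡ a * coeff g n + coeff (0ℚ ∷ (f *ₚ g)) n
  coeff-∷-*ₚ a f g n = trans (coeff-+ (a ·ₚ g) (0ℚ ∷ (f *ₚ g)) n) (cong (_+ _) (coeff-· a g n))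

  -- Only the pair of top indices survives in the convolution. The top coefficients may be zero, so
  -- this serves both to compute degrees and to force coefficients to vanish.
  coeff-*ₚ-top : ∀ a b f g → Below (suc a) f → Below (suc b) g → coeff (f *ₚ g) (a ℕ.+ b) ≡ coeff f a * coeff g b
  coeff-*ₚ-top a b [] g bf bg = sym (*-zeroˡ (coeff g b))
  coeff-*ₚ-top zero b (x ∷ f) g bf bg = trans (coeff-∷-*ₚ x f g b)
    (trans (cong (x * coeff g b +_) (at (≋-trans (shift-cong (*ₚ-cong (tail≋[] bf) (≋-refl {g}))) shift-[]) b)) (+-identityʳ _))
  coeff-*ₚ-top (suc a) b (x ∷ f) g bf bg = trans (coeff-∷-*ₚ x f g (suc (a ℕ.+ b)))
    (trans (cong₂ _+_ (trans (cong (x *_) (bg (suc (a ℕ.+ b)) (s≤s (ℕ.m≤n+m b a)))) (*-zeroʳ x)) (coeff-*ₚ-top a b f g (below-tail bf) bg))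
           (+-identityˡ _))

  below-*ₚ : ∀ a b f g → Below (suc a) f → Below (suc b) g → Below (suc (a ℕ.+ b)) (f *ₚ g)
  below-*ₚ a b [] g bf bg j _ = refl
  below-*ₚ zero b (x ∷ f) g bf bg j b<j = trans (coeff-∷-*ₚ x f g j)
    (cong₂ _+_ (trans (cong (x *_) (bg j b<j)) (*-zeroʳ x)) (at (≋-trans (shift-cong (*ₚ-cong (tail≋[] bf) (≋-refl {g}))) shift-[]) j))
  below-*ₚ (suc a) b (x ∷ f) g bf bg (suc j) (s≤s p) = trans (coeff-∷-*ₚ x f g (suc j))
    (cong₂ _+_ (trans (cong (x *_) (bg (suc j) (s≤s (ℕ.≤-trans (ℕ.m≤n+m b (suc a)) p)))) (*-zeroʳ x))
               (below-*ₚ a b f g (below-tail bf) bg j p))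

  record HasDegree (n : ℕ) (f : Poly) : Set where
    constructor _&_
    field
      lead≢0 : coeff f n ≢ 0ℚ
      bounded : DegreeAtMost n f

  degree? : ∀ f → f ≋ [] ⊎ ∃ λ n → HasDegree n f
  degree? [] = inj₁ ≋-refl
  degree? (a ∷ f) with degree? f
  ... | inj₂ (n , (fn≢0 & bf)) = inj₂ (suc n , (fn≢0 & λ { (suc j) (s≤s p) → bf j p }))
  ... | inj₁ f≋0 with a ≟ 0ℚ
  ...   | yes a≡0 = inj₁ ⟪ (λ { zero → a≡0 ; (suc n) → at f≋0 n }) ⟫
  ...   | no a≢0 = inj₂ (0 , (a≢0 & λ { (suc j) _ → at f≋0 j }))

  degree-*ₚ : ∀ {m n f g} → HasDegree m f → HasDegree n g → HasDegree (m ℕ.+ n) (f *ₚ g)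
  degree-*ₚ {m} {n} {f} {g} (fm & bf) (gn & bg) =
    (λ eq → *-≢0 fm gn (trans (sym (coeff-*ₚ-top m n f g bf bg)) eq)) & below-*ₚ m n f g bf bg

  degree-≋ : ∀ {n f g} → f ≋ g → HasDegree n f → HasDegree n g
  degree-≋ {n} e (fn & bf) = (λ eq → fn (trans (at e n) eq)) & below-≋ e bf

  degree-unique : ∀ {m n f} → HasDegree m f → HasDegree n f → m ≡ n
  degree-unique {m} {n} (fm & bm) (fn & bn) with ℕ.<-cmp m n
  ... | tri< m<n _ _ = ⊥-elim (fn (bm n m<n))
  ... | tri≈ _ m≡n _ = m≡n
  ... | tri> _ _ n<m = ⊥-elim (fm (bn m n<m))

  degree-≢[] : ∀ {n f} → HasDegree n f → ¬ (f ≋ [])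
  degree-≢[] {n} (fn & _) e = fn (at e n)

  *ₚ-domain : ∀ {f g} → ¬ (f ≋ []) → (f *ₚ g) ≋ [] → g ≋ []
  *ₚ-domain {f} {g} f≢0 e with degree? f | degree? g
  ... | inj₁ f≋0 | _ = ⊥-elim (f≢0 f≋0)
  ... | _ | inj₁ g≋0 = g≋0
  ... | inj₂ (m , df) | inj₂ (n , dg) = ⊥-elim (degree-≢[] (degree-*ₚ df dg) e)

  -ₚ-≋[] : ∀ {f g} → (f +ₚ (-ₚ g)) ≋ [] → f ≋ g
  -ₚ-≋[] {f} {g} e = begin
    f                     ≈⟨ solve 2 (λ f g → f := (f :+ :- g) :+ g) ≋-refl f g ⟩
    (f +ₚ (-ₚ g)) +ₚ g    ≈⟨ +ₚ-cong e ≋-refl ⟩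
    g                     ∎
    where
    open ≋-Reasoning
    open PolySolver

  *ₚ-cancelˡ : ∀ {f g h} → ¬ (f ≋ []) → (f *ₚ g) ≋ (f *ₚ h) → g ≋ h
  *ₚ-cancelˡ {f} {g} {h} f≢0 e = -ₚ-≋[] (*ₚ-domain f≢0 (begin
    f *ₚ (g +ₚ (-ₚ h))            ≈⟨ solve 3 (λ f g h → f :* (g :+ :- h) := (f :* g) :+ :- (f :* h)) ≋-refl f g h ⟩
    (f *ₚ g) +ₚ (-ₚ (f *ₚ h))     ≈⟨ +ₚ-cong e ≋-refl ⟩
    (f *ₚ h) +ₚ (-ₚ (f *ₚ h))     ≈⟨ +ₚ-inverseʳ (f *ₚ h) ⟩
    []                            ∎))
    where
    open ≋-Reasoning
    open PolySolver

  1≢0ₚ : ¬ (oneₚ ≋ [])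
  1≢0ₚ e = 1≢0 (at e 0)

  degree-oneₚ : HasDegree 0 oneₚ
  degree-oneₚ = 1≢0 & λ { (suc j) _ → refl }

  -- The degrees of `f` and of its inverse add up to the degree 0 of `oneₚ`.
  unit-degree : ∀ {f} → IsUnitₚ f → HasDegree 0 f
  unit-degree {f} (g , e) = go (degree? f) (degree? g)
    where
    fg≋1 : (f *ₚ g) ≋ oneₚ
    fg≋1 = ⟪ e ⟫
    go : f ≋ [] ⊎ ∃ (λ n → HasDegree n f) → g ≋ [] ⊎ ∃ (λ n → HasDegree n g) → HasDegree 0 f
    go (inj₁ f≋0) _ = ⊥-elim (1≢0ₚ (≋-trans (≋-sym fg≋1) (*ₚ-cong f≋0 (≋-refl {g}))))
    go _ (inj₁ g≋0) = ⊥-elim (1≢0ₚ (≋-trans (≋-sym fg≋1) (≋-trans (*ₚ-congʳ f g≋0) (*ₚ-zeroʳ f))))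
    go (inj₂ (m , df)) (inj₂ (n , dg)) = subst (λ k → HasDegree k f) m≡0 df
      where
      m≡0 : m ≡ 0
      m≡0 = ℕ.m+n≡0⇒m≡0 m (degree-unique (degree-≋ fg≋1 (degree-*ₚ df dg)) degree-oneₚ)

  unit-*ₚˡ : ∀ {f g h} → IsUnitₚ h → (f *ₚ g) ≋ h → IsUnitₚ f
  unit-*ₚˡ {f} {g} {h} (h′ , e) fg≋h = (g *ₚ h′) , at f*gh′≋1
    where
    open ≋-Reasoning
    f*gh′≋1 : (f *ₚ (g *ₚ h′)) ≋ oneₚ
    f*gh′≋1 = begin
      f *ₚ (g *ₚ h′)   ≈⟨ *ₚ-assoc f g h′ ⟨
      (f *ₚ g) *ₚ h′   ≈⟨ *ₚ-cong fg≋h ≋-refl ⟩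
      h *ₚ h′          ≈⟨ ⟪ e ⟫ ⟩
      oneₚ             ∎

  -- Division with remainder, Bézout's identity and Euclid's lemma.

  _∣ₚ_ : Poly → Poly → Set
  f ∣ₚ g = ∃ λ q → g ≋ (f *ₚ q)

  infix 4 _∣ₚ_

  -- As in Horner's scheme: p = s q + r gives a + x p = (x s) q + (a + x r). The new remainder has
  -- degree at most `n`, and subtracting `c` times `q` removes its coefficient at `n`.
  divMod : ∀ {n q} → HasDegree n q → ∀ p → ∃ λ s → ∃ λ r → (p ≋ ((s *ₚ q) +ₚ r)) × Below n r
  divMod {n} {q} _ [] = [] , [] , ≋-refl , λ _ _ → refl
  divMod {n} {q} dq@(qn & bq) (a ∷ p) with divMod dq p | inverse qn
  ... | s , r , e , br | i , qi≡1 = (c ∷ s) , r′ , eq , below-step r′ br′ top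
    where
    open ≋-Reasoning
    c = coeff (a ∷ r) n * i
    r′ = (a ∷ r) +ₚ ((- c) ·ₚ q)
    br′ : Below (suc n) r′
    br′ = below-+ (a ∷ r) ((- c) ·ₚ q) (λ { (suc j) (s≤s p) → br j p }) (below-· (- c) q bq)
    top : coeff r′ n ≡ 0ℚ
    top = trans (coeff-+ (a ∷ r) ((- c) ·ₚ q) n) (trans (cong (coeff (a ∷ r) n +_) (coeff-· (- c) q n))
      (trans (S.solve 3 (λ x y i → x S.:+ (S.:- (x S.:* i)) S.:* y S.:= x S.:+ S.:- (x S.:* (y S.:* i))) refl (coeff (a ∷ r) n) (coeff q n) i)
      (trans (cong (λ t → coeff (a ∷ r) n + - (coeff (a ∷ r) n * t)) qi≡1)
      (S.solve 1 (λ x → x S.:+ S.:- (x S.:* S.con 1ℚ) S.:= S.con 0ℚ) refl (coeff (a ∷ r) n)))))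
      where module S = +-*-Solver
    cancel : ((c ·ₚ q) +ₚ ((- c) ·ₚ q)) ≋ []
    cancel = ≋-trans (≋-sym (·ₚ-distribʳ c (- c) q)) (≋-trans (·ₚ-cong (+-inverseʳ c) (≋-refl {q})) (·ₚ-zeroˡ q))
    eq : (a ∷ p) ≋ (((c ∷ s) *ₚ q) +ₚ r′)
    eq = begin
      a ∷ p                                                           ≈⟨ ∷-cong (sym (+-identityˡ a)) e ⟩
      (0ℚ ∷ (s *ₚ q)) +ₚ (a ∷ r)                                      ≈⟨ +ₚ-cong cancel ≋-refl ⟨
      ((c ·ₚ q) +ₚ ((- c) ·ₚ q)) +ₚ ((0ℚ ∷ (s *ₚ q)) +ₚ (a ∷ r))      ≈⟨ solve 4 (λ u v w t → (u :+ t) :+ (v :+ w) := (u :+ v) :+ (w :+ t)) ≋-refl (c ·ₚ q) (0ℚ ∷ (s *ₚ q)) (a ∷ r) ((- c) ·ₚ q) ⟩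
      ((c ∷ s) *ₚ q) +ₚ r′                                            ∎
      where open PolySolver

  record Bézout (f g : Poly) : Set where
    field
      gcd u v : Poly
      gcd∣f : gcd ∣ₚ f
      gcd∣g : gcd ∣ₚ g
      identity : gcd ≋ ((u *ₚ f) +ₚ (v *ₚ g))

  -- The Euclidean algorithm, recursing on a degree bound for the second argument. The bound drops
  -- because the top coefficient is zero or because the remainder is shorter.
  bézout : ∀ f g → Bézout f g
  bézout f g = go (proj₁ (below-length g)) f g (proj₂ (below-length g))
    where
    open PolySolver
    go : ∀ n f g → Below n g → Bézout f g
    go zero f g bg = record
      { gcd = f ; u = oneₚ ; v = []
      ; gcd∣f = oneₚ , solve 1 (λ f → f := f :* con 1ℚ) ≋-refl f
      ; gcd∣g = [] , ≋-trans (below-0 bg) (≋-sym (*ₚ-zeroʳ f))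
      ; identity = ≋-sym (≋-trans (+ₚ-identityʳ (oneₚ *ₚ f)) (*ₚ-identityˡ f)) }
    go (suc n) f g bg with coeff g n ≟ 0ℚ
    ... | yes gn≡0 = go n f g (below-step g bg gn≡0)
    ... | no gn≢0 with s , r , f≋sg+r , br ← divMod (gn≢0 & bg) f
                  with record { gcd = d ; u = u ; v = v ; gcd∣f = q , g≋dq ; gcd∣g = q′ , r≋dq′ ; identity = id } ← go n g r br = record
      { gcd = d ; u = v ; v = u +ₚ (-ₚ (v *ₚ s))
      ; gcd∣f = ((s *ₚ q) +ₚ q′) , (begin
          f                              ≈⟨ f≋sg+r ⟩
          (s *ₚ g) +ₚ r                  ≈⟨ +ₚ-cong (*ₚ-congʳ s g≋dq) r≋dq′ ⟩
          (s *ₚ (d *ₚ q)) +ₚ (d *ₚ q′)   ≈⟨ solve 4 (λ s d q q′ → s :* (d :* q) :+ d :* q′ := d :* (s :* q :+ q′)) ≋-refl s d q q′ ⟩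
          d *ₚ ((s *ₚ q) +ₚ q′)          ∎)
      ; gcd∣g = q , g≋dq
      ; identity = begin
          d                                                            ≈⟨ id ⟩
          (u *ₚ g) +ₚ (v *ₚ r)                                         ≈⟨ solve 5 (λ u v g r s → u :* g :+ v :* r := v :* (s :* g :+ r) :+ (u :+ :- (v :* s)) :* g) ≋-refl u v g r s ⟩
          (v *ₚ ((s *ₚ g) +ₚ r)) +ₚ ((u +ₚ (-ₚ (v *ₚ s))) *ₚ g)        ≈⟨ +ₚ-cong (*ₚ-congʳ v f≋sg+r) ≋-refl ⟨
          (v *ₚ f) +ₚ ((u +ₚ (-ₚ (v *ₚ s))) *ₚ g)                      ∎ }
      where open ≋-Reasoning

  -- With d the gcd of `f` and `g` and f = d q, irreducibility makes q or d a unit. In the first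
  -- case `f` divides `g`; in the second, Bézout's identity times `h` writes `h` as a multiple of
  -- `f`.
  euclid : ∀ {f g h} → Irreducible f → f ∣ₚ (g *ₚ h) → f ∣ₚ g ⊎ f ∣ₚ h
  euclid {f} {g} {h} (_ , _ , irr) (k , gh≋fk)
    with record { gcd = d ; u = u ; v = v ; gcd∣f = q , f≋dq ; gcd∣g = q′ , g≋dq′ ; identity = id } ← bézout f g
    with irr d q (at f≋dq)
  ... | inj₂ (q⁻¹ , qq⁻¹) = inj₁ ((q⁻¹ *ₚ q′) , (begin
          g                            ≈⟨ g≋dq′ ⟩
          d *ₚ q′                      ≈⟨ solve 2 (λ d q′ → d :* q′ := d :* (con 1ℚ :* q′)) ≋-refl d q′ ⟩
          d *ₚ (oneₚ *ₚ q′)            ≈⟨ *ₚ-congʳ d (*ₚ-cong {q *ₚ q⁻¹} {oneₚ} ⟪ qq⁻¹ ⟫ ≋-refl) ⟨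
          d *ₚ ((q *ₚ q⁻¹) *ₚ q′)      ≈⟨ solve 4 (λ d q r q′ → d :* ((q :* r) :* q′) := (d :* q) :* (r :* q′)) ≋-refl d q q⁻¹ q′ ⟩
          (d *ₚ q) *ₚ (q⁻¹ *ₚ q′)      ≈⟨ *ₚ-cong f≋dq ≋-refl ⟨
          f *ₚ (q⁻¹ *ₚ q′)             ∎))
    where
    open ≋-Reasoning
    open PolySolver
  ... | inj₁ (d⁻¹ , dd⁻¹) = inj₂ ((d⁻¹ *ₚ ((u *ₚ h) +ₚ (v *ₚ k))) , (begin
          h                                                       ≈⟨ *ₚ-identityˡ h ⟨
          oneₚ *ₚ h                                               ≈⟨ *ₚ-cong {d *ₚ d⁻¹} {oneₚ} ⟪ dd⁻¹ ⟫ ≋-refl ⟨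
          (d *ₚ d⁻¹) *ₚ h                                         ≈⟨ *ₚ-cong (*ₚ-cong id ≋-refl) ≋-refl ⟩
          (((u *ₚ f) +ₚ (v *ₚ g)) *ₚ d⁻¹) *ₚ h                    ≈⟨ solve 6 (λ u f v g i h → ((u :* f :+ v :* g) :* i) :* h := i :* (f :* (u :* h) :+ v :* (g :* h))) ≋-refl u f v g d⁻¹ h ⟩
          d⁻¹ *ₚ ((f *ₚ (u *ₚ h)) +ₚ (v *ₚ (g *ₚ h)))             ≈⟨ *ₚ-congʳ d⁻¹ (+ₚ-cong ≋-refl (*ₚ-congʳ v gh≋fk)) ⟩
          d⁻¹ *ₚ ((f *ₚ (u *ₚ h)) +ₚ (v *ₚ (f *ₚ k)))             ≈⟨ solve 6 (λ u f v k i h → i :* (f :* (u :* h) :+ v :* (f :* k)) := f :* (i :* (u :* h :+ v :* k))) ≋-refl u f v k d⁻¹ h ⟩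
          f *ₚ (d⁻¹ *ₚ ((u *ₚ h) +ₚ (v *ₚ k)))                    ∎))
    where
    open ≋-Reasoning
    open PolySolver

  -- Composition with g as a ring homomorphism, injective for nonconstant g.

  ∘-[] : ∀ {f} g → f ≋ [] → (f ∘ₚ g) ≋ []
  ∘-[] {[]} g e = ≋-refl
  ∘-[] {a ∷ f} g e = begin
    (a ∷ []) +ₚ (g *ₚ (f ∘ₚ g))  ≈⟨ +ₚ-cong (≋-trans (∷-cong (at e 0) ≋-refl) shift-[]) (*ₚ-congʳ g (∘-[] {f} g ⟪ (λ n → at e (suc n)) ⟫)) ⟩
    g *ₚ []                      ≈⟨ *ₚ-zeroʳ g ⟩
    []                           ∎
    where open ≋-Reasoning

  ∘-cong : ∀ {f f′} g → f ≋ f′ → (f ∘ₚ g) ≋ (f′ ∘ₚ g)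
  ∘-cong {[]} g e = ≋-sym (∘-[] g (≋-sym e))
  ∘-cong {f@(_ ∷ _)} {[]} g e = ∘-[] {f} g e
  ∘-cong {a ∷ f} {b ∷ f′} g e = +ₚ-cong (∷-cong (at e 0) ≋-refl) (*ₚ-congʳ g (∘-cong g (∷-tail e)))

  ∘-const : ∀ c g → ((c ∷ []) ∘ₚ g) ≋ (c ∷ [])
  ∘-const c g = ≋-trans (+ₚ-cong ≋-refl (*ₚ-zeroʳ g)) (+ₚ-identityʳ (c ∷ []))

  ∘-+ₚ : ∀ f f′ g → ((f +ₚ f′) ∘ₚ g) ≋ ((f ∘ₚ g) +ₚ (f′ ∘ₚ g))
  ∘-+ₚ [] f′ g = ≋-refl
  ∘-+ₚ (a ∷ f) [] g = ≋-sym (+ₚ-identityʳ _)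
  ∘-+ₚ (a ∷ f) (b ∷ f′) g = begin
    ((a + b) ∷ []) +ₚ (g *ₚ ((f +ₚ f′) ∘ₚ g))                        ≈⟨ +ₚ-cong ≋-refl (*ₚ-congʳ g (∘-+ₚ f f′ g)) ⟩
    ((a ∷ []) +ₚ (b ∷ [])) +ₚ (g *ₚ ((f ∘ₚ g) +ₚ (f′ ∘ₚ g)))         ≈⟨ solve 5 (λ a b g f f′ → (a :+ b) :+ g :* (f :+ f′) := (a :+ g :* f) :+ (b :+ g :* f′)) ≋-refl (a ∷ []) (b ∷ []) g (f ∘ₚ g) (f′ ∘ₚ g) ⟩
    ((a ∷ f) ∘ₚ g) +ₚ ((b ∷ f′) ∘ₚ g)                                ∎
    where
    open ≋-Reasoning
    open PolySolver

  const-*ₚ : ∀ c f → ((c ∷ []) *ₚ f) ≋ (c ·ₚ f)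
  const-*ₚ c f = ≋-trans (+ₚ-cong {c ·ₚ f} ≋-refl shift-[]) (+ₚ-identityʳ (c ·ₚ f))

  ∘-·ₚ : ∀ c f g → ((c ·ₚ f) ∘ₚ g) ≋ ((c ∷ []) *ₚ (f ∘ₚ g))
  ∘-·ₚ c [] g = ≋-sym (*ₚ-zeroʳ (c ∷ []))
  ∘-·ₚ c (a ∷ f) g = begin
    ((c * a) ∷ []) +ₚ (g *ₚ ((c ·ₚ f) ∘ₚ g))                         ≈⟨ +ₚ-cong (≋-sym (const-*ₚ c (a ∷ []))) (*ₚ-congʳ g (∘-·ₚ c f g)) ⟩
    ((c ∷ []) *ₚ (a ∷ [])) +ₚ (g *ₚ ((c ∷ []) *ₚ (f ∘ₚ g)))          ≈⟨ solve 4 (λ c a g f → c :* a :+ g :* (c :* f) := c :* (a :+ g :* f)) ≋-refl (c ∷ []) (a ∷ []) g (f ∘ₚ g) ⟩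
    (c ∷ []) *ₚ ((a ∷ f) ∘ₚ g)                                       ∎
    where
    open ≋-Reasoning
    open PolySolver

  ∘-shift : ∀ f g → ((0ℚ ∷ f) ∘ₚ g) ≋ (g *ₚ (f ∘ₚ g))
  ∘-shift f g = +ₚ-cong shift-[] ≋-refl

  ∘-*ₚ : ∀ f f′ g → ((f *ₚ f′) ∘ₚ g) ≋ ((f ∘ₚ g) *ₚ (f′ ∘ₚ g))
  ∘-*ₚ [] f′ g = ≋-refl
  ∘-*ₚ (a ∷ f) f′ g = begin
    ((a ·ₚ f′) +ₚ (0ℚ ∷ (f *ₚ f′))) ∘ₚ g                              ≈⟨ ∘-+ₚ (a ·ₚ f′) (0ℚ ∷ (f *ₚ f′)) g ⟩
    ((a ·ₚ f′) ∘ₚ g) +ₚ ((0ℚ ∷ (f *ₚ f′)) ∘ₚ g)                       ≈⟨ +ₚ-cong (∘-·ₚ a f′ g) (∘-shift (f *ₚ f′) g) ⟩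
    ((a ∷ []) *ₚ (f′ ∘ₚ g)) +ₚ (g *ₚ ((f *ₚ f′) ∘ₚ g))                ≈⟨ +ₚ-cong ≋-refl (*ₚ-congʳ g (∘-*ₚ f f′ g)) ⟩
    ((a ∷ []) *ₚ (f′ ∘ₚ g)) +ₚ (g *ₚ ((f ∘ₚ g) *ₚ (f′ ∘ₚ g)))         ≈⟨ solve 4 (λ a f′ g f → a :* f′ :+ g :* (f :* f′) := (a :+ g :* f) :* f′) ≋-refl (a ∷ []) (f′ ∘ₚ g) g (f ∘ₚ g) ⟩
    ((a ∷ f) ∘ₚ g) *ₚ (f′ ∘ₚ g)                                       ∎
    where
    open ≋-Reasoning
    open PolySolver

  ∘-neg : ∀ f g → ((-ₚ f) ∘ₚ g) ≋ (-ₚ (f ∘ₚ g))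
  ∘-neg f g = ≋-trans (∘-·ₚ (- 1ℚ) f g) (const-*ₚ (- 1ℚ) (f ∘ₚ g))

  unit-≋ : ∀ f g → f ≋ g → IsUnitₚ g → IsUnitₚ f
  unit-≋ f g e ug = unit-*ₚˡ {f} {oneₚ} {g} ug (≋-trans (≋-trans (*ₚ-comm f oneₚ) (*ₚ-identityˡ f)) e)

  ∘-unit : ∀ f g → IsUnitₚ f → IsUnitₚ (f ∘ₚ g)
  ∘-unit f g (f′ , e) = (f′ ∘ₚ g) , at prod
    where
    open ≋-Reasoning
    ff′≋1 : (f *ₚ f′) ≋ oneₚ
    ff′≋1 = ⟪ e ⟫
    prod : ((f ∘ₚ g) *ₚ (f′ ∘ₚ g)) ≋ oneₚ
    prod = begin
      (f ∘ₚ g) *ₚ (f′ ∘ₚ g)   ≈⟨ ∘-*ₚ f f′ g ⟨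
      (f *ₚ f′) ∘ₚ g          ≈⟨ ∘-cong g ff′≋1 ⟩
      oneₚ ∘ₚ g               ≈⟨ ∘-const 1ℚ g ⟩
      oneₚ                    ∎

  -- Uniqueness of division by `g`: from degree `n` on `l` contributes nothing, so the top
  -- coefficient of g H vanishes, and with it that of `H`.
  remainder-zero : ∀ {n g} l H → HasDegree n g → Below n l → (l +ₚ (g *ₚ H)) ≋ [] → H ≋ []
  remainder-zero {n} {g} l H (gn & bg) bl e = downward-zero λ m bH → *-cancelˡ-0 gn (begin
    coeff g n * coeff H m                              ≡⟨ coeff-*ₚ-top n m g H bg bH ⟨
    coeff (g *ₚ H) (n ℕ.+ m)                           ≡⟨ +-identityˡ _ ⟨
    0ℚ + coeff (g *ₚ H) (n ℕ.+ m)                      ≡⟨ cong (_+ coeff (g *ₚ H) (n ℕ.+ m)) (bl (n ℕ.+ m) (ℕ.m≤m+n n m)) ⟨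
    coeff l (n ℕ.+ m) + coeff (g *ₚ H) (n ℕ.+ m)       ≡⟨ coeff-+ l (g *ₚ H) (n ℕ.+ m) ⟨
    coeff (l +ₚ (g *ₚ H)) (n ℕ.+ m)                    ≡⟨ at e (n ℕ.+ m) ⟩
    0ℚ                                                 ∎)
    where open ≡-Reasoning

  remainder-zeroˡ : ∀ {n g} l H → HasDegree n g → Below n l → (l +ₚ (g *ₚ H)) ≋ [] → l ≋ []
  remainder-zeroˡ {n} {g} l H dg bl e = begin
    l                ≈⟨ +ₚ-identityʳ l ⟨
    l +ₚ []          ≈⟨ +ₚ-cong (≋-refl {l}) (≋-sym (≋-trans (*ₚ-congʳ g (remainder-zero l H dg bl e)) (*ₚ-zeroʳ g))) ⟩
    l +ₚ (g *ₚ H)    ≈⟨ e ⟩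
    []               ∎
    where open ≋-Reasoning

  X : Poly
  X = 0ℚ ∷ oneₚ

  X-*ₚ : ∀ a f → (a ∷ f) ≋ ((a ∷ []) +ₚ (X *ₚ f))
  X-*ₚ a f = ≋-sym (begin
    (a ∷ []) +ₚ (X *ₚ f)    ≈⟨ +ₚ-cong (≋-refl {a ∷ []}) (≋-trans (shift-*ₚ oneₚ f) (shift-cong (*ₚ-identityˡ f))) ⟩
    (a ∷ []) +ₚ (0ℚ ∷ f)    ≈⟨ ∷-cong (+-identityʳ a) ≋-refl ⟩
    a ∷ f                   ∎)
    where open ≋-Reasoning

  -- In a + g · f(g) = 0 the constant a is a remainder modulo `g`, so it vanishes and f(g) = 0 holds
  -- for the tail.
  ∘-nonconstant-zero : ∀ {n g} f → HasDegree (suc n) g → (f ∘ₚ g) ≋ [] → f ≋ []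
  ∘-nonconstant-zero [] dg e = ≋-refl
  ∘-nonconstant-zero {n} {g} (a ∷ f) dg e = ⟪ (λ { zero → at (remainder-zeroˡ (a ∷ []) (f ∘ₚ g) dg b e) 0
      ; (suc n) → at (∘-nonconstant-zero f dg (remainder-zero (a ∷ []) (f ∘ₚ g) dg b e)) n }) ⟫
    where
    b : Below (suc n) (a ∷ [])
    b (suc j) _ = refl

  ≋⇒-ₚ≋[] : ∀ {f g} → f ≋ g → (f +ₚ (-ₚ g)) ≋ []
  ≋⇒-ₚ≋[] {f} {g} e = ≋-trans (+ₚ-cong e (≋-refl { -ₚ g})) (+ₚ-inverseʳ g)

  ∘-injective : ∀ {n g} f f′ → HasDegree (suc n) g → (f ∘ₚ g) ≋ (f′ ∘ₚ g) → f ≋ f′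
  ∘-injective {n} {g} f f′ dg e = -ₚ-≋[] (∘-nonconstant-zero (f +ₚ (-ₚ f′)) dg
    (≋-trans (∘-+ₚ f (-ₚ f′) g) (≋-trans (+ₚ-cong (≋-refl {f ∘ₚ g}) (∘-neg f′ g)) (≋⇒-ₚ≋[] e))))

  -- Substituting a linear polynomial.

  module Linear (g : Poly) (dg : HasDegree 1 g) (k : ℚ) (lead*k≡1 : coeff g 1 * k ≡ 1ℚ) where
    open HasDegree dg

    X≋ : X ≋ (((- (k * coeff g 0)) ∷ []) +ₚ ((k ∷ []) *ₚ g))
    X≋ = ⟪ (λ n → sym (trans (coeff-+ ((- (k * coeff g 0)) ∷ []) ((k ∷ []) *ₚ g) n)
        (trans (cong (coeff ((- (k * coeff g 0)) ∷ []) n +_) (trans (at (const-*ₚ k g) n) (coeff-· k g n))) (go n)))) ⟫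
      where
      go : ∀ n → coeff ((- (k * coeff g 0)) ∷ []) n + k * coeff g n ≡ coeff X n
      go zero = solve 1 (λ a → (:- a) :+ a := con 0ℚ) refl (k * coeff g 0)
        where open +-*-Solver
      go (suc zero) = trans (+-identityˡ _) (trans (*-comm k _) lead*k≡1)
      go (suc (suc n)) = trans (+-identityˡ _) (trans (cong (k *_) (bounded (suc (suc n)) (s≤s (s≤s z≤n)))) (*-zeroʳ k))

    -- x is itself a linear polynomial `Y` evaluated at `g`, hence so is every polynomial in x.
    -- Substitution is thus an automorphism, and factorisations can be carried back along it.
    decompose : ∀ G → ∃ λ A → G ≋ (A ∘ₚ g)
    decompose [] = [] , ≋-refl
    decompose (u ∷ G) with A , e ← decompose G = ((u ∷ []) +ₚ (Y *ₚ A)) , (begin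
      u ∷ G                                      ≈⟨ X-*ₚ u G ⟩
      (u ∷ []) +ₚ (X *ₚ G)                       ≈⟨ +ₚ-cong (≋-sym (∘-const u g)) (*ₚ-cong X≋Y e) ⟩
      ((u ∷ []) ∘ₚ g) +ₚ ((Y ∘ₚ g) *ₚ (A ∘ₚ g))  ≈⟨ +ₚ-cong ≋-refl (≋-sym (∘-*ₚ Y A g)) ⟩
      ((u ∷ []) ∘ₚ g) +ₚ ((Y *ₚ A) ∘ₚ g)         ≈⟨ ∘-+ₚ (u ∷ []) (Y *ₚ A) g ⟨
      ((u ∷ []) +ₚ (Y *ₚ A)) ∘ₚ g                ∎)
      where
      open ≋-Reasoning
      Y = (- (k * coeff g 0)) ∷ k ∷ []
      X≋Y : X ≋ (Y ∘ₚ g)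
      X≋Y = ≋-trans X≋ (+ₚ-cong (≋-refl {(- (k * coeff g 0)) ∷ []}) (≋-trans (*ₚ-comm (k ∷ []) g) (*ₚ-congʳ g (≋-sym (∘-const k g)))))

    irreducible-∘ : ∀ {f} → Irreducible f → Irreducible (f ∘ₚ g)
    irreducible-∘ {f} (f≢0 , f∤1 , irr) = (λ z → f≢0 (at (∘-nonconstant-zero f dg ⟪ z ⟫))) , notUnit , split
      where
      open ≋-Reasoning
      notUnit : ¬ IsUnitₚ (f ∘ₚ g)
      notUnit (H , e) = f∤1 (A , at (∘-injective (f *ₚ A) oneₚ dg fA≋1))
        where
        A = proj₁ (decompose H)
        fH≋1 : ((f ∘ₚ g) *ₚ H) ≋ oneₚ
        fH≋1 = ⟪ e ⟫
        fA≋1 : ((f *ₚ A) ∘ₚ g) ≋ (oneₚ ∘ₚ g)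
        fA≋1 = begin
          (f *ₚ A) ∘ₚ g           ≈⟨ ∘-*ₚ f A g ⟩
          (f ∘ₚ g) *ₚ (A ∘ₚ g)    ≈⟨ *ₚ-congʳ (f ∘ₚ g) (proj₂ (decompose H)) ⟨
          (f ∘ₚ g) *ₚ H           ≈⟨ fH≋1 ⟩
          oneₚ                    ≈⟨ ∘-const 1ℚ g ⟨
          oneₚ ∘ₚ g               ∎
      split : ∀ G H → (f ∘ₚ g) ≈ₚ (G *ₚ H) → IsUnitₚ G ⊎ IsUnitₚ H
      split G H e = Sum.map (λ uA → unit-≋ G (A ∘ₚ g) (proj₂ (decompose G)) (∘-unit A g uA))
                            (λ uB → unit-≋ H (B ∘ₚ g) (proj₂ (decompose H)) (∘-unit B g uB))
                            (irr A B (at (∘-injective f (A *ₚ B) dg f≋AB)))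
        where
        A = proj₁ (decompose G)
        B = proj₁ (decompose H)
        f≋GH : (f ∘ₚ g) ≋ (G *ₚ H)
        f≋GH = ⟪ e ⟫
        f≋AB : (f ∘ₚ g) ≋ ((A *ₚ B) ∘ₚ g)
        f≋AB = begin
          f ∘ₚ g                  ≈⟨ f≋GH ⟩
          G *ₚ H                  ≈⟨ *ₚ-cong (proj₂ (decompose G)) (proj₂ (decompose H)) ⟩
          (A ∘ₚ g) *ₚ (B ∘ₚ g)    ≈⟨ ∘-*ₚ A B g ⟨
          (A *ₚ B) ∘ₚ g           ∎

  -- Substituting a quadratic: ℚ[x] as a quadratic extension of ℚ[g].

  module Quadratic (g : Poly) (dg : HasDegree 2 g)
    (k : ℚ) (lead*k≡1 : coeff g 2 * k ≡ 1ℚ) (h : ℚ) (h+h≡ : h + h ≡ k * coeff g 1) where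
    open HasDegree dg

    -- Since k g = x² + 2 h x + k g₀, completing the square gives (x + h)² = k g + (h² - k g₀),
    -- which is `L` evaluated at `g`.
    ξ L : Poly
    ξ = h ∷ oneₚ
    L = (h * h + - (k * coeff g 0)) ∷ k ∷ []

    ξ²≋L∘g : (ξ *ₚ ξ) ≋ (L ∘ₚ g)
    ξ²≋L∘g = ≋-sym (≋-trans (+ₚ-cong (≋-refl {l₀ ∷ []}) (≋-trans (*ₚ-congʳ g (∘-const k g)) (*ₚ-comm g (k ∷ []))))
        ⟪ (λ n → trans (coeff-+ (l₀ ∷ []) ((k ∷ []) *ₚ g) n)
          (trans (cong (coeff (l₀ ∷ []) n +_) (trans (at (const-*ₚ k g) n) (coeff-· k g n))) (go n))) ⟫)
      where
      open +-*-Solver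
      l₀ = h * h + - (k * coeff g 0)
      go : ∀ n → coeff (l₀ ∷ []) n + k * coeff g n ≡ coeff (ξ *ₚ ξ) n
      go zero = solve 2 (λ x a → (x :+ :- a) :+ a := x :+ con 0ℚ) refl (h * h) (k * coeff g 0)
      go (suc zero) = trans (+-identityˡ _) (trans (sym h+h≡) (solve 1 (λ h → h :+ h := h :* con 1ℚ :+ (con 1ℚ :* h :+ con 0ℚ)) refl h))
      go (suc (suc zero)) = trans (+-identityˡ _) (trans (*-comm k _) lead*k≡1)
      go (suc (suc (suc n))) = trans (+-identityˡ _) (trans (cong (k *_) (bounded (suc (suc (suc n))) (s≤s (s≤s (s≤s z≤n))))) (*-zeroʳ k))

    -- The element A + B √L of ℚ[y][√L], with y sent to `g` and √L to `ξ`. By `decompose` and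
    -- `Φ-injective` every polynomial has exactly one such pair of coordinates.
    Φ : Poly → Poly → Poly
    Φ A B = (A ∘ₚ g) +ₚ (ξ *ₚ (B ∘ₚ g))

    Φ-*ₚ : ∀ A B A′ B′ → (Φ A B *ₚ Φ A′ B′) ≋ Φ ((A *ₚ A′) +ₚ (L *ₚ (B *ₚ B′))) ((A *ₚ B′) +ₚ (A′ *ₚ B))
    Φ-*ₚ A B A′ B′ = begin
      Φ A B *ₚ Φ A′ B′
        ≈⟨ solve 5 (λ a b a′ b′ x → (a :+ x :* b) :* (a′ :+ x :* b′) := (a :* a′ :+ (x :* x) :* (b :* b′)) :+ x :* (a :* b′ :+ a′ :* b)) ≋-refl (A ∘ₚ g) (B ∘ₚ g) (A′ ∘ₚ g) (B′ ∘ₚ g) ξ ⟩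
      (((A ∘ₚ g) *ₚ (A′ ∘ₚ g)) +ₚ ((ξ *ₚ ξ) *ₚ ((B ∘ₚ g) *ₚ (B′ ∘ₚ g)))) +ₚ (ξ *ₚ (((A ∘ₚ g) *ₚ (B′ ∘ₚ g)) +ₚ ((A′ ∘ₚ g) *ₚ (B ∘ₚ g))))
        ≈⟨ +ₚ-cong (+ₚ-cong (∘-*ₚ A A′ g) (≋-trans (∘-*ₚ L (B *ₚ B′) g) (*ₚ-cong (≋-sym ξ²≋L∘g) (∘-*ₚ B B′ g))))
                   (*ₚ-congʳ ξ (+ₚ-cong (∘-*ₚ A B′ g) (∘-*ₚ A′ B g))) ⟨
      (((A *ₚ A′) ∘ₚ g) +ₚ ((L *ₚ (B *ₚ B′)) ∘ₚ g)) +ₚ (ξ *ₚ (((A *ₚ B′) ∘ₚ g) +ₚ ((A′ *ₚ B) ∘ₚ g)))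
        ≈⟨ +ₚ-cong (∘-+ₚ (A *ₚ A′) (L *ₚ (B *ₚ B′)) g) (*ₚ-congʳ ξ (∘-+ₚ (A *ₚ B′) (A′ *ₚ B) g)) ⟨
      Φ ((A *ₚ A′) +ₚ (L *ₚ (B *ₚ B′))) ((A *ₚ B′) +ₚ (A′ *ₚ B)) ∎
      where
      open ≋-Reasoning
      open PolySolver

    Φ-+ₚ : ∀ A B A′ B′ → (Φ A B +ₚ Φ A′ B′) ≋ Φ (A +ₚ A′) (B +ₚ B′)
    Φ-+ₚ A B A′ B′ = ≋-trans
      (solve 5 (λ a b a′ b′ x → (a :+ x :* b) :+ (a′ :+ x :* b′) := (a :+ a′) :+ x :* (b :+ b′)) ≋-refl (A ∘ₚ g) (B ∘ₚ g) (A′ ∘ₚ g) (B′ ∘ₚ g) ξ)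
      (≋-sym (+ₚ-cong (∘-+ₚ A A′ g) (*ₚ-congʳ ξ (∘-+ₚ B B′ g))))
      where open PolySolver

    Φ-cong : ∀ {A B A′ B′} → A ≋ A′ → B ≋ B′ → Φ A B ≋ Φ A′ B′
    Φ-cong e e′ = +ₚ-cong (∘-cong g e) (*ₚ-congʳ ξ (∘-cong g e′))

    Φ-[] : ∀ A → Φ A [] ≋ (A ∘ₚ g)
    Φ-[] A = ≋-trans (+ₚ-cong (≋-refl {A ∘ₚ g}) (*ₚ-zeroʳ ξ)) (+ₚ-identityʳ (A ∘ₚ g))

    Φ-const : ∀ c → Φ (c ∷ []) [] ≋ (c ∷ [])
    Φ-const c = ≋-trans (Φ-[] (c ∷ [])) (∘-const c g)

    X≋Φ : X ≋ Φ ((- h) ∷ []) oneₚ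
    X≋Φ = begin
      X                         ≈⟨ ∷-cong (sym (+-inverseˡ h)) ≋-refl ⟩
      ((- h) ∷ []) +ₚ ξ         ≈⟨ +ₚ-cong (≋-refl {(- h) ∷ []}) (≋-trans (≋-sym (*ₚ-identityˡ ξ)) (*ₚ-comm oneₚ ξ)) ⟩
      ((- h) ∷ []) +ₚ (ξ *ₚ oneₚ)  ≈⟨ +ₚ-cong (∘-const (- h) g) (*ₚ-congʳ ξ (∘-const 1ℚ g)) ⟨
      Φ ((- h) ∷ []) oneₚ       ∎
      where open ≋-Reasoning

    -- x = ξ - h has coordinates (-h, 1), and sums and products of elements with coordinates have
    -- coordinates, so Horner's scheme reaches every polynomial.
    decompose : ∀ G → ∃ λ A → ∃ λ B → G ≋ Φ A B
    decompose [] = [] , [] , ≋-sym (*ₚ-zeroʳ ξ)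
    decompose (u ∷ G) = ((u ∷ []) +ₚ A″) , B″ , (begin
      u ∷ G                                   ≈⟨ X-*ₚ u G ⟩
      (u ∷ []) +ₚ (X *ₚ G)                    ≈⟨ +ₚ-cong (≋-sym (Φ-const u)) (*ₚ-cong X≋Φ G≋) ⟩
      Φ (u ∷ []) [] +ₚ (Φ ((- h) ∷ []) oneₚ *ₚ Φ A B)  ≈⟨ +ₚ-cong (≋-refl {Φ (u ∷ []) []}) (Φ-*ₚ ((- h) ∷ []) oneₚ A B) ⟩
      Φ (u ∷ []) [] +ₚ Φ A″ B″                ≈⟨ Φ-+ₚ (u ∷ []) [] A″ B″ ⟩
      Φ ((u ∷ []) +ₚ A″) B″                   ∎)
      where
      open ≋-Reasoning
      A = proj₁ (decompose G)
      B = proj₁ (proj₂ (decompose G))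
      G≋ = proj₂ (proj₂ (decompose G))
      A″ = (((- h) ∷ []) *ₚ A) +ₚ (L *ₚ (oneₚ *ₚ B))
      B″ = (((- h) ∷ []) *ₚ B) +ₚ (A *ₚ oneₚ)

    -- The lowest coefficients contribute a + b ξ, of degree below 2, and the rest is a multiple of
    -- `g`. Uniqueness of division separates the two, one coefficient of `A` and of `B` at a time; a
    -- list that ends first is padded with zero.
    Φ-zero : ∀ A B → Φ A B ≋ [] → A ≋ [] × B ≋ []
    Φ-zero-step : ∀ a A b B → Φ (a ∷ A) (b ∷ B) ≋ [] → (a ≡ 0ℚ × b ≡ 0ℚ) × Φ A B ≋ []
    Φ-zero-step a A b B e = (a≡0 , b≡0) , remainder-zero l (Φ A B) dg bl e′
      where
      l = (a ∷ []) +ₚ (ξ *ₚ (b ∷ []))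
      bl : Below 2 l
      bl (suc zero) (s≤s ())
      bl (suc (suc j)) _ = refl
      e′ : (l +ₚ (g *ₚ Φ A B)) ≋ []
      e′ = ≋-trans (solve 6 (λ a b x g A B → (a :+ x :* b) :+ g :* (A :+ x :* B) := (a :+ g :* A) :+ x :* (b :+ g :* B)) ≋-refl (a ∷ []) (b ∷ []) ξ g (A ∘ₚ g) (B ∘ₚ g)) e
        where open PolySolver
      l≋[] : l ≋ []
      l≋[] = remainder-zeroˡ l (Φ A B) dg bl e′
      open +-*-Solver
      b≡0 : b ≡ 0ℚ
      b≡0 = trans (solve 1 (λ b → b := con 1ℚ :* b :+ con 0ℚ) refl b) (at l≋[] 1)
      a≡0 : a ≡ 0ℚ
      a≡0 = trans (solve 2 (λ a h → a := a :+ (h :* con 0ℚ :+ con 0ℚ)) refl a h) (trans (cong (λ b → a + (h * b + 0ℚ)) (sym b≡0)) (at l≋[] 0))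
    Φ-zero [] [] e = ≋-refl , ≋-refl
    Φ-zero [] (b ∷ B) e = ≋-refl , ≋-trans (∷-cong (proj₂ (proj₁ s)) (proj₂ (Φ-zero [] B (proj₂ s)))) shift-[]
      where s = Φ-zero-step 0ℚ [] b B (≋-trans (Φ-cong shift-[] (≋-refl {b ∷ B})) e)
    Φ-zero (a ∷ A) [] e = ≋-trans (∷-cong (proj₁ (proj₁ s)) (proj₁ (Φ-zero A [] (proj₂ s)))) shift-[] , ≋-refl
      where s = Φ-zero-step a A 0ℚ [] (≋-trans (Φ-cong (≋-refl {a ∷ A}) shift-[]) e)
    Φ-zero (a ∷ A) (b ∷ B) e =
        ≋-trans (∷-cong (proj₁ (proj₁ s)) (proj₁ rest)) shift-[]
      , ≋-trans (∷-cong (proj₂ (proj₁ s)) (proj₂ rest)) shift-[]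
      where
      s = Φ-zero-step a A b B e
      rest = Φ-zero A B (proj₂ s)

    Φ-injective : ∀ A B A′ B′ → Φ A B ≋ Φ A′ B′ → A ≋ A′ × B ≋ B′
    Φ-injective A B A′ B′ e = -ₚ-≋[] (proj₁ both) , -ₚ-≋[] (proj₂ both)
      where
      open ≋-Reasoning
      open PolySolver
      both = Φ-zero (A +ₚ (-ₚ A′)) (B +ₚ (-ₚ B′)) (begin
        Φ (A +ₚ (-ₚ A′)) (B +ₚ (-ₚ B′))                       ≈⟨ Φ-+ₚ A B (-ₚ A′) (-ₚ B′) ⟨
        Φ A B +ₚ (((-ₚ A′) ∘ₚ g) +ₚ (ξ *ₚ ((-ₚ B′) ∘ₚ g)))    ≈⟨ +ₚ-cong e (+ₚ-cong (∘-neg A′ g) (*ₚ-congʳ ξ (∘-neg B′ g))) ⟩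
        Φ A′ B′ +ₚ ((-ₚ (A′ ∘ₚ g)) +ₚ (ξ *ₚ (-ₚ (B′ ∘ₚ g))))  ≈⟨ +ₚ-cong (≋-refl {Φ A′ B′}) (solve 3 (λ a b x → (:- a) :+ x :* (:- b) := :- (a :+ x :* b)) ≋-refl (A′ ∘ₚ g) (B′ ∘ₚ g) ξ) ⟩
        Φ A′ B′ +ₚ (-ₚ Φ A′ B′)                               ≈⟨ +ₚ-inverseʳ (Φ A′ B′) ⟩
        []                                                    ∎)

    norm : Poly → Poly → Poly
    norm A B = (A *ₚ A) +ₚ (-ₚ (L *ₚ (B *ₚ B)))

    Φ-conjugate : ∀ A B → (Φ A B *ₚ Φ A (-ₚ B)) ≋ (norm A B ∘ₚ g)
    Φ-conjugate A B = begin
      Φ A B *ₚ Φ A (-ₚ B)                                                     ≈⟨ Φ-*ₚ A B A (-ₚ B) ⟩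
      Φ ((A *ₚ A) +ₚ (L *ₚ (B *ₚ (-ₚ B)))) ((A *ₚ (-ₚ B)) +ₚ (A *ₚ B))        ≈⟨ Φ-cong
          (solve 3 (λ a b l → a :* a :+ l :* (b :* (:- b)) := a :* a :+ :- (l :* (b :* b))) ≋-refl A B L)
          (≋-trans (solve 2 (λ a b → a :* (:- b) :+ a :* b := (a :* b) :+ :- (a :* b)) ≋-refl A B) (+ₚ-inverseʳ (A *ₚ B))) ⟩
      Φ (norm A B) []                                                         ≈⟨ Φ-[] (norm A B) ⟩
      norm A B ∘ₚ g                                                           ∎
      where
      open ≋-Reasoning
      open PolySolver

    -- Brahmagupta's identity N N′ = P² - L Q², with P and Q the coordinates of the product; the
    -- hypotheses say P = f and Q = 0.
    norm-*ₚ : ∀ A B A′ B′ {f} → ((A *ₚ A′) +ₚ (L *ₚ (B *ₚ B′))) ≋ f → ((A *ₚ B′) +ₚ (A′ *ₚ B)) ≋ []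
            → (norm A B *ₚ norm A′ B′) ≋ (f *ₚ f)
    norm-*ₚ A B A′ B′ {f} e e′ = begin
      norm A B *ₚ norm A′ B′                   ≈⟨ solve 5 (λ a b a′ b′ l →
          (a :* a :+ :- (l :* (b :* b))) :* (a′ :* a′ :+ :- (l :* (b′ :* b′)))
          := (a :* a′ :+ l :* (b :* b′)) :* (a :* a′ :+ l :* (b :* b′)) :+ (a :* b′ :+ a′ :* b) :* :- (l :* (a :* b′ :+ a′ :* b))) ≋-refl A B A′ B′ L ⟩
      (P *ₚ P) +ₚ (Q *ₚ (-ₚ (L *ₚ Q)))         ≈⟨ +ₚ-cong (*ₚ-cong e e) (*ₚ-cong e′ (≋-refl { -ₚ (L *ₚ Q)})) ⟩
      (f *ₚ f) +ₚ []                           ≈⟨ +ₚ-identityʳ (f *ₚ f) ⟩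
      f *ₚ f                                   ∎
      where
      open ≋-Reasoning
      open PolySolver
      P = (A *ₚ A′) +ₚ (L *ₚ (B *ₚ B′))
      Q = (A *ₚ B′) +ₚ (A′ *ₚ B)

    module _ {f : Poly} (irreducible : Irreducible f) where
      f≢0 : ¬ (f ≋ [])
      f≢0 e = proj₁ irreducible (at e)

      -- The coordinate of f(g) H = 1 without ξ would exhibit an inverse of `f`.
      ∘-not-unit : ¬ IsUnitₚ (f ∘ₚ g)
      ∘-not-unit (H , e) = proj₁ (proj₂ irreducible) (A , at fA≋1)
        where
        open ≋-Reasoning
        A = proj₁ (decompose H)
        B = proj₁ (proj₂ (decompose H))
        fH≋1 : ((f ∘ₚ g) *ₚ H) ≋ oneₚ
        fH≋1 = ⟪ e ⟫
        fA≋1 : (f *ₚ A) ≋ oneₚ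
        fA≋1 = ≋-trans (≋-sym (≋-trans (+ₚ-cong (≋-refl {f *ₚ A}) (*ₚ-zeroʳ L)) (+ₚ-identityʳ (f *ₚ A))))
          (proj₁ (Φ-injective ((f *ₚ A) +ₚ (L *ₚ ([] *ₚ B))) ((f *ₚ B) +ₚ (A *ₚ [])) oneₚ [] (begin
            Φ ((f *ₚ A) +ₚ (L *ₚ ([] *ₚ B))) ((f *ₚ B) +ₚ (A *ₚ []))   ≈⟨ Φ-*ₚ f [] A B ⟨
            Φ f [] *ₚ Φ A B                                            ≈⟨ *ₚ-cong (Φ-[] f) (≋-sym (proj₂ (proj₂ (decompose H)))) ⟩
            (f ∘ₚ g) *ₚ H                                              ≈⟨ fH≋1 ⟩
            oneₚ                                                       ≈⟨ Φ-const 1ℚ ⟨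
            Φ oneₚ []                                                  ∎)))

      -- Dividing N N′ = f² by f leaves N M = f, and f is irreducible.
      norm-associate : ∀ A B A′ B′ G → G ≋ Φ A B → f ∣ₚ norm A′ B′ → (norm A B *ₚ norm A′ B′) ≋ (f *ₚ f)
        → IsUnitₚ G ⊎ ∃ λ M → IsUnitₚ M × norm A′ B′ ≋ (M *ₚ f)
      norm-associate A B A′ B′ G G≋ (M , N′≋fM) NN′≋ff = Sum.map
          (λ uN → unit-*ₚˡ {G} {Φ A (-ₚ B)} {norm A B ∘ₚ g} (∘-unit (norm A B) g uN)
                    (≋-trans (*ₚ-cong G≋ (≋-refl {Φ A (-ₚ B)})) (Φ-conjugate A B)))
          (λ uM → M , uM , ≋-trans N′≋fM (*ₚ-comm f M))
          (proj₂ (proj₂ irreducible) (norm A B) M (at f≋NM))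
        where
        open ≋-Reasoning
        open PolySolver
        f≋NM : f ≋ (norm A B *ₚ M)
        f≋NM = *ₚ-cancelˡ f≢0 (begin
          f *ₚ f                    ≈⟨ NN′≋ff ⟨
          norm A B *ₚ norm A′ B′    ≈⟨ *ₚ-congʳ (norm A B) N′≋fM ⟩
          norm A B *ₚ (f *ₚ M)      ≈⟨ solve 3 (λ n f m → n :* (f :* m) := f :* (n :* m)) ≋-refl (norm A B) f M ⟩
          f *ₚ (norm A B *ₚ M)      ∎)

      -- The two norms multiply to f², so `f` divides one of them. That norm is not a unit multiple
      -- of `f` by hypothesis, and `norm-associate` then makes the opposite factor a unit.
      irreducible-∘ : (∀ A B M → IsUnitₚ M → ¬ (norm A B ≋ (M *ₚ f))) → Irreducible (f ∘ₚ g)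
      irreducible-∘ noNorm = (λ z → f≢0 (∘-nonconstant-zero f dg ⟪ z ⟫)) , ∘-not-unit , split
        where
        split : ∀ G H → (f ∘ₚ g) ≈ₚ (G *ₚ H) → IsUnitₚ G ⊎ IsUnitₚ H
        split G H e = go (euclid {f} {norm A₁ B₁} {norm A₂ B₂} irreducible (f , N₁N₂≋ff))
          where
          open ≋-Reasoning
          A₁ = proj₁ (decompose G)
          B₁ = proj₁ (proj₂ (decompose G))
          G≋ = proj₂ (proj₂ (decompose G))
          A₂ = proj₁ (decompose H)
          B₂ = proj₁ (proj₂ (decompose H))
          H≋ = proj₂ (proj₂ (decompose H))
          f≋GH : (f ∘ₚ g) ≋ (G *ₚ H)
          f≋GH = ⟪ e ⟫
          coords : (((A₁ *ₚ A₂) +ₚ (L *ₚ (B₁ *ₚ B₂))) ≋ f) × (((A₁ *ₚ B₂) +ₚ (A₂ *ₚ B₁)) ≋ [])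
          coords = Φ-injective ((A₁ *ₚ A₂) +ₚ (L *ₚ (B₁ *ₚ B₂))) ((A₁ *ₚ B₂) +ₚ (A₂ *ₚ B₁)) f [] (begin
            Φ ((A₁ *ₚ A₂) +ₚ (L *ₚ (B₁ *ₚ B₂))) ((A₁ *ₚ B₂) +ₚ (A₂ *ₚ B₁))  ≈⟨ Φ-*ₚ A₁ B₁ A₂ B₂ ⟨
            Φ A₁ B₁ *ₚ Φ A₂ B₂                                              ≈⟨ *ₚ-cong G≋ H≋ ⟨
            G *ₚ H                                                          ≈⟨ f≋GH ⟨
            f ∘ₚ g                                                          ≈⟨ Φ-[] f ⟨
            Φ f []                                                          ∎)
          N₁N₂≋ff : (norm A₁ B₁ *ₚ norm A₂ B₂) ≋ (f *ₚ f)
          N₁N₂≋ff = norm-*ₚ A₁ B₁ A₂ B₂ (proj₁ coords) (proj₂ coords)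
          excluded : ∀ {P : Set} A B → P ⊎ (∃ λ M → IsUnitₚ M × norm A B ≋ (M *ₚ f)) → P
          excluded A B (inj₁ p) = p
          excluded A B (inj₂ (M , uM , n)) = ⊥-elim (noNorm A B M uM n)
          go : f ∣ₚ norm A₁ B₁ ⊎ f ∣ₚ norm A₂ B₂ → IsUnitₚ G ⊎ IsUnitₚ H
          go (inj₁ d) = inj₂ (excluded A₁ B₁ (norm-associate A₂ B₂ A₁ B₁ H H≋ d (≋-trans (*ₚ-comm (norm A₂ B₂) (norm A₁ B₁)) N₁N₂≋ff)))
          go (inj₂ d) = inj₁ (excluded A₂ B₂ (norm-associate A₁ B₁ A₂ B₂ G G≋ d N₁N₂≋ff))

  -- Degree bounds forced by the norm form A² - (l + k y) B².

  module NormForm (l k : ℚ) (k≢0 : k ≢ 0ℚ) where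
    norm : Poly → Poly → Poly
    norm A B = (A *ₚ A) +ₚ (-ₚ ((l ∷ k ∷ []) *ₚ (B *ₚ B)))

    below-linear : Below 2 (l ∷ k ∷ [])
    below-linear (suc zero) (s≤s ())
    below-linear (suc (suc j)) _ = refl

    coeff-norm : ∀ A B n → coeff (norm A B) n ≡ coeff (A *ₚ A) n + (- 1ℚ) * coeff ((l ∷ k ∷ []) *ₚ (B *ₚ B)) n
    coeff-norm A B n = trans (coeff-+ (A *ₚ A) _ n) (cong (coeff (A *ₚ A) n +_) (coeff-· (- 1ℚ) ((l ∷ k ∷ []) *ₚ (B *ₚ B)) n))

    -- A² and (l + k y) B² have degrees of opposite parity, so their leading terms never cancel.
    lower-B : ∀ m A B → Below (suc m) A → Below (suc m) B → coeff (norm A B) (suc (m ℕ.+ m)) ≡ 0ℚ → Below m B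
    lower-B m A B bA bB e = below-step B bB (square≡0 (*-cancelˡ-0 k≢0 (begin
      k * (coeff B m * coeff B m)                                ≡⟨ cong (k *_) (coeff-*ₚ-top m m B B bB bB) ⟨
      k * coeff (B *ₚ B) (m ℕ.+ m)                               ≡⟨ coeff-*ₚ-top 1 (m ℕ.+ m) (l ∷ k ∷ []) (B *ₚ B) below-linear (below-*ₚ m m B B bB bB) ⟨
      coeff LBB (suc (m ℕ.+ m))                                  ≡⟨ solve 2 (λ x y → x := y :+ :- (y :+ con (- 1ℚ) :* x)) refl (coeff LBB (suc (m ℕ.+ m))) (coeff (A *ₚ A) (suc (m ℕ.+ m))) ⟩
      AA + - (AA + (- 1ℚ) * coeff LBB (suc (m ℕ.+ m)))           ≡⟨ cong₂ (λ x y → x + - y) (below-*ₚ m m A A bA bA (suc (m ℕ.+ m)) ℕ.≤-refl) (trans (sym (coeff-norm A B (suc (m ℕ.+ m)))) e) ⟩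
      0ℚ                                                         ∎)))
      where
      open ≡-Reasoning
      open +-*-Solver
      LBB = (l ∷ k ∷ []) *ₚ (B *ₚ B)
      AA = coeff (A *ₚ A) (suc (m ℕ.+ m))

    lower-A : ∀ m A B → Below (suc m) A → Below m B → coeff (norm A B) (m ℕ.+ m) ≡ 0ℚ → Below m A
    lower-A m A B bA bB e = below-step A bA (square≡0 (begin
      coeff A m * coeff A m                                      ≡⟨ coeff-*ₚ-top m m A A bA bA ⟨
      AA                                                         ≡⟨ solve 2 (λ x y → x := (x :+ con (- 1ℚ) :* y) :+ y) refl AA (coeff LBB (m ℕ.+ m)) ⟩
      (AA + (- 1ℚ) * coeff LBB (m ℕ.+ m)) + coeff LBB (m ℕ.+ m)  ≡⟨ cong₂ _+_ (trans (sym (coeff-norm A B (m ℕ.+ m))) e) (bLBB m bB) ⟩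
      0ℚ                                                         ∎))
      where
      open ≡-Reasoning
      open +-*-Solver
      LBB = (l ∷ k ∷ []) *ₚ (B *ₚ B)
      AA = coeff (A *ₚ A) (m ℕ.+ m)
      bLBB : ∀ m → Below m B → coeff LBB (m ℕ.+ m) ≡ 0ℚ
      bLBB zero b = at (≋-trans (*ₚ-congʳ (l ∷ k ∷ []) (*ₚ-cong (below-0 {B} b) (≋-refl {B}))) (*ₚ-zeroʳ (l ∷ k ∷ []))) 0
      bLBB (suc m) b = below-*ₚ 1 (m ℕ.+ m) (l ∷ k ∷ []) (B *ₚ B) below-linear (below-*ₚ m m B B b b) (suc m ℕ.+ suc m) (s≤s (ℕ.≤-reflexive (sym (ℕ.+-suc m m))))

    -- From a common bound on `A` and `B`, each round lowers `B` through an odd coefficient of the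
    -- norm and then `A` through the even coefficient below it, as long as these lie at or above 2t.
    norm-below : ∀ t A B → Below (t ℕ.+ t) (norm A B) → Below t A × Below t B
    norm-below t A B bN = go (a ℕ.+ b) (below-weaken {f = A} (≤″ (ℕ.m≤m+n a b)) (proj₂ (below-length A)))
                                       (below-weaken {f = B} (≤″ (ℕ.m≤n+m b a)) (proj₂ (below-length B)))
      where
      a = proj₁ (below-length A)
      b = proj₁ (below-length B)
      ≤″ : ∀ {x y} → x ≤ y → x ≤ y ℕ.+ t
      ≤″ {x} {y} x≤y = ℕ.≤-trans x≤y (ℕ.m≤m+n y t)
      go : ∀ m → Below (m ℕ.+ t) A → Below (m ℕ.+ t) B → Below t A × Below t B
      go zero bA bB = bA , bB
      go (suc m) bA bB = go m (lower-A (m ℕ.+ t) A B bA bB′ (bN _ 2t≤2s)) bB′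
        where
        2t≤2s : t ℕ.+ t ≤ (m ℕ.+ t) ℕ.+ (m ℕ.+ t)
        2t≤2s = ℕ.+-mono-≤ (ℕ.m≤n+m t m) (ℕ.m≤n+m t m)
        bB′ : Below (m ℕ.+ t) B
        bB′ = lower-B (m ℕ.+ t) A B bA bB (bN _ (ℕ.m≤n⇒m≤1+n 2t≤2s))

    norm-cong : ∀ {A A′ B B′} → A ≋ A′ → B ≋ B′ → norm A B ≋ norm A′ B′
    norm-cong {A} {A′} {B} {B′} e e′ = +ₚ-cong (*ₚ-cong e e) (·ₚ-cong refl (*ₚ-congʳ (l ∷ k ∷ []) (*ₚ-cong e′ e′)))

  -- From a norm equation to a rational point.

  ≋-list₁ : ∀ f → Below 1 f → f ≋ (coeff f 0 ∷ [])
  ≋-list₁ f b = ⟪ (λ { 0 → refl ; (suc n) → b (suc n) (s≤s z≤n) }) ⟫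

  ≋-list₂ : ∀ f → Below 2 f → f ≋ (coeff f 0 ∷ coeff f 1 ∷ [])
  ≋-list₂ f b = ⟪ (λ { 0 → refl ; 1 → refl ; (suc (suc n)) → b (suc (suc n)) (s≤s (s≤s z≤n)) }) ⟫

  ≋-list₃ : ∀ f → Below 3 f → f ≋ (coeff f 0 ∷ coeff f 1 ∷ coeff f 2 ∷ [])
  ≋-list₃ f b = ⟪ (λ { 0 → refl ; 1 → refl ; 2 → refl ; (suc (suc (suc n))) → b (suc (suc (suc n))) (s≤s (s≤s (s≤s z≤n))) }) ⟫

  below-unit-*ₚ : ∀ {n} M f → IsUnitₚ M → DegreeAtMost n f → DegreeAtMost n (M *ₚ f)
  below-unit-*ₚ {n} M f uM bf = below-*ₚ 0 n M f (HasDegree.bounded (unit-degree {M} uM)) bf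

  -- The curve w² = t⁴ + c in weighted coordinates t = x/y, w = z/y²; x ≠ 0 leaves out the points
  -- with t = 0, which exist when c is a square.
  NoRationalPoint : ℚ → Set
  NoRationalPoint c = ∀ x y z → x ≢ 0ℚ → y ≢ 0ℚ → z * z ≢ x * x * (x * x) + c * (y * y * (y * y))

  module _ (l k : ℚ) (k≢0 : k ≢ 0ℚ) where
    open NormForm l k k≢0

    -- The root y = −δ/ε of B turns A² − (l + k y) B² = γ² (y⁴ + c) into a rational point.
    quartic-equations : ∀ {c e} α β γ δ ε → c ≢ 0ℚ → e ≢ 0ℚ → NoRationalPoint c
      → γ * γ ≡ e
      → (β * γ + γ * β) + - (k * (ε * ε)) ≡ 0ℚ
      → (α * γ + β * β + γ * α) + - (l * (ε * ε) + k * (δ * ε + ε * δ)) ≡ 0ℚ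
      → (α * β + β * α) + - (l * (δ * ε + ε * δ) + k * (δ * δ)) ≡ 0ℚ
      → α * α + - (l * (δ * δ)) ≡ e * c
      → ⊥
    quartic-equations {c} {e} α β γ δ ε c≢0 e≢0 noPoint E₄ E₃ E₂ E₁ E₀ = case (ε ≟ 0ℚ) (δ ≟ 0ℚ)
      where
      open ≡-Reasoning
      open +-*-Solver
      γ≢0 : γ ≢ 0ℚ
      γ≢0 γ≡0 = e≢0 (trans (sym E₄) (trans (cong (_* γ) γ≡0) (*-zeroˡ γ)))
      2≢0 : 1ℚ + 1ℚ ≢ 0ℚ
      2≢0 ()
      ec≢0 : e * c ≢ 0ℚ
      ec≢0 = *-≢0 e≢0 c≢0
      -- For ε = 0 the equations force β = 0, then α = 0 and δ = 0, against `E₀`. For δ = 0 and ε ≠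
      -- 0 they give β ≠ 0, hence α = 0, against `E₀` again.
      ε≡0⇒β≡0 : ε ≡ 0ℚ → β ≡ 0ℚ
      ε≡0⇒β≡0 refl = *-cancelˡ-0 γ≢0 (*-cancelˡ-0 2≢0 (trans
        (solve 3 (λ β γ k → (con 1ℚ :+ con 1ℚ) :* (γ :* β) := (β :* γ :+ γ :* β) :+ :- (k :* (con 0ℚ :* con 0ℚ))) refl β γ k) E₃))
      ε≡0⇒α≡0 : ε ≡ 0ℚ → β ≡ 0ℚ → α ≡ 0ℚ
      ε≡0⇒α≡0 refl refl = *-cancelˡ-0 γ≢0 (*-cancelˡ-0 2≢0 (trans
        (solve 5 (λ α γ δ k l → (con 1ℚ :+ con 1ℚ) :* (γ :* α) := (α :* γ :+ con 0ℚ :* con 0ℚ :+ γ :* α) :+ :- (l :* (con 0ℚ :* con 0ℚ) :+ k :* (δ :* con 0ℚ :+ con 0ℚ :* δ))) refl α γ δ k l) E₂))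
      ε≡0⇒δ≡0 : ε ≡ 0ℚ → β ≡ 0ℚ → δ ≡ 0ℚ
      ε≡0⇒δ≡0 refl refl = square≡0 (*-cancelˡ-0 k≢0 (trans
        (solve 4 (λ α δ k l → k :* (δ :* δ) := :- ((α :* con 0ℚ :+ con 0ℚ :* α) :+ :- (l :* (δ :* con 0ℚ :+ con 0ℚ :* δ) :+ k :* (δ :* δ)))) refl α δ k l) (cong -_ E₁)))
      vanish : α ≡ 0ℚ → δ ≡ 0ℚ → ⊥
      vanish refl refl = ec≢0 (trans (sym E₀) (solve 1 (λ l → con 0ℚ :* con 0ℚ :+ :- (l :* (con 0ℚ :* con 0ℚ)) := con 0ℚ) refl l))
      δ≡0⇒βα≡0 : δ ≡ 0ℚ → β * α ≡ 0ℚ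
      δ≡0⇒βα≡0 refl = *-cancelˡ-0 2≢0 (trans
        (solve 5 (λ α β ε k l → (con 1ℚ :+ con 1ℚ) :* (β :* α) := (α :* β :+ β :* α) :+ :- (l :* (con 0ℚ :* ε :+ ε :* con 0ℚ) :+ k :* (con 0ℚ :* con 0ℚ))) refl α β ε k l) E₁)
      β≡0⇒ε≡0 : β ≡ 0ℚ → ε ≡ 0ℚ
      β≡0⇒ε≡0 refl = square≡0 (*-cancelˡ-0 k≢0 (trans
        (solve 3 (λ γ ε k → k :* (ε :* ε) := :- ((con 0ℚ :* γ :+ γ :* con 0ℚ) :+ :- (k :* (ε :* ε)))) refl γ ε k) (cong -_ E₃)))
      -- This is ε² A(-δ/ε). As B vanishes at -δ/ε, its square is ε⁴ times the norm at that point,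
      -- which is expanded below coefficient by coefficient.
      w : ℚ
      w = γ * (δ * δ) + - (β * (δ * ε)) + α * (ε * ε)
      w² : w * w ≡ (γ * γ) * (δ * δ * (δ * δ) + c * (ε * ε * (ε * ε)))
      w² = begin
        w * w
          ≡⟨ solve 7 (λ α β γ δ ε k l →
               (γ :* (δ :* δ) :+ :- (β :* (δ :* ε)) :+ α :* (ε :* ε)) :* (γ :* (δ :* δ) :+ :- (β :* (δ :* ε)) :+ α :* (ε :* ε))
               := (γ :* γ) :* (δ :* δ :* (δ :* δ))
                  :+ :- (((β :* γ :+ γ :* β) :+ :- (k :* (ε :* ε))) :* (δ :* δ :* δ :* ε))
                  :+ ((α :* γ :+ β :* β :+ γ :* α) :+ :- (l :* (ε :* ε) :+ k :* (δ :* ε :+ ε :* δ))) :* (δ :* δ :* ε :* ε)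
                  :+ :- (((α :* β :+ β :* α) :+ :- (l :* (δ :* ε :+ ε :* δ) :+ k :* (δ :* δ))) :* (δ :* ε :* ε :* ε))
                  :+ (α :* α :+ :- (l :* (δ :* δ))) :* (ε :* ε :* (ε :* ε))) refl α β γ δ ε k l ⟩
        (γ * γ) * D₄ + - (e₃ * D₃) + e₂ * D₂ + - (e₁ * D₁) + e₀ * D₀
          ≡⟨ cong₂ (λ x y → (γ * γ) * D₄ + - (x * D₃) + y * D₂ + - (e₁ * D₁) + e₀ * D₀) E₃ E₂ ⟩
        (γ * γ) * D₄ + - (0ℚ * D₃) + 0ℚ * D₂ + - (e₁ * D₁) + e₀ * D₀
          ≡⟨ cong₂ (λ x y → (γ * γ) * D₄ + - (0ℚ * D₃) + 0ℚ * D₂ + - (x * D₁) + y * D₀) E₁ (trans E₀ (cong (_* c) (sym E₄))) ⟩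
        (γ * γ) * D₄ + - (0ℚ * D₃) + 0ℚ * D₂ + - (0ℚ * D₁) + (γ * γ) * c * D₀
          ≡⟨ solve 7 (λ g c D₄ D₃ D₂ D₁ D₀ → g :* D₄ :+ :- (con 0ℚ :* D₃) :+ con 0ℚ :* D₂ :+ :- (con 0ℚ :* D₁) :+ g :* c :* D₀ := g :* (D₄ :+ c :* D₀)) refl (γ * γ) c D₄ D₃ D₂ D₁ D₀ ⟩
        (γ * γ) * (D₄ + c * D₀) ∎
        where
        D₄ = δ * δ * (δ * δ)
        D₃ = δ * δ * δ * ε
        D₂ = δ * δ * ε * ε
        D₁ = δ * ε * ε * ε
        D₀ = ε * ε * (ε * ε)
        e₃ = (β * γ + γ * β) + - (k * (ε * ε))
        e₂ = (α * γ + β * β + γ * α) + - (l * (ε * ε) + k * (δ * ε + ε * δ))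
        e₁ = (α * β + β * α) + - (l * (δ * ε + ε * δ) + k * (δ * δ))
        e₀ = α * α + - (l * (δ * δ))
      point : δ ≢ 0ℚ → ε ≢ 0ℚ → ⊥
      point δ≢0 ε≢0 = noPoint δ ε (w * i) δ≢0 ε≢0 (begin
        (w * i) * (w * i)                                                      ≡⟨ solve 2 (λ w i → (w :* i) :* (w :* i) := (w :* w) :* (i :* i)) refl w i ⟩
        (w * w) * (i * i)                                                      ≡⟨ cong (_* (i * i)) w² ⟩
        (γ * γ) * q * (i * i)                                                  ≡⟨ solve 3 (λ γ q i → (γ :* γ) :* q :* (i :* i) := ((γ :* i) :* (γ :* i)) :* q) refl γ q i ⟩
        ((γ * i) * (γ * i)) * q                                                ≡⟨ cong (λ x → (x * x) * q) γi≡1 ⟩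
        (1ℚ * 1ℚ) * q                                                          ≡⟨ *-identityˡ q ⟩
        q                                                                      ∎)
        where
        i = proj₁ (inverse γ≢0)
        γi≡1 = proj₂ (inverse γ≢0)
        q = δ * δ * (δ * δ) + c * (ε * ε * (ε * ε))
      case : Dec (ε ≡ 0ℚ) → Dec (δ ≡ 0ℚ) → ⊥
      case (yes ε≡0) _ = vanish (ε≡0⇒α≡0 ε≡0 β≡0) (ε≡0⇒δ≡0 ε≡0 β≡0)
        where β≡0 = ε≡0⇒β≡0 ε≡0
      case (no ε≢0) (yes δ≡0) = vanish (*-cancelˡ-0 (λ β≡0 → ε≢0 (β≡0⇒ε≡0 β≡0)) (δ≡0⇒βα≡0 δ≡0)) δ≡0
      case (no ε≢0) (no δ≢0) = point δ≢0 ε≢0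

  unit-const : ∀ {M} → IsUnitₚ M → M ≋ (coeff M 0 ∷ []) × coeff M 0 ≢ 0ℚ
  unit-const {M} uM = ≋-list₁ M (HasDegree.bounded (unit-degree {M} uM)) , HasDegree.lead≢0 (unit-degree {M} uM)

  below-x⁴+ : ∀ c → Below 5 (x⁴+ c)
  below-x⁴+ c 1 (s≤s ())
  below-x⁴+ c 2 (s≤s (s≤s ()))
  below-x⁴+ c 3 (s≤s (s≤s (s≤s ())))
  below-x⁴+ c 4 (s≤s (s≤s (s≤s (s≤s ()))))
  below-x⁴+ c (suc (suc (suc (suc (suc n))))) _ = refl

  module _ (l k : ℚ) (k≢0 : k ≢ 0ℚ) where
    open NormForm l k k≢0

    norm-quartic : ∀ {c} → c ≢ 0ℚ → NoRationalPoint c → ∀ A B M → IsUnitₚ M → ¬ (norm A B ≋ (M *ₚ x⁴+ c))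
    norm-quartic {c} c≢0 noPoint A B M uM N≋ =
      quartic-equations l k k≢0 α β γ δ ε c≢0 (proj₂ (unit-const {M} uM)) noPoint
        (trans (at E 4) (*-identityʳ e))
        (trans (solve 5 (λ β γ ε k l → (β :* γ :+ γ :* β) :+ :- (k :* (ε :* ε)) := (β :* γ :+ γ :* β) :+ con (- 1ℚ) :* (k :* (ε :* ε))) refl β γ ε k l) (trans (at E 3) (*-zeroʳ e)))
        (trans (solve 7 (λ α β γ δ ε k l → (α :* γ :+ β :* β :+ γ :* α) :+ :- (l :* (ε :* ε) :+ k :* (δ :* ε :+ ε :* δ))
            := (α :* γ :+ (β :* β :+ (γ :* α :+ con 0ℚ))) :+ con (- 1ℚ) :* (l :* (ε :* ε) :+ k :* (δ :* ε :+ (ε :* δ :+ con 0ℚ)))) refl α β γ δ ε k l) (trans (at E 2) (*-zeroʳ e)))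
        (trans (solve 6 (λ α β δ ε k l → (α :* β :+ β :* α) :+ :- (l :* (δ :* ε :+ ε :* δ) :+ k :* (δ :* δ))
            := (α :* β :+ (β :* α :+ con 0ℚ)) :+ con (- 1ℚ) :* (l :* (δ :* ε :+ (ε :* δ :+ con 0ℚ)) :+ (k :* (δ :* δ :+ con 0ℚ) :+ con 0ℚ))) refl α β δ ε k l) (trans (at E 1) (*-zeroʳ e)))
        (trans (solve 3 (λ α δ l → α :* α :+ :- (l :* (δ :* δ)) := (α :* α :+ con 0ℚ) :+ con (- 1ℚ) :* (l :* (δ :* δ :+ con 0ℚ) :+ con 0ℚ)) refl α δ l)
          (trans (at E 0) (+-identityʳ (e * c))))
      where
      open +-*-Solver
      bN : Below 5 (norm A B)
      bN = below-≋ (≋-sym N≋) (below-unit-*ₚ M (x⁴+ c) uM (below-x⁴+ c))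
      -- The norm has degree at most 4, below 6 = 3 + 3, so `A` and `B` are at most quadratic; its
      -- vanishing coefficient at y⁵ then makes `B` at most linear.
      bAB : Below 3 A × Below 3 B
      bAB = norm-below 3 A B (below-weaken {f = norm A B} (ℕ.n≤1+n 5) bN)
      bB : Below 2 B
      bB = lower-B 2 A B (proj₁ bAB) (proj₂ bAB) (bN 5 ℕ.≤-refl)
      α = coeff A 0
      β = coeff A 1
      γ = coeff A 2
      δ = coeff B 0
      ε = coeff B 1
      e = coeff M 0
      E : norm (α ∷ β ∷ γ ∷ []) (δ ∷ ε ∷ []) ≋ ((e ∷ []) *ₚ x⁴+ c)
      E = ≋-trans (≋-sym (norm-cong (≋-list₃ A (proj₁ bAB)) (≋-list₂ B bB)))
            (≋-trans N≋ (*ₚ-cong (proj₁ (unit-const {M} uM)) (≋-refl {x⁴+ c})))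

  inverse≢0 : ∀ {a b} → a * b ≡ 1ℚ → b ≢ 0ℚ
  inverse≢0 {a} ab≡1 refl = 1≢0 (trans (sym ab≡1) (*-zeroʳ a))

  irreducible-∘-quadratic : ∀ {c} → c ≢ 0ℚ → NoRationalPoint c → Irreducible (x⁴+ c)
    → ∀ g → HasDegree 2 g → Irreducible (x⁴+ c ∘ₚ g)
  irreducible-∘-quadratic {c} c≢0 noPoint irr g dg =
    Quadratic.irreducible-∘ g dg k k≡ h h+h≡ irr
      (norm-quartic (h * h + - (k * coeff g 0)) k (inverse≢0 {coeff g 2} k≡) c≢0 noPoint)
    where
    open +-*-Solver
    k = proj₁ (inverse (HasDegree.lead≢0 dg))
    k≡ = proj₂ (inverse (HasDegree.lead≢0 dg))
    h = ½ * (k * coeff g 1)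
    h+h≡ : h + h ≡ k * coeff g 1
    h+h≡ = solve 1 (λ a → con ½ :* a :+ con ½ :* a := a) refl (k * coeff g 1)

  irreducible-∘-linear : ∀ {f} → Irreducible f → ∀ g → HasDegree 1 g → Irreducible (f ∘ₚ g)
  irreducible-∘-linear {f} irr g dg =
    Linear.irreducible-∘ g dg (proj₁ (inverse (HasDegree.lead≢0 dg))) (proj₂ (inverse (HasDegree.lead≢0 dg))) {f} irr

  superirreducible : ∀ {c} → c ≢ 0ℚ → NoRationalPoint c → Irreducible (x⁴+ c) → Superirreducible 2 (x⁴+ c)
  superirreducible {c} c≢0 noPoint irr = irr , compose
    where
    compose : ∀ g → NonConstant g → DegreeAtMost 2 g → Irreducible (x⁴+ c ∘ₚ g)
    compose g nonConstant bg = go (coeff g 2 ≟ 0ℚ) nonConstant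
      where
      go : Dec (coeff g 2 ≡ 0ℚ) → NonConstant g → Irreducible (x⁴+ c ∘ₚ g)
      go (no g₂≢0) _ = irreducible-∘-quadratic c≢0 noPoint irr g (g₂≢0 & bg)
      go (yes g₂≡0) (1 , _ , g₁≢0) = irreducible-∘-linear {x⁴+ c} irr g (g₁≢0 & below-step g bg g₂≡0)
      go (yes g₂≡0) (suc (suc n) , _ , gₙ≢0) = ⊥-elim (gₙ≢0 (below-step g bg g₂≡0 (suc (suc n)) (s≤s (s≤s z≤n))))

  -- Irreducibility of y + c, y² + c and x⁴ + c.

  degree-0-unit : ∀ f → HasDegree 0 f → IsUnitₚ f
  degree-0-unit f (f₀≢0 & bf) = (i ∷ []) , at f*i≋1
    where
    i = proj₁ (inverse f₀≢0)
    f*i≋1 : (f *ₚ (i ∷ [])) ≋ oneₚ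
    f*i≋1 = ≋-trans (*ₚ-cong (≋-list₁ f bf) (≋-refl {i ∷ []})) (∷-cong (trans (+-identityʳ _) (proj₂ (inverse f₀≢0))) ≋-refl)

  irreducible-degree-1 : ∀ f → HasDegree 1 f → Irreducible f
  irreducible-degree-1 f df@(f₁≢0 & _) = (λ z → f₁≢0 (z 1)) , (λ uf → f₁≢0 (HasDegree.bounded (unit-degree {f} uf) 1 ℕ.≤-refl)) , split
    where
    split : ∀ g h → f ≈ₚ (g *ₚ h) → IsUnitₚ g ⊎ IsUnitₚ h
    split g h e = go (degree? g) (degree? h)
      where
      f≋gh : f ≋ (g *ₚ h)
      f≋gh = ⟪ e ⟫
      go : g ≋ [] ⊎ ∃ (λ n → HasDegree n g) → h ≋ [] ⊎ ∃ (λ n → HasDegree n h) → IsUnitₚ g ⊎ IsUnitₚ h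
      go (inj₁ g≋0) _ = ⊥-elim (degree-≢[] df (≋-trans f≋gh (*ₚ-cong g≋0 (≋-refl {h}))))
      go _ (inj₁ h≋0) = ⊥-elim (degree-≢[] df (≋-trans f≋gh (≋-trans (*ₚ-congʳ g h≋0) (*ₚ-zeroʳ g))))
      go (inj₂ (m , dg)) (inj₂ (n , dh)) = byDegree m n dg dh (degree-unique (degree-≋ f≋gh df) (degree-*ₚ dg dh))
        where
        byDegree : ∀ m n → HasDegree m g → HasDegree n h → 1 ≡ m ℕ.+ n → IsUnitₚ g ⊎ IsUnitₚ h
        byDegree zero n dg dh _ = inj₁ (degree-0-unit g dg)
        byDegree (suc zero) zero dg dh _ = inj₂ (degree-0-unit h dh)

  irreducible-≋ : ∀ f g → f ≋ g → Irreducible f → Irreducible g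
  irreducible-≋ f g e (f≢0 , f∤1 , split) =
      (λ z → f≢0 (at (≋-trans {f} {g} {[]} e ⟪ z ⟫)))
    , (λ ug → f∤1 (unit-≋ f g e ug))
    , (λ h h′ e′ → split h h′ (at (≋-trans {f} {g} {h *ₚ h′} e ⟪ e′ ⟫)))

  X² : Poly
  X² = 0ℚ ∷ 0ℚ ∷ 1ℚ ∷ []

  degree-X² : HasDegree 2 X²
  degree-X² = 1≢0 & λ { 1 (s≤s ()) ; 2 (s≤s (s≤s ())) ; (suc (suc (suc n))) _ → refl }

  -- For g = x² the square is already complete: h = 0, k = 1, ξ = x and L = y.
  irreducible-∘-X² : ∀ {f} → Irreducible f → (∀ A B M → IsUnitₚ M → ¬ (NormForm.norm 0ℚ 1ℚ 1≢0 A B ≋ (M *ₚ f))) → Irreducible (f ∘ₚ X²)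
  irreducible-∘-X² irr = Quadratic.irreducible-∘ X² degree-X² 1ℚ refl 0ℚ refl irr

  -- A norm equal to e (y + c) has constants A = α and B = δ, so e = -δ² and α² + c δ² = 0. The
  -- hypothesis says that -c is not a square.
  irreducible-y²+ : ∀ c → (∀ α δ → δ ≢ 0ℚ → α * α + c * (δ * δ) ≢ 0ℚ) → Irreducible (c ∷ 0ℚ ∷ 1ℚ ∷ [])
  irreducible-y²+ c noZero = irreducible-≋ ((c ∷ 1ℚ ∷ []) ∘ₚ X²) (c ∷ 0ℚ ∷ 1ℚ ∷ []) e
      (irreducible-∘-X² {c ∷ 1ℚ ∷ []} (irreducible-degree-1 (c ∷ 1ℚ ∷ []) (1≢0 & b)) noNorm)
    where
    e : ((c ∷ 1ℚ ∷ []) ∘ₚ X²) ≋ (c ∷ 0ℚ ∷ 1ℚ ∷ [])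
    e = ∷-cong (+-identityʳ c) (∷-cong refl (∷-cong refl ⟪ (λ { 0 → refl ; 1 → refl ; (suc (suc n)) → refl }) ⟫))
    b : DegreeAtMost 1 (c ∷ 1ℚ ∷ [])
    b 1 (s≤s ())
    b (suc (suc n)) _ = refl
    open NormForm 0ℚ 1ℚ 1≢0
    noNorm : ∀ A B M → IsUnitₚ M → ¬ (norm A B ≋ (M *ₚ (c ∷ 1ℚ ∷ [])))
    noNorm A B M uM N≋ = noZero α δ δ≢0 (begin
        α * α + c * (δ * δ)                                                     ≡⟨ solve 3 (λ α δ c → α :* α :+ c :* (δ :* δ) := ((α :* α :+ con 0ℚ) :+ con (- 1ℚ) :* (con 0ℚ :* (δ :* δ :+ con 0ℚ) :+ con 0ℚ)) :+ c :* (δ :* δ)) refl α δ c ⟩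
        ((α * α + 0ℚ) + (- 1ℚ) * (0ℚ * (δ * δ + 0ℚ) + 0ℚ)) + c * (δ * δ)        ≡⟨ cong (_+ c * (δ * δ)) (at E 0) ⟩
        (e₀ * c + 0ℚ) + c * (δ * δ)                                             ≡⟨ cong (λ x → (x * c + 0ℚ) + c * (δ * δ)) e₀≡ ⟩
        (- (δ * δ) * c + 0ℚ) + c * (δ * δ)                                      ≡⟨ solve 2 (λ d c → ((:- d) :* c :+ con 0ℚ) :+ c :* d := con 0ℚ) refl (δ * δ) c ⟩
        0ℚ                                                                      ∎)
      where
      open ≡-Reasoning
      open +-*-Solver
      α = coeff A 0
      δ = coeff B 0
      e₀ = coeff M 0
      bAB : Below 1 A × Below 1 B
      bAB = norm-below 1 A B (below-≋ (≋-sym N≋) (below-unit-*ₚ M (c ∷ 1ℚ ∷ []) uM b))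
      E : norm (α ∷ []) (δ ∷ []) ≋ ((e₀ ∷ []) *ₚ (c ∷ 1ℚ ∷ []))
      E = ≋-trans (≋-sym (norm-cong (≋-list₁ A (proj₁ bAB)) (≋-list₁ B (proj₂ bAB))))
            (≋-trans N≋ (*ₚ-cong (proj₁ (unit-const {M} uM)) (≋-refl {c ∷ 1ℚ ∷ []})))
      e₀≡ : e₀ ≡ - (δ * δ)
      e₀≡ = trans (sym (*-identityʳ e₀)) (trans (sym (at E 1)) (solve 1 (λ δ → con (- 1ℚ) :* (con 1ℚ :* (δ :* δ :+ con 0ℚ) :+ con 0ℚ) := :- (δ :* δ)) refl δ))
      δ≢0 : δ ≢ 0ℚ
      δ≢0 δ≡0 = proj₂ (unit-const {M} uM) (trans e₀≡ (cong (λ x → - (x * x)) δ≡0))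

  -- Here A = α + γ y and B = δ yield e = γ², 2 α γ = δ² and α² = c γ². Together these make 4c a
  -- fourth power, the case of Sophie Germain's factorisation of x⁴ + 4u⁴.
  irreducible-x⁴+ : ∀ c → (∀ α δ → δ ≢ 0ℚ → α * α + c * (δ * δ) ≢ 0ℚ)
    → (∀ α γ δ → γ ≢ 0ℚ → α * α ≡ c * (γ * γ) → α * γ + γ * α ≢ δ * δ) → Irreducible (x⁴+ c)
  irreducible-x⁴+ c noZero noSquare = irreducible-≋ ((c ∷ 0ℚ ∷ 1ℚ ∷ []) ∘ₚ X²) (x⁴+ c) e
      (irreducible-∘-X² {c ∷ 0ℚ ∷ 1ℚ ∷ []} (irreducible-y²+ c noZero) noNorm)
    where
    e : ((c ∷ 0ℚ ∷ 1ℚ ∷ []) ∘ₚ X²) ≋ x⁴+ c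
    e = ∷-cong (+-identityʳ c) (∷-cong refl (∷-cong refl (∷-cong refl (∷-cong refl ⟪ (λ { 0 → refl ; 1 → refl ; 2 → refl ; 3 → refl ; (suc (suc (suc (suc n)))) → refl }) ⟫))))
    b : DegreeAtMost 2 (c ∷ 0ℚ ∷ 1ℚ ∷ [])
    b 1 (s≤s ())
    b 2 (s≤s (s≤s ()))
    b (suc (suc (suc n))) _ = refl
    open NormForm 0ℚ 1ℚ 1≢0
    noNorm : ∀ A B M → IsUnitₚ M → ¬ (norm A B ≋ (M *ₚ (c ∷ 0ℚ ∷ 1ℚ ∷ [])))
    noNorm A B M uM N≋ = noSquare α γ δ γ≢0
        (trans (solve 2 (λ α δ → α :* α := (α :* α :+ con 0ℚ) :+ con (- 1ℚ) :* (con 0ℚ :* (δ :* δ :+ con 0ℚ) :+ con 0ℚ)) refl α δ)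
          (trans (at E 0) (trans (+-identityʳ (e₀ * c)) (trans (*-comm e₀ c) (cong (c *_) (sym γγ≡e₀))))))
        (trans (solve 3 (λ α γ δ → α :* γ :+ γ :* α := ((α :* γ :+ (γ :* α :+ con 0ℚ)) :+ con (- 1ℚ) :* (con 1ℚ :* (δ :* δ :+ con 0ℚ) :+ con 0ℚ)) :+ δ :* δ) refl α γ δ)
          (trans (cong (_+ δ * δ) (trans (at E 1) (*-zeroʳ e₀))) (+-identityˡ (δ * δ))))
      where
      open +-*-Solver
      α = coeff A 0
      γ = coeff A 1
      δ = coeff B 0
      e₀ = coeff M 0
      bN : Below 3 (norm A B)
      bN = below-≋ (≋-sym N≋) (below-unit-*ₚ M (c ∷ 0ℚ ∷ 1ℚ ∷ []) uM b)
      bAB : Below 2 A × Below 2 B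
      bAB = norm-below 2 A B (below-weaken {f = norm A B} (ℕ.n≤1+n 3) bN)
      bB : Below 1 B
      bB = lower-B 1 A B (proj₁ bAB) (proj₂ bAB) (bN 3 ℕ.≤-refl)
      E : norm (α ∷ γ ∷ []) (δ ∷ []) ≋ ((e₀ ∷ []) *ₚ (c ∷ 0ℚ ∷ 1ℚ ∷ []))
      E = ≋-trans (≋-sym (norm-cong (≋-list₂ A (proj₁ bAB)) (≋-list₁ B bB)))
            (≋-trans N≋ (*ₚ-cong (proj₁ (unit-const {M} uM)) (≋-refl {c ∷ 0ℚ ∷ 1ℚ ∷ []})))
      γγ≡e₀ : γ * γ ≡ e₀
      γγ≡e₀ = trans (at E 2) (*-identityʳ e₀)
      γ≢0 : γ ≢ 0ℚ
      γ≢0 γ≡0 = proj₂ (unit-const {M} uM) (trans (sym γγ≡e₀) (trans (cong (_* γ) γ≡0) (*-zeroˡ γ)))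

-- The equations z² = x⁴ + c y⁴ and x⁴ = z² + c y⁴ in natural numbers.

module Descent where

  open import Data.List.Membership.DecPropositional using () renaming (_∈?_ to member?)
  open import Data.Nat
  open import Data.Nat.Divisibility
  open import Data.Nat.DivMod
  open import Data.Nat.GCD using (gcd; gcd[m,n]∣m; gcd[m,n]∣n; gcd[m,n]≢0)
  open import Data.Nat.Properties
  open import Data.Nat.Solver using (module +-*-Solver)

  infix 9 _⁴
  _⁴ : ℕ → ℕ
  n ⁴ = n * n * (n * n)

  *-≢0ˡ : ∀ a b → a * b ≢ 0 → a ≢ 0
  *-≢0ˡ a b ab≢0 refl = ab≢0 refl

  *-≢0ʳ : ∀ a b → a * b ≢ 0 → b ≢ 0
  *-≢0ʳ a b ab≢0 refl = ab≢0 (*-zeroʳ a)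

  cancelˡ : ∀ {a b} c → c ≢ 0 → c * a ≡ c * b → a ≡ b
  cancelˡ {a} {b} c c≢0 = *-cancelˡ-≡ a b c
    where instance _ = ≢-nonZero c≢0

  gcd-split : ∀ m n → n ≢ 0 → ∃ λ g → ∃ λ m′ → ∃ λ n′ → g ≢ 0 × m ≡ m′ * g × n ≡ n′ * g × Coprime m′ n′
  gcd-split m n n≢0 = gcd m n , m / gcd m n , n / gcd m n , g≢0 ,
      sym (m/n*n≡m (gcd[m,n]∣m m n)) , sym (m/n*n≡m (gcd[m,n]∣n m n)) , coprime-/gcd m n
    where
    g≢0 : gcd m n ≢ 0
    g≢0 = gcd[m,n]≢0 m n (inj₂ n≢0)
    instance _ = ≢-nonZero g≢0

  coprime-∣ : ∀ {a b a′ b′} → a′ ∣ a → b′ ∣ b → Coprime a b → Coprime a′ b′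
  coprime-∣ p q c (d∣a , d∣b) = c (∣-trans d∣a p , ∣-trans d∣b q)

  coprime-*ʳ : ∀ a b c → Coprime a b → Coprime a c → Coprime a (b * c)
  coprime-*ʳ a b c ab ac {d} (d∣a , d∣bc) = ac (d∣a , coprime-divisor {d} {b} {c} (λ (e∣d , e∣b) → ab (∣-trans e∣d d∣a , e∣b)) d∣bc)

  -- Let g be the gcd of u and y. Cancelling it gives u₁ v = g y₁², where u₁ is prime to y₁ and g is
  -- prime to v; so u₁ and g divide each other.
  coprime-square : ∀ {u v y} → y ≢ 0 → Coprime u v → u * v ≡ y * y → ∃ λ a → ∃ λ b → u ≡ a * a × v ≡ b * b × a * b ≡ y
  coprime-square {u} {v} {y} y≢0 uv eq with gcd-split u y y≢0
  ... | g , u₁ , y₁ , g≢0 , refl , refl , cop = g , y₁ , cong (_* g) u₁≡g , v≡ , *-comm g y₁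
    where
    open +-*-Solver
    u₁v≡ : u₁ * v ≡ g * (y₁ * y₁)
    u₁v≡ = cancelˡ g g≢0 (trans (solve 3 (λ g u v → g :* (u :* v) := u :* g :* v) refl g u₁ v)
      (trans eq (solve 2 (λ g y → y :* g :* (y :* g) := g :* (g :* (y :* y))) refl g y₁)))
    u₁∣g : u₁ ∣ g
    u₁∣g = coprime-divisor {u₁} {y₁ * y₁} {g} (coprime-*ʳ u₁ y₁ y₁ cop cop)
      (divides v (trans (*-comm (y₁ * y₁) g) (trans (sym u₁v≡) (*-comm u₁ v))))
    g∣u₁ : g ∣ u₁
    g∣u₁ = coprime-divisor {g} {v} {u₁} (λ (d∣g , d∣v) → uv (∣n⇒∣m*n u₁ d∣g , d∣v))
      (divides (y₁ * y₁) (trans (*-comm v u₁) (trans u₁v≡ (*-comm g (y₁ * y₁)))))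
    u₁≡g : u₁ ≡ g
    u₁≡g = ∣-antisym u₁∣g g∣u₁
    v≡ : v ≡ y₁ * y₁
    v≡ = cancelˡ g g≢0 (trans (cong (_* v) (sym u₁≡g)) u₁v≡)

  coprime-fourth : ∀ {u v y} → y ≢ 0 → Coprime u v → u * v ≡ y ⁴ → ∃ λ r → ∃ λ s → u ≡ r ⁴ × v ≡ s ⁴ × r * s ≡ y
  coprime-fourth {u} {v} {y} y≢0 uv eq
    with a , b , refl , refl , ab≡yy ← coprime-square (λ yy≡0 → y≢0 (Sum.reduce (m*n≡0⇒m≡0∨n≡0 y yy≡0))) uv eq
    with r , s , refl , refl , rs≡y ← coprime-square y≢0 (coprime-∣ (divides a refl) (divides b refl) uv) ab≡yy
    = r , s , refl , refl , rs≡y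

  -- Take d₁ = gcd(u, d). Its cofactor d₂ is prime to u/d₁ and therefore divides v, which leaves two
  -- coprime factors of y⁴.
  coprime-split : ∀ {u v d y} → d ≢ 0 → y ≢ 0 → Coprime u v → u * v ≡ d * y ⁴
    → ∃ λ d₁ → ∃ λ d₂ → ∃ λ r → ∃ λ s → d₁ * d₂ ≡ d × r * s ≡ y × u ≡ d₁ * r ⁴ × v ≡ d₂ * s ⁴
  coprime-split {u} {v} {d} {y} d≢0 y≢0 uv eq with gcd-split u d d≢0
  ... | d₁ , u′ , d₂ , d₁≢0 , refl , refl , cop = finish d₂∣v
    where
    open +-*-Solver
    u′v≡ : u′ * v ≡ d₂ * y ⁴
    u′v≡ = cancelˡ d₁ d₁≢0 (trans (solve 3 (λ g u v → g :* (u :* v) := u :* g :* v) refl d₁ u′ v)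
      (trans eq (solve 3 (λ g d y → d :* g :* y := g :* (d :* y)) refl d₁ d₂ (y ⁴))))
    d₂∣v : d₂ ∣ v
    d₂∣v = coprime-divisor {d₂} {u′} {v} (Coprimality.sym cop) (divides (y ⁴) (trans u′v≡ (*-comm d₂ (y ⁴))))
    finish : d₂ ∣ v → _
    finish (divides v′ refl) with coprime-fourth {u′} {v′} y≢0 (coprime-∣ (divides d₁ (*-comm u′ d₁)) (divides d₂ (*-comm v′ d₂)) uv)
        (cancelˡ d₂ (*-≢0ˡ d₂ d₁ d≢0) (trans (solve 3 (λ d u v → d :* (u :* v) := u :* (v :* d)) refl d₂ u′ v′) u′v≡))
    ... | r , s , refl , refl , rs≡y = d₁ , d₂ , r , s , *-comm d₁ d₂ , rs≡y , *-comm (r ⁴) d₁ , *-comm (s ⁴) d₂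

  square-mono⁻¹ : ∀ a b → a * a ≤ b * b → a ≤ b
  square-mono⁻¹ a b aa≤bb with a ≤? b
  ... | yes a≤b = a≤b
  ... | no a≰b = ⊥-elim (<⇒≱ (*-mono-< (≰⇒> a≰b) (≰⇒> a≰b)) aa≤bb)

  square-even⁻¹ : ∀ n → 2 ∣ n * n → 2 ∣ n
  square-even⁻¹ n 2∣nn = Sum.reduce (euclidsLemma n n prime[2] 2∣nn)

  -- The factors (z - w)/2 and (z + w)/2 of (z² - w²)/4, given by their difference w and sum z. When
  -- z - w and z + w are themselves the factors, the record is used at 2w and 2z.
  record Factorisation (d y w z : ℕ) : Set where
    constructor factorisation
    field
      d₁ d₂ r s : ℕ
      d₁d₂≡d : d₁ * d₂ ≡ d
      rs≡y : r * s ≡ y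
      difference : w + d₁ * r ⁴ ≡ d₂ * s ⁴
      total : z ≡ d₁ * r ⁴ + d₂ * s ⁴
      coprime : Coprime (d₁ * r ⁴) (d₂ * s ⁴)

  difference-of-squares : ∀ {z w n} → z * z ≡ w * w + n → ∃ λ t → z ≡ w + t × t * (t + 2 * w) ≡ n
  difference-of-squares {z} {w} {n} eq = t , z≡ , +-cancelˡ-≡ (w * w) _ _ (trans (solve 2 (λ w t → w :* w :+ t :* (t :+ con 2 :* w) := (w :+ t) :* (w :+ t)) refl w t)
      (trans (cong (λ x → x * x) (sym z≡)) eq))
    where
    open +-*-Solver
    w≤z : w ≤ z
    w≤z = square-mono⁻¹ w z (subst (w * w ≤_) (sym eq) (m≤m+n (w * w) n))
    t = z ∸ w
    z≡ : z ≡ w + t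
    z≡ = sym (m+[n∸m]≡n w≤z)

  -- t = z - w satisfies t² + 2 w t = 4 d y⁴, so it is some 2u; a common divisor of u and u + w
  -- divides w and z = w + 2u.
  factor-even : ∀ {d y w z} → d ≢ 0 → y ≢ 0 → Coprime z w → z * z ≡ w * w + 4 * (d * y ⁴) → Factorisation d y w z
  factor-even {d} {y} {w} {z} d≢0 y≢0 zw eq with difference-of-squares {z} {w} eq
  ... | t , refl , t[t+2w]≡ = go (square-even⁻¹ t (∣m+n∣m⇒∣n (divides (2 * (d * y ⁴)) tt≡) (divides (w * t) (solve 2 (λ w t → con 2 :* (w :* t) := w :* t :* con 2) refl w t))))
    where
    open +-*-Solver
    tt≡ : 2 * (w * t) + t * t ≡ 2 * (d * y ⁴) * 2
    tt≡ = trans (solve 2 (λ w t → con 2 :* (w :* t) :+ t :* t := t :* (t :+ con 2 :* w)) refl w t)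
      (trans t[t+2w]≡ (solve 1 (λ n → con 4 :* n := con 2 :* n :* con 2) refl (d * y ⁴)))
    go : 2 ∣ t → Factorisation d y w (w + t)
    go (divides u refl) = go′ (coprime-split {u} {u + w} d≢0 y≢0 cop u[u+w]≡)
      where
      cop : Coprime u (u + w)
      cop (e∣u , e∣u+w) = zw (∣m∣n⇒∣m+n e∣w (∣m⇒∣m*n 2 e∣u) , e∣w)
        where e∣w = ∣m+n∣m⇒∣n e∣u+w e∣u
      u[u+w]≡ : u * (u + w) ≡ d * y ⁴
      u[u+w]≡ = cancelˡ 4 (λ ()) (trans (solve 2 (λ u w → con 4 :* (u :* (u :+ w)) := u :* con 2 :* (u :* con 2 :+ con 2 :* w)) refl u w) t[t+2w]≡)
      go′ : _ → Factorisation d y w (w + u * 2)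
      go′ (d₁ , d₂ , r , s , d≡ , rs , u≡ , v≡) = factorisation d₁ d₂ r s d≡ rs
        (trans (cong (w +_) (sym u≡)) (trans (+-comm w u) v≡))
        (trans (solve 2 (λ u w → w :+ u :* con 2 := u :+ (u :+ w)) refl u w) (cong₂ _+_ u≡ v≡))
        (subst₂ Coprime u≡ v≡ cop)

  odd⇒coprime-2 : ∀ {n} → ¬ 2 ∣ n → Coprime n 2
  odd⇒coprime-2 2∤n (e∣n , e∣2) with prime⇒irreducible prime[2] e∣2
  ... | inj₁ e≡1 = e≡1
  ... | inj₂ refl = ⊥-elim (2∤n e∣n)

  -- z - w is odd, so a common divisor of z - w and z + w is odd and divides 2w, hence both w and z.
  factor-odd : ∀ {d y w z} → d ≢ 0 → y ≢ 0 → Coprime z w → ¬ 2 ∣ z + w → z * z ≡ w * w + d * y ⁴ → Factorisation d y (2 * w) (2 * z)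
  factor-odd {d} {y} {w} {z} d≢0 y≢0 zw odd eq with difference-of-squares {z} {w} eq
  ... | t , refl , t[t+2w]≡ = go (coprime-split {t} {t + 2 * w} d≢0 y≢0 cop t[t+2w]≡)
    where
    open +-*-Solver
    2∤t : ¬ 2 ∣ t
    2∤t (divides q refl) = odd (divides (w + q) (solve 2 (λ w q → w :+ q :* con 2 :+ w := (w :+ q) :* con 2) refl w q))
    cop : Coprime t (t + 2 * w)
    cop {e} (e∣t , e∣t+2w) = zw (∣m∣n⇒∣m+n e∣w e∣t , e∣w)
      where
      e∣w : e ∣ w
      e∣w = coprime-divisor {e} {2} {w} (odd⇒coprime-2 (λ 2∣e → 2∤t (∣-trans 2∣e e∣t))) (∣m+n∣m⇒∣n e∣t+2w e∣t)
    go : _ → Factorisation d y (2 * w) (2 * (w + t))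
    go (d₁ , d₂ , r , s , d≡ , rs , u≡ , v≡) = factorisation d₁ d₂ r s d≡ rs
      (trans (cong (2 * w +_) (sym u≡)) (trans (+-comm (2 * w) t) v≡))
      (trans (solve 2 (λ t w → con 2 :* (w :+ t) := t :+ (t :+ con 2 :* w)) refl t w) (cong₂ _+_ u≡ v≡))
      (subst₂ Coprime u≡ v≡ cop)

  -- Congruences modulo 16, decided on the residues of squares.

  infix 4 _≡₁₆_
  record _≡₁₆_ (a b : ℕ) : Set where
    constructor ⟨_⟩
    field residue : a % 16 ≡ b % 16
  open _≡₁₆_

  infixl 6 _⊕_
  infixl 7 _⊗_

  _⊕_ : ∀ {a b c d} → a ≡₁₆ b → c ≡₁₆ d → a + c ≡₁₆ b + d
  _⊕_ {a} {b} {c} {d} ⟨ p ⟩ ⟨ q ⟩ = ⟨ trans (%-distribˡ-+ a c 16) (trans (cong₂ (λ u v → (u + v) % 16) p q) (sym (%-distribˡ-+ b d 16))) ⟩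

  _⊗_ : ∀ {a b c d} → a ≡₁₆ b → c ≡₁₆ d → a * c ≡₁₆ b * d
  _⊗_ {a} {b} {c} {d} ⟨ p ⟩ ⟨ q ⟩ = ⟨ trans (%-distribˡ-* a c 16) (trans (cong₂ (λ u v → (u * v) % 16) p q) (sym (%-distribˡ-* b d 16))) ⟩

  reduce : ∀ n → n ≡₁₆ n % 16
  reduce n = ⟨ sym (m%n%n≡m%n n 16) ⟩

  const : ∀ n → n ≡₁₆ n
  const n = ⟨ refl ⟩

  compare₁₆ : ∀ {a b A B} → a ≡₁₆ A → b ≡₁₆ B → a ≡ b → A % 16 ≡ B % 16
  compare₁₆ ⟨ p ⟩ ⟨ q ⟩ eq = trans (sym p) (trans (cong (_% 16) eq) q)

  even⁺ : ∀ {a A} → a ≡₁₆ A → A % 2 ≡ 0 → 2 ∣ a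
  even⁺ {a} {A} ⟨ p ⟩ A%2≡0 = ∣n∣m%n⇒∣m (divides 8 refl) (subst (2 ∣_) (sym p) (%-presˡ-∣ (m%n≡0⇒n∣m A 2 A%2≡0) (divides 8 refl)))

  even⁻ : ∀ {a A} → a ≡₁₆ A → 2 ∣ a → A % 2 ≡ 0
  even⁻ {a} {A} ⟨ p ⟩ 2∣a = n∣m⇒m%n≡0 A 2 (∣n∣m%n⇒∣m (divides 8 refl) (subst (2 ∣_) p (%-presˡ-∣ 2∣a (divides 8 refl))))

  -- The part of coprimality that is visible modulo 16.
  NotBothEven : ℕ → ℕ → Set
  NotBothEven A B = ¬ (A % 2 ≡ 0 × B % 2 ≡ 0)

  notBothEven? : ∀ A B → Dec (NotBothEven A B)
  notBothEven? A B = ¬? (A % 2 ≟ 0 ×-dec B % 2 ≟ 0)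

  coprime⇒notBothEven : ∀ {a b A B} → Coprime a b → a ≡₁₆ A → b ≡₁₆ B → NotBothEven A B
  coprime⇒notBothEven c p q (A≡0 , B≡0) with () ← c (even⁺ p A≡0 , even⁺ q B≡0)

  sq : ℕ → ℕ
  sq n = n * n % 16

  square : ∀ n → n * n ≡₁₆ sq n
  square n = reduce (n * n)

  fourth : ∀ n → n ⁴ ≡₁₆ sq n * sq n
  fourth n = square n ⊗ square n

  -- The squares modulo 16. Checks range over these four values instead of sixteen residues.
  squares : List ℕ
  squares = 0 ∷ 1 ∷ 4 ∷ 9 ∷ []

  sq∈squares : ∀ n → sq n ∈ squares
  sq∈squares n = subst (_∈ squares) (sym (%-distribˡ-* n n 16)) (checked (m%n<n n 16))
    where
    checked : ∀ {m} → m < 16 → m * m % 16 ∈ squares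
    checked = from-yes (allUpTo? (λ m → member? _≟_ (m * m % 16) squares) 16)

  forSquare : ∀ {Q : ℕ → Set} → All Q squares → ∀ n → Q (sq n)
  forSquare all n = lookup all (sq∈squares n)

  sq-even : ∀ n → sq n % 2 ≡ 0 → 2 ∣ n
  sq-even n e = square-even⁻¹ n (even⁺ (square n) e)

  even-sq : ∀ n → 2 ∣ n → sq n % 2 ≡ 0
  even-sq n 2∣n = even⁻ (square n) (∣m⇒∣m*n n 2∣n)

  -- K x² + D₁ r⁴ = D₂ s⁴ modulo 16, in terms of the residues of x², r² and s².
  NoDifference : ℕ → ℕ → ℕ → Set
  NoDifference K D₁ D₂ = All (λ X → All (λ R → All (λ S →
    (K * X + D₁ * (R * R)) % 16 ≡ D₂ * (S * S) % 16 → ¬ NotBothEven (D₁ * (R * R)) (D₂ * (S * S))) squares) squares) squares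

  noDifference? : ∀ K D₁ D₂ → Dec (NoDifference K D₁ D₂)
  noDifference? K D₁ D₂ = all? (λ X → all? (λ R → all? (λ S →
    (K * X + D₁ * (R * R)) % 16 ≟ D₂ * (S * S) % 16 →-dec ¬? (notBothEven? (D₁ * (R * R)) (D₂ * (S * S)))) squares) squares) squares

  noDifference : ∀ K {D₁ D₂ d₁ d₂} x r s → NoDifference K D₁ D₂ → d₁ ≡₁₆ D₁ → d₂ ≡₁₆ D₂
    → K * (x * x) + d₁ * r ⁴ ≡ d₂ * s ⁴ → ¬ Coprime (d₁ * r ⁴) (d₂ * s ⁴)
  noDifference K x r s none p q eq c = forSquare (forSquare (forSquare none x) r) s
    (compare₁₆ (const K ⊗ square x ⊕ p ⊗ fourth r) (q ⊗ fourth s) eq)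
    (coprime⇒notBothEven c (p ⊗ fourth r) (q ⊗ fourth s))

  -- K x² = D₁ r⁴ + D₂ s⁴ modulo 16, matching the field `total`. K is 2 or 4 when the factorisation
  -- comes from `factor-odd`.
  NoTotal : ℕ → ℕ → ℕ → Set
  NoTotal K D₁ D₂ = All (λ X → All (λ R → All (λ S →
    K * X % 16 ≡ (D₁ * (R * R) + D₂ * (S * S)) % 16 → ¬ NotBothEven (D₁ * (R * R)) (D₂ * (S * S))) squares) squares) squares

  noTotal? : ∀ K D₁ D₂ → Dec (NoTotal K D₁ D₂)
  noTotal? K D₁ D₂ = all? (λ X → all? (λ R → all? (λ S →
    K * X % 16 ≟ (D₁ * (R * R) + D₂ * (S * S)) % 16 →-dec ¬? (notBothEven? (D₁ * (R * R)) (D₂ * (S * S)))) squares) squares) squares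

  noTotal : ∀ K {D₁ D₂ d₁ d₂} x r s → NoTotal K D₁ D₂ → d₁ ≡₁₆ D₁ → d₂ ≡₁₆ D₂
    → K * (x * x) ≡ d₁ * r ⁴ + d₂ * s ⁴ → ¬ Coprime (d₁ * r ⁴) (d₂ * s ⁴)
  noTotal K x r s none p q eq c = forSquare (forSquare (forSquare none x) r) s
    (compare₁₆ (const K ⊗ square x) (p ⊗ fourth r ⊕ q ⊗ fourth s) eq)
    (coprime⇒notBothEven c (p ⊗ fourth r) (q ⊗ fourth s))

  -- Splittings of a coefficient, and the steps common to all descents.

  prime-split : ∀ {p} → Prime p → ∀ k d₁ d₂ → d₁ * d₂ ≡ k * p
    → (∃ λ a → d₁ ≡ a * p × a * d₂ ≡ k) ⊎ (∃ λ a → d₂ ≡ a * p × d₁ * a ≡ k)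
  prime-split {p} pp k d₁ d₂ eq with euclidsLemma d₁ d₂ pp (divides k eq)
  ... | inj₁ (divides a refl) = inj₁ (a , refl , *-cancelʳ-≡ (a * d₂) k p (trans (solve 3 (λ a d p → a :* d :* p := a :* p :* d) refl a d₂ p) eq))
    where
    open +-*-Solver
    instance _ = prime⇒nonZero pp
  ... | inj₂ (divides a refl) = inj₂ (a , refl , *-cancelʳ-≡ (d₁ * a) k p (trans (*-assoc d₁ a p) eq))
    where instance _ = prime⇒nonZero pp

  factors : ∀ k ps .{{_ : NonZero k}} → (∀ {a} → a < suc k → ∀ {b} → b < suc k → a * b ≡ k → (a , b) ∈ ps)
    → ∀ a b → a * b ≡ k → (a , b) ∈ ps
  factors k ps check a b eq = check (s≤s (∣⇒≤ (divides b (trans (sym eq) (*-comm a b))))) (s≤s (∣⇒≤ (divides a (sym eq)))) eq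

  factorsChecked? : ∀ k ps → Dec (∀ {a} → a < suc k → ∀ {b} → b < suc k → a * b ≡ k → (a , b) ∈ ps)
  factorsChecked? k ps = allUpTo? (λ a → allUpTo? (λ b → (a * b ≟ k) →-dec (member? (≡-dec _≟_ _≟_) (a , b) ps)) (suc k)) (suc k)

  factors-1 : ∀ a b → a * b ≡ 1 → (a , b) ∈ (1 , 1) ∷ []
  factors-1 = factors 1 _ (from-yes (factorsChecked? 1 ((1 , 1) ∷ [])))

  factors-2 : ∀ a b → a * b ≡ 2 → (a , b) ∈ (1 , 2) ∷ (2 , 1) ∷ []
  factors-2 = factors 2 _ (from-yes (factorsChecked? 2 ((1 , 2) ∷ (2 , 1) ∷ [])))

  factors-4 : ∀ a b → a * b ≡ 4 → (a , b) ∈ (1 , 4) ∷ (2 , 2) ∷ (4 , 1) ∷ []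
  factors-4 = factors 4 _ (from-yes (factorsChecked? 4 ((1 , 4) ∷ (2 , 2) ∷ (4 , 1) ∷ [])))

  factors-8 : ∀ a b → a * b ≡ 8 → (a , b) ∈ (1 , 8) ∷ (2 , 4) ∷ (4 , 2) ∷ (8 , 1) ∷ []
  factors-8 = factors 8 _ (from-yes (factorsChecked? 8 ((1 , 8) ∷ (2 , 4) ∷ (4 , 2) ∷ (8 , 1) ∷ [])))

  ∣m+n∣n⇒∣m : ∀ {d m n} → d ∣ m + n → d ∣ n → d ∣ m
  ∣m+n∣n⇒∣m {d} {m} {n} d∣m+n = ∣m+n∣m⇒∣n (subst (d ∣_) (+-comm m n) d∣m+n)

  ∣-square : ∀ {e} n → e ∣ n → e ∣ n * n
  ∣-square n = ∣m⇒∣m*n n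

  ∣-⁴ : ∀ {e} n → e ∣ n → e ∣ n ⁴
  ∣-⁴ n e∣n = ∣m⇒∣m*n (n * n) (∣-square n e∣n)

  both-even : ∀ {a b} → Coprime a b → 2 ∣ a → 2 ∣ b → ⊥
  both-even c p q with () ← c (p , q)

  2∣2* : ∀ n → 2 ∣ 2 * n
  2∣2* n = divides n (*-comm 2 n)

  both-doubled : ∀ k l {a b} m n → a ≡ 2 * k → b ≡ 2 * l → Coprime (a * m) (b * n) → ⊥
  both-doubled k l m n refl refl c = both-even c (∣m⇒∣m*n m (2∣2* k)) (∣m⇒∣m*n n (2∣2* l))

  -- a ≤ a b ≤ a b s = Y < 2Y. This is the decrease behind every descent below.
  factor-<ˡ : ∀ {a b r s Y} → Y * 2 ≢ 0 → a * b ≡ r → r * s ≡ Y → a < Y * 2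
  factor-<ˡ {a} {b} {r} {s} 2Y≢0 refl refl = ≤-<-trans
    (≤-trans (m≤m*n a b) (m≤m*n (a * b) s)) (m<m*n (a * b * s) 2 (s≤s (s≤s z≤n)))
    where
    abs≢0 = *-≢0ˡ (a * b * s) 2 2Y≢0
    instance
      _ = ≢-nonZero (*-≢0ʳ (a * b) s abs≢0)
      _ = ≢-nonZero (*-≢0ʳ a b (*-≢0ˡ (a * b) s abs≢0))
      _ = ≢-nonZero abs≢0

  coprime-part : ∀ {a s A B} → s * s ≡ A + B → a ∣ A → Coprime A B → Coprime a s
  coprime-part {a} {s} {A} {B} eq a∣A c {e} (e∣a , e∣s) =
    c (e∣A , ∣m+n∣m⇒∣n (subst (e ∣_) eq (∣-square s e∣s)) e∣A)
    where e∣A = ∣-trans e∣a a∣A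

  coprime-difference : ∀ {x s A B} → x * x + A ≡ B → s ∣ B → Coprime A B → Coprime s x
  coprime-difference {x} {s} {A} {B} eq s∣B c (e∣s , e∣x) =
    c (∣m+n∣m⇒∣n (subst (_ ∣_) (sym eq) e∣B) (∣-square x e∣x) , e∣B)
    where e∣B = ∣-trans e∣s s∣B

  prime≢0 : ∀ {p} → Prime p → p ≢ 0
  prime≢0 pp = ≢-nonZero⁻¹ _ {{prime⇒nonZero pp}}

  *-≢0ₙ : ∀ {a b} → a ≢ 0 → b ≢ 0 → a * b ≢ 0
  *-≢0ₙ {a} a≢0 b≢0 ab≡0 = Sum.[ a≢0 , b≢0 ] (m*n≡0⇒m≡0∨n≡0 a ab≡0)

  coprime-squareʳ : ∀ {z x} → Coprime x z → Coprime z (x * x)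
  coprime-squareʳ {z} {x} c = coprime-*ʳ z x x (Coprimality.sym c) (Coprimality.sym c)


  noDifference₁ : ∀ {D₁ D₂ d₁ d₂} x r s → NoDifference 1 D₁ D₂ → d₁ ≡₁₆ D₁ → d₂ ≡₁₆ D₂
    → x * x + d₁ * r ⁴ ≡ d₂ * s ⁴ → ¬ Coprime (d₁ * r ⁴) (d₂ * s ⁴)
  noDifference₁ {d₁ = d₁} x r s none p q eq = noDifference 1 x r s none p q (trans (cong (_+ d₁ * r ⁴) (*-identityˡ (x * x))) eq)

  -- In the surviving case s⁴ = x² + 4 D r⁴, again a difference of two squares, those of s² and x.
  second-step : ∀ {d₁ d₂} x r s D → D ≢ 0 → r ≢ 0 → d₁ ≡ 4 * D → d₂ ≡ 1
    → x * x + d₁ * r ⁴ ≡ d₂ * s ⁴ → Coprime (d₁ * r ⁴) (d₂ * s ⁴) → Factorisation D r x (s * s)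
  second-step x r s D D≢0 r≢0 refl refl eq c = factor-even D≢0 r≢0
    (Coprimality.sym (coprime-squareʳ {x} {s} (coprime-difference eq (∣n⇒∣m*n 1 (∣-⁴ s ∣-refl)) c)))
    (trans (sym (*-identityˡ (s ⁴))) (trans (sym eq) (cong (x * x +_) (*-assoc 4 D (r ⁴)))))

  -- c (2Y)⁴ = 4 (4c) Y⁴: the even y supplies the factor 4 for `factor-even` and turns the
  -- coefficient into d = 4c.
  first-step : ∀ {d c x Y z} → d ≢ 0 → Y * 2 ≢ 0 → c * 4 ≡ d → Coprime x z → z * z ≡ x ⁴ + c * (Y * 2) ⁴ → Factorisation d Y (x * x) z
  first-step {d} {c} {x} {Y} {z} d≢0 y≢0 refl cop eq = factor-even d≢0 (*-≢0ˡ Y 2 y≢0) (coprime-squareʳ {z} {x} cop)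
    (trans eq (cong (x ⁴ +_) (solve 2 (λ c Y → c :* (Y :* con 2 :* (Y :* con 2) :* (Y :* con 2 :* (Y :* con 2))) := con 4 :* (c :* con 4 :* (Y :* Y :* (Y :* Y)))) refl c Y)))
    where open +-*-Solver

  -- What a descent returns: `s` takes the place of z, and `b`, in the place of y, divides `r`. The
  -- cofactor `q` is kept because it proves `b` smaller.
  record Solution (c r s : ℕ) : Set where
    constructor solution
    field
      a b q : ℕ
      bq≡r : b * q ≡ r
      coprime : Coprime a s
      equation : s * s ≡ a ⁴ + c * b ⁴

  solutionˡ : ∀ {c d₁ d₂ r} s a b → d₁ ≡ c → d₂ ≡ 1 → a * b ≡ r → s * s ≡ d₁ * a ⁴ + d₂ * b ⁴ → Coprime (d₁ * a ⁴) (d₂ * b ⁴) → Solution c r s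
  solutionˡ {c} {r = r} s a b refl refl ab≡r eq cop = solution b a b ab≡r
    (coprime-part {b} {s} (trans eq (+-comm (c * a ⁴) (1 * b ⁴))) (∣n⇒∣m*n 1 (∣-⁴ b ∣-refl)) (Coprimality.sym cop))
    (trans eq (trans (+-comm (c * a ⁴) (1 * b ⁴)) (cong (_+ c * a ⁴) (*-identityˡ (b ⁴)))))

  solutionʳ : ∀ {c d₁ d₂ r} s a b → d₁ ≡ 1 → d₂ ≡ c → a * b ≡ r → s * s ≡ d₁ * a ⁴ + d₂ * b ⁴ → Coprime (d₁ * a ⁴) (d₂ * b ⁴) → Solution c r s
  solutionʳ {c} {d₁} {d₂} {r} s a b p q ab≡r eq cop = solutionˡ s b a q p (trans (*-comm b a) ab≡r)
    (trans eq (+-comm (d₁ * a ⁴) (d₂ * b ⁴))) (Coprimality.sym cop)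

  solution-< : ∀ {c r s s′ Y} → Y * 2 ≢ 0 → r * s′ ≡ Y → (sol : Solution c r s) → Solution.b sol < Y * 2
  solution-< y≢0 rs≡Y sol = factor-<ˡ y≢0 (Solution.bq≡r sol) rs≡Y

  solution-≢0 : ∀ {c r s} → r ≢ 0 → (sol : Solution c r s) → Solution.b sol ≢ 0
  solution-≢0 r≢0 (solution a b q refl _ _) = *-≢0ˡ b q r≢0


  -- c = 1: Fermat's equation z² = x⁴ + y⁴.

  module Fermat where
    OneEven : ℕ → ℕ → ℕ → Set
    OneEven X Y Z = Z % 16 ≡ (X * X + 1 * (Y * Y)) % 16 → NotBothEven X Z → X % 2 ≡ 0 ⊎ Y % 2 ≡ 0

    oneEven : All (λ X → All (λ Y → All (OneEven X Y) squares) squares) squares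
    oneEven = from-yes (all? (λ X → all? (λ Y → all? (λ Z →
      Z % 16 ≟ (X * X + 1 * (Y * Y)) % 16 →-dec notBothEven? X Z →-dec (X % 2 ≟ 0 ⊎-dec Y % 2 ≟ 0)) squares) squares) squares)

    -- Were x and y both odd, z² would be 2 modulo 16.
    even-x-or-y : ∀ x y z → Coprime x z → z * z ≡ x ⁴ + 1 * y ⁴ → 2 ∣ x ⊎ 2 ∣ y
    even-x-or-y x y z c eq = Sum.map (sq-even x) (sq-even y)
      (forSquare (forSquare (forSquare oneEven x) y) z (compare₁₆ (square z) (fourth x ⊕ const 1 ⊗ fourth y) eq)
        (λ (X≡0 , Z≡0) → both-even c (sq-even x X≡0) (sq-even z Z≡0)))

    first : ∀ {x Y z} → Y ≢ 0 → Factorisation 4 Y (x * x) z → ∃ λ r → ∃ λ s → r ≢ 0 × r * s ≡ Y × Factorisation 1 r x (s * s)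
    first {x} Y≢0 (factorisation d₁ d₂ r s d≡ refl difference _ cop) = r , s , r≢0 , refl , cases (factors-4 d₁ d₂ d≡) difference cop
      where
      r≢0 = *-≢0ˡ r s Y≢0
      cases : ∀ {d₁ d₂} → (d₁ , d₂) ∈ (1 , 4) ∷ (2 , 2) ∷ (4 , 1) ∷ [] → x * x + d₁ * r ⁴ ≡ d₂ * s ⁴ → Coprime (d₁ * r ⁴) (d₂ * s ⁴) → Factorisation 1 r x (s * s)
      cases (here refl) eq c = ⊥-elim (noDifference₁ x r s (from-yes (noDifference? 1 1 4)) (const 1) (const 4) eq c)
      cases (there (here refl)) eq c = ⊥-elim (both-doubled 1 1 (r ⁴) (s ⁴) refl refl c)
      cases (there (there (here refl))) eq c = second-step x r s 1 (λ ()) r≢0 refl refl eq c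

    descent : ∀ n x Y z → Y * 2 < n → Y * 2 ≢ 0 → Coprime x z → z * z ≢ x ⁴ + 1 * (Y * 2) ⁴
    descent (suc n) x Y z (s≤s y≤n) y≢0 c eq = go (first (*-≢0ˡ Y 2 y≢0) (first-step {4} {1} (λ ()) y≢0 refl c eq))
      where
      go : (∃ λ r → ∃ λ s → r ≢ 0 × r * s ≡ Y × Factorisation 1 r x (s * s)) → ⊥
      go (r , s , r≢0 , rs≡Y , factorisation e₁ e₂ a b e≡ ab≡r _ total cop) with factors-1 e₁ e₂ e≡
      -- Either entry of the new solution may be the even one; the equation is symmetric in x and y,
      -- so they are exchanged if needed.
      ... | here refl = Sum.[ swapped , straight ] (even-x-or-y a b s cop-a eq-a)
        where
        solʳ = solutionʳ {1} {r = r} s a b refl refl ab≡r total cop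
        solˡ = solutionˡ {1} {r = r} s a b refl refl ab≡r total cop
        cop-a = Solution.coprime solʳ
        eq-a = Solution.equation solʳ
        straight : 2 ∣ b → ⊥
        straight (divides B refl) = descent n a B s (<-≤-trans (solution-< y≢0 rs≡Y solʳ) y≤n) (solution-≢0 r≢0 solʳ) cop-a eq-a
        swapped : 2 ∣ a → ⊥
        swapped (divides A refl) = descent n b A s (<-≤-trans (solution-< y≢0 rs≡Y solˡ) y≤n) (solution-≢0 r≢0 solˡ) (Solution.coprime solˡ) (Solution.equation solˡ)

    no-solution : ∀ x y z → x ≢ 0 → y ≢ 0 → Coprime x y → Coprime x z → Coprime y z → z * z ≢ x ⁴ + 1 * y ⁴
    no-solution x y z x≢0 y≢0 xy xz yz eq = Sum.[ evenˣ , evenʸ ] (even-x-or-y x y z xz eq)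
      where
      open +-*-Solver
      evenʸ : 2 ∣ y → ⊥
      evenʸ (divides Y refl) = descent (suc (Y * 2)) x Y z ≤-refl y≢0 xz eq
      evenˣ : 2 ∣ x → ⊥
      evenˣ (divides X refl) = descent (suc (X * 2)) y X z ≤-refl x≢0 yz
        (trans eq (solve 2 (λ x y → x :+ con 1 :* y := y :+ con 1 :* x) refl ((X * 2) ⁴) (y ⁴)))

  EvenY : ℕ → ℕ → ℕ → ℕ → Set
  EvenY C X Y Z = Z % 16 ≡ (X * X + C * (Y * Y)) % 16 → NotBothEven X Z → Y % 2 ≡ 0

  EvenYs : ℕ → Set
  EvenYs C = All (λ X → All (λ Y → All (EvenY C X Y) squares) squares) squares

  evenYs? : ∀ C → Dec (EvenYs C)
  evenYs? C = all? (λ X → all? (λ Y → all? (λ Z → Z % 16 ≟ (X * X + C * (Y * Y)) % 16 →-dec notBothEven? X Z →-dec Y % 2 ≟ 0) squares) squares) squares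

  -- For odd y the right side is c or c + 1 modulo 16, which is never a square for the coefficients
  -- to which this is applied.
  even-y : ∀ {c C} x y z → EvenYs C → c ≡₁₆ C → Coprime x z → z * z ≡ x ⁴ + c * y ⁴ → 2 ∣ y
  even-y x y z evenYs c≡C cop eq = sq-even y (forSquare (forSquare (forSquare evenYs x) y) z
    (compare₁₆ (square z) (fourth x ⊕ c≡C ⊗ fourth y) eq)
    (λ (X≡0 , Z≡0) → both-even cop (sq-even x X≡0) (sq-even z Z≡0)))

  split-prime : ∀ {p} → Prime p → ∀ d₁ d₂ → d₁ * d₂ ≡ p → (d₁ ≡ p × d₂ ≡ 1) ⊎ (d₁ ≡ 1 × d₂ ≡ p)
  split-prime {p} pp d₁ d₂ eq with prime⇒irreducible pp (divides d₂ (trans (sym eq) (*-comm d₁ d₂)))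
  ... | inj₁ refl = inj₂ (refl , trans (sym (*-identityˡ d₂)) eq)
  ... | inj₂ refl = inj₁ (refl , m*n≡m⇒n≡1 d₁ (prime≢0 pp) eq)
    where
    m*n≡m⇒n≡1 : ∀ m {n} → m ≢ 0 → m * n ≡ m → n ≡ 1
    m*n≡m⇒n≡1 m m≢0 e = cancelˡ m m≢0 (trans e (sym (*-identityʳ m)))

  noTotal-prime : ∀ {p P} → Prime p → p ≡₁₆ P → ∀ K x d₁ d₂ r s → NoTotal K P 1 → NoTotal K 1 P → d₁ * d₂ ≡ p
    → K * (x * x) ≡ d₁ * r ⁴ + d₂ * s ⁴ → ¬ Coprime (d₁ * r ⁴) (d₂ * s ⁴)
  noTotal-prime pp p≡P K x d₁ d₂ r s noˡ noʳ d≡ eq c with split-prime pp d₁ d₂ d≡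
  ... | inj₁ (refl , refl) = noTotal K x r s noˡ p≡P (const 1) eq c
  ... | inj₂ (refl , refl) = noTotal K x r s noʳ (const 1) p≡P eq c

  -- c = p with p congruent to 7 or 11 modulo 16.

  module PlusPrime {p : ℕ} (pp : Prime p) (p₁₆ : p % 16 ∈ 7 ∷ 11 ∷ []) where
    -- As 4 s⁴ is even, coprimality makes r odd, and then x is odd.
    oddX : All (λ P → All (λ X → All (λ R → All (λ S →
      (X + 1 * P * (R * R)) % 16 ≡ 4 * (S * S) % 16 → NotBothEven (1 * P * (R * R)) (4 * (S * S)) → ¬ X % 2 ≡ 0) squares) squares) squares) (7 ∷ 11 ∷ [])
    oddX = from-yes (all? (λ P → all? (λ X → all? (λ R → all? (λ S →
      (X + 1 * P * (R * R)) % 16 ≟ 4 * (S * S) % 16 →-dec notBothEven? (1 * P * (R * R)) (4 * (S * S)) →-dec ¬? (X % 2 ≟ 0)) squares) squares) squares) (7 ∷ 11 ∷ []))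

    p≢0 = prime≢0 pp
    1*p = const 1 ⊗ reduce p
    4*p = const 4 ⊗ reduce p

    -- x² + p r⁴ = 4 s⁴ would give 4 s² = p a⁴ + b⁴.
    excluded : ∀ x r s → r ≢ 0 → x * x + 1 * p * r ⁴ ≡ 4 * s ⁴ → ¬ Coprime (1 * p * r ⁴) (4 * s ⁴)
    excluded x r s r≢0 eq c = go (factor-odd {p} {r} {x} {2 * (s * s)} p≢0 r≢0 cop odd
        (trans (solve 1 (λ s → con 2 :* s :* (con 2 :* s) := con 4 :* (s :* s)) refl (s * s)) (trans (sym eq) (cong (λ t → x * x + t * r ⁴) (*-identityˡ p)))))
      where
      open +-*-Solver
      2∤x : ¬ 2 ∣ x
      2∤x 2∣x = forSquare (forSquare (forSquare (lookup oddX p₁₆) x) r) s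
        (compare₁₆ (square x ⊕ 1*p ⊗ fourth r) (const 4 ⊗ fourth s) eq)
        (coprime⇒notBothEven c (1*p ⊗ fourth r) (const 4 ⊗ fourth s)) (even-sq x 2∣x)
      odd : ¬ 2 ∣ 2 * (s * s) + x
      odd 2∣ = 2∤x (∣m+n∣m⇒∣n 2∣ (2∣2* (s * s)))
      cop : Coprime (2 * (s * s)) x
      cop = coprime-difference eq (divides (2 * (s * s)) (solve 1 (λ s → con 4 :* (s :* s) := con 2 :* s :* (con 2 :* s)) refl (s * s))) c
      go : ¬ Factorisation p r (2 * x) (2 * (2 * (s * s)))
      -- 4 s² is 0 or 4 modulo 16. Coprimality and parity make a and b odd, so the other side is p +
      -- 1, that is 8 or 12.
      go (factorisation e₁ e₂ a b e≡ _ _ total cop′) = noTotal-prime pp (reduce p) 4 s e₁ e₂ a b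
        (lookup (from-yes (all? (λ P → noTotal? 4 P 1) (7 ∷ 11 ∷ []))) p₁₆)
        (lookup (from-yes (all? (λ P → noTotal? 4 1 P) (7 ∷ 11 ∷ []))) p₁₆)
        e≡ (trans (*-assoc 2 2 (s * s)) total) cop′

    -- Of the splittings of 4p only (4p, 1) survives: (2, 2p) and (2p, 2) share a factor 2, (p, 4)
    -- is `excluded`, and (1, 4p) and (4, p) fail modulo 16.
    first : ∀ {x Y z} → Y ≢ 0 → Factorisation (4 * p) Y (x * x) z → ∃ λ r → ∃ λ s → r ≢ 0 × r * s ≡ Y × Factorisation p r x (s * s)
    first {x} Y≢0 (factorisation d₁ d₂ r s d≡ refl difference _ cop) = r , s , r≢0 , refl ,
        Sum.[ (λ (a , d₁≡ , e) → left (factors-4 a d₂ e) d₁≡ difference cop) , (λ (a , d₂≡ , e) → right (factors-4 d₁ a e) d₂≡ difference cop) ] (prime-split pp 4 d₁ d₂ d≡)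
      where
      r≢0 = *-≢0ˡ r s Y≢0
      left : ∀ {a d₁ d₂} → (a , d₂) ∈ (1 , 4) ∷ (2 , 2) ∷ (4 , 1) ∷ [] → d₁ ≡ a * p → x * x + d₁ * r ⁴ ≡ d₂ * s ⁴ → Coprime (d₁ * r ⁴) (d₂ * s ⁴) → Factorisation p r x (s * s)
      left (here refl) refl eq c = ⊥-elim (excluded x r s r≢0 eq c)
      left (there (here refl)) refl eq c = ⊥-elim (both-doubled p 1 (r ⁴) (s ⁴) refl refl c)
      left (there (there (here refl))) refl eq c = second-step x r s p p≢0 r≢0 refl refl eq c
      right : ∀ {a d₁ d₂} → (d₁ , a) ∈ (1 , 4) ∷ (2 , 2) ∷ (4 , 1) ∷ [] → d₂ ≡ a * p → x * x + d₁ * r ⁴ ≡ d₂ * s ⁴ → Coprime (d₁ * r ⁴) (d₂ * s ⁴) → Factorisation p r x (s * s)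
      right (here refl) refl eq c = ⊥-elim (noDifference₁ x r s (lookup (from-yes (all? (λ P → noDifference? 1 1 (4 * P)) (7 ∷ 11 ∷ []))) p₁₆) (const 1) 4*p eq c)
      right (there (here refl)) refl eq c = ⊥-elim (both-doubled 1 p (r ⁴) (s ⁴) refl refl c)
      right (there (there (here refl))) refl eq c = ⊥-elim (noDifference₁ x r s (lookup (from-yes (all? (λ P → noDifference? 1 4 (1 * P)) (7 ∷ 11 ∷ []))) p₁₆) (const 4) 1*p eq c)

    second : ∀ {r x s} → Factorisation p r x (s * s) → Solution p r s
    second {s = s} (factorisation e₁ e₂ a b e≡ ab≡r _ total cop) with split-prime pp e₁ e₂ e≡
    ... | inj₁ (e₁≡p , e₂≡1) = solutionˡ s a b e₁≡p e₂≡1 ab≡r total cop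
    ... | inj₂ (e₁≡1 , e₂≡p) = solutionʳ s a b e₁≡1 e₂≡p ab≡r total cop

    descent : ∀ n x y z → y < n → y ≢ 0 → Coprime x z → z * z ≢ x ⁴ + p * y ⁴
    descent (suc n) x y z (s≤s y≤n) y≢0 c eq = even (even-y x y z (lookup (from-yes (all? evenYs? (7 ∷ 11 ∷ []))) p₁₆) (reduce p) c eq)
      where
      even : 2 ∣ y → ⊥
      even (divides Y refl) = go (first (*-≢0ˡ Y 2 y≢0) (first-step {4 * p} {p} (*-≢0ₙ {4} (λ ()) p≢0) y≢0 (*-comm p 4) c eq))
        where
        go : (∃ λ r → ∃ λ s → r ≢ 0 × r * s ≡ Y × Factorisation p r x (s * s)) → ⊥
        go (r , s , r≢0 , rs≡Y , F) = descent n (Solution.a sol) (Solution.b sol) s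
            (<-≤-trans (solution-< y≢0 rs≡Y sol) y≤n) (solution-≢0 r≢0 sol) (Solution.coprime sol) (Solution.equation sol)
          where sol = second F

  -- c = 2m, where m is 1 or a prime congruent to 3 or 5 modulo 8.

  module PlusTwice {m : ℕ} (hyp : m ≡ 1 ⊎ (Prime m × m % 16 ∈ 3 ∷ 5 ∷ 11 ∷ 13 ∷ [])) where
    m₁₆ : m % 16 ∈ 1 ∷ 3 ∷ 5 ∷ 11 ∷ 13 ∷ []
    m₁₆ = Sum.[ (λ { refl → here refl }) , (λ (_ , i) → there i) ] hyp

    m≢0 : m ≢ 0
    m≢0 = Sum.[ (λ { refl () }) , (λ (pp , _) → prime≢0 pp) ] hyp

    -- For m = 1 every splitting of k counts as one with m on the left, so both kinds of m share the
    -- case analysis.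
    split : ∀ k d₁ d₂ → d₁ * d₂ ≡ k * m
      → (∃ λ a → d₁ ≡ a * m × a * d₂ ≡ k) ⊎ (m % 16 ∈ 3 ∷ 5 ∷ 11 ∷ 13 ∷ [] × ∃ λ a → d₂ ≡ a * m × d₁ * a ≡ k)
    split k d₁ d₂ eq = Sum.[ (λ { refl → inj₁ (d₁ , sym (*-identityʳ d₁) , trans eq (*-identityʳ k)) })
                           , (λ (pp , i) → Sum.map₂ (i ,_) (prime-split pp k d₁ d₂ eq)) ] hyp

    1*m = const 1 ⊗ reduce m
    2m≢0 = *-≢0ₙ {2} (λ ()) m≢0

    -- Only (8m, 1) survives: (m, 8), (1, 8m) and (8, m) fail modulo 16, and every other splitting
    -- has two even entries.
    first : ∀ {x Y z} → Y ≢ 0 → Factorisation (8 * m) Y (x * x) z → ∃ λ r → ∃ λ s → r ≢ 0 × r * s ≡ Y × Factorisation (2 * m) r x (s * s)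
    first {x} Y≢0 (factorisation d₁ d₂ r s d≡ refl difference _ cop) = r , s , r≢0 , refl ,
        Sum.[ (λ (a , d₁≡ , e) → left (factors-8 a d₂ e) d₁≡ difference cop) , (λ (i , a , d₂≡ , e) → right i (factors-8 d₁ a e) d₂≡ difference cop) ] (split 8 d₁ d₂ d≡)
      where
      r≢0 = *-≢0ˡ r s Y≢0
      left : ∀ {a d₁ d₂} → (a , d₂) ∈ (1 , 8) ∷ (2 , 4) ∷ (4 , 2) ∷ (8 , 1) ∷ [] → d₁ ≡ a * m → x * x + d₁ * r ⁴ ≡ d₂ * s ⁴ → Coprime (d₁ * r ⁴) (d₂ * s ⁴) → Factorisation (2 * m) r x (s * s)
      left (here refl) refl eq c = ⊥-elim (noDifference₁ x r s (lookup (from-yes (all? (λ M → noDifference? 1 (1 * M) 8) (1 ∷ 3 ∷ 5 ∷ 11 ∷ 13 ∷ []))) m₁₆) 1*m (const 8) eq c)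
      left (there (here refl)) refl eq c = ⊥-elim (both-doubled m 2 (r ⁴) (s ⁴) refl refl c)
      left (there (there (here refl))) refl eq c = ⊥-elim (both-doubled (2 * m) 1 (r ⁴) (s ⁴) (*-assoc 2 2 m) refl c)
      left (there (there (there (here refl)))) refl eq c = second-step x r s (2 * m) 2m≢0 r≢0 (*-assoc 4 2 m) refl eq c
      right : ∀ {a d₁ d₂} → m % 16 ∈ 3 ∷ 5 ∷ 11 ∷ 13 ∷ [] → (d₁ , a) ∈ (1 , 8) ∷ (2 , 4) ∷ (4 , 2) ∷ (8 , 1) ∷ [] → d₂ ≡ a * m → x * x + d₁ * r ⁴ ≡ d₂ * s ⁴ → Coprime (d₁ * r ⁴) (d₂ * s ⁴) → Factorisation (2 * m) r x (s * s)
      right i (here refl) refl eq c = ⊥-elim (noDifference₁ x r s (lookup (from-yes (all? (λ M → noDifference? 1 1 (8 * M)) (3 ∷ 5 ∷ 11 ∷ 13 ∷ []))) i) (const 1) (const 8 ⊗ reduce m) eq c)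
      right i (there (here refl)) refl eq c = ⊥-elim (both-doubled 1 (2 * m) (r ⁴) (s ⁴) refl (*-assoc 2 2 m) c)
      right i (there (there (here refl))) refl eq c = ⊥-elim (both-doubled 2 m (r ⁴) (s ⁴) refl refl c)
      right i (there (there (there (here refl)))) refl eq c = ⊥-elim (noDifference₁ x r s (lookup (from-yes (all? (λ M → noDifference? 1 8 (1 * M)) (3 ∷ 5 ∷ 11 ∷ 13 ∷ []))) i) (const 8) 1*m eq c)

    second : ∀ {r x s} → Factorisation (2 * m) r x (s * s) → Solution (2 * m) r s
    second {r} {x} {s} (factorisation e₁ e₂ a b e≡ ab≡r _ total cop) =
        Sum.[ (λ (k , e₁≡ , e) → left (factors-2 k e₂ e) e₁≡ total cop) , (λ (i , k , e₂≡ , e) → right i (factors-2 e₁ k e) e₂≡ total cop) ] (split 2 e₁ e₂ e≡)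
      where
      left : ∀ {k e₁ e₂} → (k , e₂) ∈ (1 , 2) ∷ (2 , 1) ∷ [] → e₁ ≡ k * m → s * s ≡ e₁ * a ⁴ + e₂ * b ⁴ → Coprime (e₁ * a ⁴) (e₂ * b ⁴) → Solution (2 * m) r s
      -- For m = 1 this is the equation itself. For a prime m, a is odd and s² would be m or m + 2
      -- modulo 16, neither of them a square.
      left (here refl) refl eq c = Sum.[ (λ { refl → solutionʳ s a b refl refl ab≡r eq c })
        , (λ (_ , i) → ⊥-elim (noTotal 1 s a b (lookup (from-yes (all? (λ M → noTotal? 1 (1 * M) 2) (3 ∷ 5 ∷ 11 ∷ 13 ∷ []))) i) 1*m (const 2) (trans (*-identityˡ (s * s)) eq) c)) ] hyp
      left (there (here refl)) refl eq c = solutionˡ s a b refl refl ab≡r eq c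
      right : ∀ {k e₁ e₂} → m % 16 ∈ 3 ∷ 5 ∷ 11 ∷ 13 ∷ [] → (e₁ , k) ∈ (1 , 2) ∷ (2 , 1) ∷ [] → e₂ ≡ k * m → s * s ≡ e₁ * a ⁴ + e₂ * b ⁴ → Coprime (e₁ * a ⁴) (e₂ * b ⁴) → Solution (2 * m) r s
      right i (here refl) refl eq c = solutionʳ s a b refl refl ab≡r eq c
      right i (there (here refl)) refl eq c = ⊥-elim (noTotal 1 s a b (lookup (from-yes (all? (λ M → noTotal? 1 2 (1 * M)) (3 ∷ 5 ∷ 11 ∷ 13 ∷ []))) i) (const 2) 1*m (trans (*-identityˡ (s * s)) eq) c)

    descent : ∀ n x y z → y < n → y ≢ 0 → Coprime x z → z * z ≢ x ⁴ + 2 * m * y ⁴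
    descent (suc n) x y z (s≤s y≤n) y≢0 c eq = even (even-y x y z (lookup (from-yes (all? (λ M → evenYs? (2 * M)) (1 ∷ 3 ∷ 5 ∷ 11 ∷ 13 ∷ []))) m₁₆) (const 2 ⊗ reduce m) c eq)
      where
      even : 2 ∣ y → ⊥
      even (divides Y refl) = go (first (*-≢0ˡ Y 2 y≢0) (first-step {8 * m} {2 * m} (*-≢0ₙ {8} (λ ()) m≢0) y≢0 (trans (*-comm (2 * m) 4) (sym (*-assoc 4 2 m))) c eq))
        where
        go : (∃ λ r → ∃ λ s → r ≢ 0 × r * s ≡ Y × Factorisation (2 * m) r x (s * s)) → ⊥
        go (r , s , r≢0 , rs≡Y , F) = descent n (Solution.a sol) (Solution.b sol) s
            (<-≤-trans (solution-< y≢0 rs≡Y sol) y≤n) (solution-≢0 r≢0 sol) (Solution.coprime sol) (Solution.equation sol)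
          where sol = second F

  -- c = -p and c = 4p with p congruent to 3, 11 or 13 modulo 16: each equation descends to the
  -- other.

  module MinusPrime {p : ℕ} (pp : Prime p) (p₁₆ : p % 16 ∈ 3 ∷ 11 ∷ 13 ∷ []) where
    p≢0 = prime≢0 pp

    parities : All (λ P → All (λ X → All (λ Y → All (λ Z →
      X * X % 16 ≡ (Z + P * (Y * Y)) % 16 → ¬ Y % 2 ≡ 0 → (¬ X % 2 ≡ 0) × Z % 2 ≡ 0) squares) squares) squares) (3 ∷ 11 ∷ 13 ∷ [])
    parities = from-yes (all? (λ P → all? (λ X → all? (λ Y → all? (λ Z →
      X * X % 16 ≟ (Z + P * (Y * Y)) % 16 →-dec ¬? (Y % 2 ≟ 0) →-dec (¬? (X % 2 ≟ 0) ×-dec Z % 2 ≟ 0)) squares) squares) squares) (3 ∷ 11 ∷ 13 ∷ []))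

    -- Residues make x odd and z even, so x² - z and x² + z are coprime, and up to order 2 x² = p a⁴
    -- + b⁴ with a b = y odd. The right side is p + 1, that is 4, 12 or 14 modulo 16, while 2 x² is
    -- 0, 2 or 8.
    minus-odd : ∀ x y z → ¬ 2 ∣ y → Coprime x z → x ⁴ ≢ z * z + p * y ⁴
    minus-odd x y z 2∤y c eq = go (factor-odd {p} {y} {z} {x * x} p≢0 (λ { refl → 2∤y (2 ∣0) }) (Coprimality.sym (coprime-squareʳ {z} {x} c)) odd eq)
      where
      par = forSquare (forSquare (forSquare (lookup parities p₁₆) x) y) z
        (compare₁₆ (fourth x) (square z ⊕ reduce p ⊗ fourth y) eq) (λ Y≡0 → 2∤y (sq-even y Y≡0))
      odd : ¬ 2 ∣ x * x + z
      odd 2∣ = proj₁ par (even⁻ (square x) (∣m+n∣n⇒∣m 2∣ (sq-even z (proj₂ par))))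
      go : ¬ Factorisation p y (2 * z) (2 * (x * x))
      go (factorisation e₁ e₂ a b e≡ _ _ total cop) = noTotal-prime pp (reduce p) 2 x e₁ e₂ a b
        (lookup (from-yes (all? (λ P → noTotal? 2 P 1) (3 ∷ 11 ∷ 13 ∷ []))) p₁₆)
        (lookup (from-yes (all? (λ P → noTotal? 2 1 P) (3 ∷ 11 ∷ 13 ∷ []))) p₁₆)
        e≡ total cop

    oddZ : All (λ P → All (λ X → All (λ Y → All (λ Z →
      Z % 16 ≡ (4 * (X * X) + P * (Y * Y)) % 16 → ¬ Y % 2 ≡ 0 → ¬ Z % 2 ≡ 0) squares) squares) squares) (3 ∷ 11 ∷ 13 ∷ [])
    oddZ = from-yes (all? (λ P → all? (λ X → all? (λ Y → all? (λ Z →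
      Z % 16 ≟ (4 * (X * X) + P * (Y * Y)) % 16 →-dec ¬? (Y % 2 ≟ 0) →-dec ¬? (Z % 2 ≟ 0)) squares) squares) squares) (3 ∷ 11 ∷ 13 ∷ []))

    -- Factoring z² - (2x²)² gives either (2x)² + p r⁴ = s⁴ with r odd, against `minus-odd`, or 4 x²
    -- + r⁴ = p s⁴, which fails modulo 16.
    four-odd : ∀ x y z → ¬ 2 ∣ y → Coprime x z → z * z ≢ 4 * x ⁴ + p * y ⁴
    four-odd x y z 2∤y c eq = go (factor-odd {p} {y} {2 * (x * x)} {z} p≢0 (λ { refl → 2∤y (2 ∣0) })
        (coprime-*ʳ z 2 (x * x) (odd⇒coprime-2 2∤z) (coprime-squareʳ {z} {x} c))
        (λ 2∣ → 2∤z (∣m+n∣n⇒∣m 2∣ (2∣2* (x * x))))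
        (trans eq (cong (_+ p * y ⁴) (solve 1 (λ x → con 4 :* (x :* x) := con 2 :* x :* (con 2 :* x)) refl (x * x)))))
      where
      open +-*-Solver
      2∤z : ¬ 2 ∣ z
      2∤z 2∣z = forSquare (forSquare (forSquare (lookup oddZ p₁₆) x) y) z
        (compare₁₆ (square z) (const 4 ⊗ fourth x ⊕ reduce p ⊗ fourth y) eq) (λ Y≡0 → 2∤y (sq-even y Y≡0)) (even-sq z 2∣z)
      go : ¬ Factorisation p y (2 * (2 * (x * x))) (2 * z)
      go (factorisation e₁ e₂ r s e≡ rs≡y difference _ cop) with split-prime pp e₁ e₂ e≡
      ... | inj₁ (refl , refl) = minus-odd s r (2 * x) (λ 2∣r → 2∤y (subst (2 ∣_) rs≡y (∣m⇒∣m*n s 2∣r)))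
              (coprime-difference eq′ (∣n⇒∣m*n 1 (∣-⁴ s ∣-refl)) cop) (trans (sym (*-identityˡ (s ⁴))) (sym eq′))
        where
        eq′ : 2 * x * (2 * x) + p * r ⁴ ≡ 1 * s ⁴
        eq′ = trans (cong (_+ p * r ⁴) (solve 1 (λ x → con 2 :* x :* (con 2 :* x) := con 2 :* (con 2 :* (x :* x))) refl x)) difference
      ... | inj₂ (refl , refl) = noDifference 4 x r s (lookup (from-yes (all? (λ P → noDifference? 4 1 P) (3 ∷ 11 ∷ 13 ∷ []))) p₁₆) (const 1) (reduce p)
              (trans (cong (_+ 1 * r ⁴) (*-assoc 2 2 (x * x))) difference) cop

    -- x² is the sum of the two factors. The splitting 4p · 1 leads to the equation with c = 4p, and
    -- p · 4 to an instance of `four-odd`.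
    minus-even : ∀ x Y z → Y * 2 ≢ 0 → Coprime x z → x ⁴ ≡ z * z + p * (Y * 2) ⁴ → Solution (4 * p) Y x
    minus-even x Y z y≢0 c eq = go (factor-even {4 * p} {Y} {z} {x * x} (*-≢0ₙ {4} (λ ()) p≢0) (*-≢0ˡ Y 2 y≢0) (Coprimality.sym (coprime-squareʳ {z} {x} c))
        (trans eq (cong (z * z +_) (solve 2 (λ p Y → p :* (Y :* con 2 :* (Y :* con 2) :* (Y :* con 2 :* (Y :* con 2))) := con 4 :* (con 4 :* p :* (Y :* Y :* (Y :* Y)))) refl p Y))))
      where
      open +-*-Solver
      impossible : ∀ a b → x * x ≡ 1 * p * a ⁴ + 4 * b ⁴ → ¬ Coprime (1 * p * a ⁴) (4 * b ⁴)
      impossible a b eq c = four-odd b a x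
        (λ 2∣a → both-even c (∣n⇒∣m*n (1 * p) (∣-⁴ a 2∣a)) (∣m⇒∣m*n (b ⁴) (divides 2 refl)))
        (coprime-part {b} {x} (trans eq (+-comm (1 * p * a ⁴) (4 * b ⁴))) (∣n⇒∣m*n 4 (∣-⁴ b ∣-refl)) (Coprimality.sym c))
        (trans eq (solve 3 (λ p a b → con 1 :* p :* a :+ b := b :+ p :* a) refl p (a ⁴) (4 * b ⁴)))
      go : Factorisation (4 * p) Y z (x * x) → Solution (4 * p) Y x
      go (factorisation e₁ e₂ a b e≡ ab≡Y _ total cop) =
          Sum.[ (λ (k , e₁≡ , e) → left (factors-4 k e₂ e) e₁≡ total cop) , (λ (k , e₂≡ , e) → right (factors-4 e₁ k e) e₂≡ total cop) ] (prime-split pp 4 e₁ e₂ e≡)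
        where
        left : ∀ {k e₁ e₂} → (k , e₂) ∈ (1 , 4) ∷ (2 , 2) ∷ (4 , 1) ∷ [] → e₁ ≡ k * p → x * x ≡ e₁ * a ⁴ + e₂ * b ⁴ → Coprime (e₁ * a ⁴) (e₂ * b ⁴) → Solution (4 * p) Y x
        left (here refl) refl eq c = ⊥-elim (impossible a b eq c)
        left (there (here refl)) refl eq c = ⊥-elim (both-doubled p 1 (a ⁴) (b ⁴) refl refl c)
        left (there (there (here refl))) refl eq c = solutionˡ x a b refl refl ab≡Y eq c
        right : ∀ {k e₁ e₂} → (e₁ , k) ∈ (1 , 4) ∷ (2 , 2) ∷ (4 , 1) ∷ [] → e₂ ≡ k * p → x * x ≡ e₁ * a ⁴ + e₂ * b ⁴ → Coprime (e₁ * a ⁴) (e₂ * b ⁴) → Solution (4 * p) Y x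
        right (here refl) refl eq c = solutionʳ x a b refl refl ab≡Y eq c
        right (there (here refl)) refl eq c = ⊥-elim (both-doubled 1 p (a ⁴) (b ⁴) refl refl c)
        right (there (there (here refl))) refl eq c = ⊥-elim (impossible b a (trans eq (+-comm (4 * a ⁴) (1 * p * b ⁴))) (Coprimality.sym c))

    -- The coefficient 4p already carries the factor 4 of `factor-even`, so odd y is covered too.
    -- The splitting (1, p) fails modulo 16 and (p, 1) leads to the equation with c = -p.
    plus-step : ∀ x y z → y ≢ 0 → Coprime x z → z * z ≡ x ⁴ + 4 * p * y ⁴
      → ∃ λ r → ∃ λ s → r * s ≡ y × Coprime s x × s ⁴ ≡ x * x + p * r ⁴
    plus-step x y z y≢0 c eq = go (factor-even {p} {y} {x * x} {z} p≢0 y≢0 (coprime-squareʳ {z} {x} c) (trans eq (cong (x ⁴ +_) (*-assoc 4 p (y ⁴)))))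
      where
      go : Factorisation p y (x * x) z → ∃ λ r → ∃ λ s → r * s ≡ y × Coprime s x × s ⁴ ≡ x * x + p * r ⁴
      go (factorisation d₁ d₂ r s d≡ rs≡y difference _ cop) with split-prime pp d₁ d₂ d≡
      ... | inj₁ (refl , refl) = r , s , rs≡y , coprime-difference difference (∣n⇒∣m*n 1 (∣-⁴ s ∣-refl)) cop , trans (sym (*-identityˡ (s ⁴))) (sym difference)
      ... | inj₂ (refl , refl) = ⊥-elim (noDifference₁ x r s (lookup (from-yes (all? (λ P → noDifference? 1 1 P) (3 ∷ 11 ∷ 13 ∷ []))) p₁₆) (const 1) (reduce p) difference cop)

    Smaller : ℕ → Set
    Smaller y = ∃ λ a → ∃ λ b → ∃ λ s → b < y × b ≢ 0 × Coprime a s × s * s ≡ a ⁴ + 4 * p * b ⁴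

    smaller : ∀ {R s y} → R * 2 * s ≡ y → y ≢ 0 → Solution (4 * p) R s → Smaller y
    smaller {R} {s} refl y≢0 (solution a b q bq≡R cop eq) = a , b , s , b<y , (λ { refl → *-≢0ˡ R 2 r≢0 (sym bq≡R) }) , cop , eq
      where
      r≢0 : R * 2 ≢ 0
      r≢0 = *-≢0ˡ (R * 2) s y≢0
      b<y : b < R * 2 * s
      b<y = <-≤-trans (factor-<ˡ {b} {q} {R} {1} {R} r≢0 bq≡R (*-identityʳ R)) (m≤m*n (R * 2) s {{≢-nonZero (*-≢0ʳ (R * 2) s y≢0)}})

    -- A round trip through both equations: in s⁴ = x² + p r⁴ the number r is even by `minus-odd`,
    -- and `minus-even` comes back with b dividing r/2, where r divides y.
    plus-smaller : ∀ x y z → y ≢ 0 → Coprime x z → z * z ≡ x ⁴ + 4 * p * y ⁴ → Smaller y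
    plus-smaller x y z y≢0 c eq = go (plus-step x y z y≢0 c eq)
      where
      by-parity : ∀ r s → Dec (2 ∣ r) → r * s ≡ y → Coprime s x → s ⁴ ≡ x * x + p * r ⁴ → Smaller y
      by-parity r s (no 2∤r) _ cop eq′ = ⊥-elim (minus-odd s r x 2∤r cop eq′)
      by-parity r s (yes (divides R refl)) rs≡y cop eq′ = smaller rs≡y y≢0 (minus-even s R x (λ e → y≢0 (trans (sym rs≡y) (cong (_* s) e))) cop eq′)
      go : (∃ λ r → ∃ λ s → r * s ≡ y × Coprime s x × s ⁴ ≡ x * x + p * r ⁴) → Smaller y
      go (r , s , rs≡y , cop , eq′) = by-parity r s (2 ∣? r) rs≡y cop eq′

    descent : ∀ n x y z → y < n → y ≢ 0 → Coprime x z → z * z ≢ x ⁴ + 4 * p * y ⁴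
    descent (suc n) x y z (s≤s y≤n) y≢0 c eq = go (plus-smaller x y z y≢0 c eq)
      where
      go : Smaller y → ⊥
      go (a , b , s , b<y , b≢0 , cop , eq′) = descent n a b s (<-≤-trans b<y y≤n) b≢0 cop eq′

    minus-no-solution : ∀ x y z → y ≢ 0 → Coprime x z → x ⁴ ≢ z * z + p * y ⁴
    minus-no-solution x y z y≢0 c eq with 2 ∣? y
    ... | no 2∤y = minus-odd x y z 2∤y c eq
    ... | yes (divides Y refl) = descent (suc (Solution.b sol)) (Solution.a sol) (Solution.b sol) x ≤-refl
            (solution-≢0 (*-≢0ˡ Y 2 y≢0) sol) (Solution.coprime sol) (Solution.equation sol)
      where sol = minus-even x Y z y≢0 c eq

  -- Reduction to coprime solutions.

  square-quotient : ∀ {n m z} → n ≢ 0 → n * n * m ≡ z * z → ∃ λ z′ → m ≡ z′ * z′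
  square-quotient {n} {m} {z} n≢0 eq = go (gcd-split z n n≢0)
    where
    open +-*-Solver
    go : (∃ λ g → ∃ λ z′ → ∃ λ n′ → g ≢ 0 × z ≡ z′ * g × n ≡ n′ * g × Coprime z′ n′) → ∃ λ z′ → m ≡ z′ * z′
    go (g , z′ , n′ , g≢0 , refl , refl , cop) = z′ , trans (sym (trans (cong (λ t → t * t * m) n′≡1) (*-identityˡ m))) n′n′m≡z′z′
      where
      n′n′m≡z′z′ : n′ * n′ * m ≡ z′ * z′
      n′n′m≡z′z′ = cancelˡ g g≢0 (cancelˡ g g≢0 (trans (solve 3 (λ g n m → g :* (g :* (n :* n :* m)) := n :* g :* (n :* g) :* m) refl g n′ m)
        (trans eq (solve 2 (λ g z → z :* g :* (z :* g) := g :* (g :* (z :* z))) refl g z′))))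
      n′∣z′ : n′ ∣ z′
      n′∣z′ = coprime-divisor {n′} {z′} {z′} (Coprimality.sym cop) (divides (n′ * m) (trans (sym n′n′m≡z′z′) (solve 2 (λ n m → n :* n :* m := n :* m :* n) refl n′ m)))
      n′≡1 : n′ ≡ 1
      n′≡1 = cop (n′∣z′ , ∣-refl)

  module _ {c : ℕ} where
    -- Dividing x and y by their gcd g turns z² into z²/g⁴, a natural number and by
    -- `square-quotient` a square.
    plus-coprime : (∀ x y z → x ≢ 0 → y ≢ 0 → Coprime x y → z * z ≢ x ⁴ + c * y ⁴)
      → ∀ x y z → x ≢ 0 → y ≢ 0 → z * z ≢ x ⁴ + c * y ⁴
    plus-coprime none x y z x≢0 y≢0 eq = go (gcd-split x y y≢0)
      where
      open +-*-Solver
      go : (∃ λ g → ∃ λ x′ → ∃ λ y′ → g ≢ 0 × x ≡ x′ * g × y ≡ y′ * g × Coprime x′ y′) → ⊥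
      go (g , x′ , y′ , g≢0 , refl , refl , cop) = none x′ y′ (proj₁ root) (*-≢0ˡ x′ g x≢0) (*-≢0ˡ y′ g y≢0) cop (sym (proj₂ root))
        where
        root = square-quotient {g * g} {x′ ⁴ + c * y′ ⁴} {z} (*-≢0ₙ g≢0 g≢0) (trans (solve 4 (λ g c x y →
          g :* g :* (g :* g) :* (x :* x :* (x :* x) :+ c :* (y :* y :* (y :* y)))
          := x :* g :* (x :* g) :* (x :* g :* (x :* g)) :+ c :* (y :* g :* (y :* g) :* (y :* g :* (y :* g)))) refl g c x′ y′) (sym eq))

    minus-coprime : (∀ x y z → x ≢ 0 → y ≢ 0 → Coprime x y → x ⁴ ≢ z * z + c * y ⁴)
      → ∀ x y z → x ≢ 0 → y ≢ 0 → x ⁴ ≢ z * z + c * y ⁴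
    minus-coprime none x y z x≢0 y≢0 eq = go (gcd-split x y y≢0)
      where
      open +-*-Solver
      go : (∃ λ g → ∃ λ x′ → ∃ λ y′ → g ≢ 0 × x ≡ x′ * g × y ≡ y′ * g × Coprime x′ y′) → ⊥
      go (g , x′ , y′ , g≢0 , refl , refl , cop) = finish (∣m+n∣n⇒∣m {g ⁴} {z * z} {c * (y′ * g) ⁴}
          (divides (x′ ⁴) (trans (sym eq) (solve 2 (λ x g → x :* g :* (x :* g) :* (x :* g :* (x :* g)) := x :* x :* (x :* x) :* (g :* g :* (g :* g))) refl x′ g)))
          (divides (c * y′ ⁴) (solve 3 (λ c y g → c :* (y :* g :* (y :* g) :* (y :* g :* (y :* g))) := c :* (y :* y :* (y :* y)) :* (g :* g :* (g :* g))) refl c y′ g)))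
        where
        finish : g ⁴ ∣ z * z → ⊥
        finish (divides k zz≡kg⁴) = none x′ y′ (proj₁ root) (*-≢0ˡ x′ g x≢0) (*-≢0ˡ y′ g y≢0) cop
            (trans x′⁴≡ (cong (_+ c * y′ ⁴) (proj₂ root)))
          where
          root = square-quotient {g * g} {k} {z} (*-≢0ₙ g≢0 g≢0) (trans (*-comm (g ⁴) k) (sym zz≡kg⁴))
          x′⁴≡ : x′ ⁴ ≡ k + c * y′ ⁴
          x′⁴≡ = cancelˡ (g ⁴) (*-≢0ₙ (*-≢0ₙ g≢0 g≢0) (*-≢0ₙ g≢0 g≢0))
            (trans (solve 2 (λ x g → g :* g :* (g :* g) :* (x :* x :* (x :* x)) := x :* g :* (x :* g) :* (x :* g :* (x :* g))) refl x′ g)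
            (trans eq (trans (cong (_+ c * (y′ * g) ⁴) zz≡kg⁴)
            (solve 4 (λ k c y g → k :* (g :* g :* (g :* g)) :+ c :* (y :* g :* (y :* g) :* (y :* g :* (y :* g))) := g :* g :* (g :* g) :* (k :+ c :* (y :* y :* (y :* y)))) refl k c y′ g))))

    -- The descents ask for x prime to z, while lowest terms give x prime to y. A common divisor e
    -- of x and z has e² dividing c y⁴, hence c; for squarefree c this means e = 1.
    square-∣ : ∀ {e x y} → Coprime x y → e ∣ x → e * e ∣ c * y ⁴ → e * e ∣ c
    square-∣ {e} {x} {y} cop e∣x d = coprime-divisor {e * e} {y ⁴} {c} (coprime-*ʳ (e * e) (y * y) (y * y) ee-yy ee-yy) (subst (e * e ∣_) (*-comm c (y ⁴)) d)
      where
      e-y : Coprime e y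
      e-y = coprime-∣ e∣x ∣-refl cop
      ee-y : Coprime (e * e) y
      ee-y = Coprimality.sym (coprime-*ʳ y e e (Coprimality.sym e-y) (Coprimality.sym e-y))
      ee-yy : Coprime (e * e) (y * y)
      ee-yy = coprime-*ʳ (e * e) y y ee-y ee-y

    plus-common : ∀ {e x y z} → Coprime x y → z * z ≡ x ⁴ + c * y ⁴ → e ∣ x → e ∣ z → e * e ∣ c
    plus-common {e} {x} {y} {z} cop eq e∣x e∣z = square-∣ {e} {x} {y} cop e∣x
      (∣m+n∣m⇒∣n (subst (e * e ∣_) eq (*-pres-∣ e∣z e∣z)) (∣m⇒∣m*n (x * x) (*-pres-∣ e∣x e∣x)))

    minus-common : ∀ {e x y z} → Coprime x y → x ⁴ ≡ z * z + c * y ⁴ → e ∣ x → e ∣ z → e * e ∣ c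
    minus-common {e} {x} {y} {z} cop eq e∣x e∣z = square-∣ {e} {x} {y} cop e∣x
      (∣m+n∣m⇒∣n (subst (e * e ∣_) eq (∣m⇒∣m*n (x * x) (*-pres-∣ e∣x e∣x))) (*-pres-∣ e∣z e∣z))

  square-∣-prime : ∀ {p m} e → Prime p → ¬ p ∣ m → e * e ∣ m * p → e * e ∣ m
  square-∣-prime {p} {m} e pp p∤m d = go (p ∣? e)
    where
    instance _ = prime⇒nonZero pp
    go : Dec (p ∣ e) → e * e ∣ m
    go (yes p∣e) = ⊥-elim (p∤m (*-cancelʳ-∣ p (∣-trans (*-pres-∣ p∣e p∣e) d)))
    go (no p∤e) = coprime-divisor {e * e} {p} {m} (Coprimality.sym (coprime-*ʳ p e e p-e p-e)) (subst (e * e ∣_) (*-comm m p) d)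
      where
      p-e : Coprime p e
      p-e {f} (f∣p , f∣e) with prime⇒irreducible pp f∣p
      ... | inj₁ f≡1 = f≡1
      ... | inj₂ refl = ⊥-elim (p∤e f∣e)

  square-∣1 : ∀ {e} → e * e ∣ 1 → e ≡ 1
  square-∣1 {e} d = ∣1⇒≡1 (∣-trans (∣m⇒∣m*n e ∣-refl) d)

  square-∣2 : ∀ {e} → e * e ∣ 2 → e ≡ 1
  square-∣2 {e} d = go (prime⇒irreducible prime[2] (∣-trans (∣m⇒∣m*n e ∣-refl) d))
    where
    go : e ≡ 1 ⊎ e ≡ 2 → e ≡ 1
    go (inj₁ e≡1) = e≡1
    go (inj₂ refl) with s≤s (s≤s ()) ← ∣⇒≤ d

  square-∣4 : ∀ {e} → ¬ 2 ∣ e → e * e ∣ 4 → e ≡ 1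
  square-∣4 {e} 2∤e d with ∣-trans (∣m⇒∣m*n e ∣-refl) d
  ... | divides q eq = go (factors-4 e q (trans (*-comm e q) (sym eq)))
    where
    go : ∀ {q} → (e , q) ∈ (1 , 4) ∷ (2 , 2) ∷ (4 , 1) ∷ [] → e ≡ 1
    go (here e≡) = cong proj₁ e≡
    go (there (here e≡)) = ⊥-elim (2∤e (subst (2 ∣_) (sym (cong proj₁ e≡)) ∣-refl))
    go (there (there (here e≡))) = ⊥-elim (2∤e (subst (2 ∣_) (sym (cong proj₁ e≡)) (divides 2 refl)))

  prime∤1 : ∀ {p} → Prime p → ¬ p ∣ 1
  prime∤1 pp p∣1 = ¬prime[1] (subst Prime (∣1⇒≡1 p∣1) pp)

  prime∣2⇒≡2 : ∀ {p} → Prime p → p ∣ 2 → p ≡ 2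
  prime∣2⇒≡2 {p} pp p∣2 = Sum.[ (λ { refl → ⊥-elim (prime∤1 pp ∣-refl) }) , (λ e → e) ] (prime⇒irreducible prime[2] p∣2)

  prime∤2 : ∀ {p} → Prime p → p % 16 ≢ 2 → ¬ p ∣ 2
  prime∤2 pp p≢2 p∣2 = p≢2 (cong (_% 16) (prime∣2⇒≡2 pp p∣2))

  -- Unsolvability for each family of coefficients.

  NoPlus NoMinus : ℕ → Set
  NoPlus c = ∀ x y z → x ≢ 0 → y ≢ 0 → z * z ≢ x ⁴ + c * y ⁴
  NoMinus c = ∀ x y z → x ≢ 0 → y ≢ 0 → x ⁴ ≢ z * z + c * y ⁴

  noPlus-1 : NoPlus 1
  noPlus-1 = plus-coprime {1} λ x y z x≢0 y≢0 xy eq → Fermat.no-solution x y z x≢0 y≢0 xy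
    (λ (e∣x , e∣z) → square-∣1 (plus-common {1} xy eq e∣x e∣z))
    (λ (e∣y , e∣z) → square-∣1 (plus-common {1} {y = x} (Coprimality.sym xy)
      (trans eq (trans (+-comm (x ⁴) (1 * y ⁴)) (cong₂ _+_ (*-identityˡ (y ⁴)) (sym (*-identityˡ (x ⁴)))))) e∣y e∣z)) eq

  noPlus-2 : NoPlus 2
  noPlus-2 = plus-coprime {2} λ x y z x≢0 y≢0 xy eq → PlusTwice.descent {1} (inj₁ refl) (suc y) x y z ≤-refl y≢0
    (λ (e∣x , e∣z) → square-∣2 (plus-common {2} xy eq e∣x e∣z)) eq

  noPlus-p : ∀ {p} → Prime p → p % 16 ∈ 7 ∷ 11 ∷ [] → NoPlus p
  noPlus-p {p} pp p₁₆ = plus-coprime {p} λ x y z x≢0 y≢0 xy eq → PlusPrime.descent pp p₁₆ (suc y) x y z ≤-refl y≢0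
    (λ {e} (e∣x , e∣z) → square-∣1 (square-∣-prime e pp (prime∤1 pp) (subst (e * e ∣_) (sym (*-identityˡ p)) (plus-common {p} xy eq e∣x e∣z)))) eq

  noPlus-2p : ∀ {p} → Prime p → p % 16 ∈ 3 ∷ 5 ∷ 11 ∷ 13 ∷ [] → NoPlus (2 * p)
  noPlus-2p {p} pp p₁₆ = plus-coprime {2 * p} λ x y z x≢0 y≢0 xy eq → PlusTwice.descent (inj₂ (pp , p₁₆)) (suc y) x y z ≤-refl y≢0
    (λ {e} (e∣x , e∣z) → square-∣2 (square-∣-prime e pp (prime∤2 pp p≢2) (plus-common {2 * p} xy eq e∣x e∣z))) eq
    where
    p≢2 : p % 16 ≢ 2
    p≢2 e = lookup {P = _≢ 2} (from-yes (all? (λ P → ¬? (P ≟ 2)) (3 ∷ 5 ∷ 11 ∷ 13 ∷ []))) p₁₆ e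

  module _ {p : ℕ} (pp : Prime p) (p₁₆ : p % 16 ∈ 3 ∷ 11 ∷ 13 ∷ []) where
    open MinusPrime pp p₁₆

    noMinus-p : NoMinus p
    noMinus-p = minus-coprime {p} λ x y z x≢0 y≢0 xy eq → minus-no-solution x y z y≢0
      (λ {e} (e∣x , e∣z) → square-∣1 (square-∣-prime e pp (prime∤1 pp) (subst (e * e ∣_) (sym (*-identityˡ p)) (minus-common {p} xy eq e∣x e∣z)))) eq

    p∤4 : ¬ p ∣ 4
    p∤4 p∣4 = p≢2 (cong (_% 16) (prime∣2⇒≡2 pp (Sum.reduce (euclidsLemma 2 2 pp p∣4))))
      where
      p≢2 : p % 16 ≢ 2
      p≢2 e = lookup {P = _≢ 2} (from-yes (all? (λ P → ¬? (P ≟ 2)) (3 ∷ 11 ∷ 13 ∷ []))) p₁₆ e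

    -- 4p is not squarefree, so x and z may share a factor 2. For odd x they do not and the descent
    -- applies. For even x, z is even as well, and dividing by 4 gives Z² = 4 X⁴ + p y⁴ with y odd,
    -- refuted by `four-odd`.
    noPlus-4p : NoPlus (4 * p)
    noPlus-4p = plus-coprime {4 * p} λ x y z x≢0 y≢0 xy eq → by-parity x y z (2 ∣? x) y≢0 xy eq
      where
      open +-*-Solver
      odd : ∀ x y z → ¬ 2 ∣ x → y ≢ 0 → Coprime x y → z * z ≢ x ⁴ + 4 * p * y ⁴
      odd x y z 2∤x y≢0 xy eq = descent (suc y) x y z ≤-refl y≢0
        (λ {e} (e∣x , e∣z) → square-∣4 (λ 2∣e → 2∤x (∣-trans 2∣e e∣x)) (square-∣-prime e pp p∤4 (plus-common {4 * p} xy eq e∣x e∣z))) eq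
      even : ∀ X y Z → Coprime (X * 2) y → Z * 2 * (Z * 2) ≢ (X * 2) ⁴ + 4 * p * y ⁴
      even X y Z xy eq = four-odd X y Z (λ 2∣y → both-even xy (∣n⇒∣m*n X ∣-refl) 2∣y)
        (λ {e} (e∣X , e∣Z) → square-∣1 (square-∣-prime e pp (prime∤1 pp) (subst (e * e ∣_) (sym (*-identityˡ p)) (common e∣X e∣Z)))) eq′
        where
        eq′ : Z * Z ≡ 4 * X ⁴ + p * y ⁴
        eq′ = cancelˡ 4 (λ ()) (trans (solve 1 (λ Z → con 4 :* (Z :* Z) := Z :* con 2 :* (Z :* con 2)) refl Z)
          (trans eq (solve 3 (λ X p y → X :* con 2 :* (X :* con 2) :* (X :* con 2 :* (X :* con 2)) :+ con 4 :* p :* y := con 4 :* (con 4 :* (X :* X :* (X :* X)) :+ p :* y)) refl X p (y ⁴))))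
        common : ∀ {e} → e ∣ X → e ∣ Z → e * e ∣ p
        common {e} e∣X e∣Z = square-∣ {p} {e} {X * 2} {y} xy (∣m⇒∣m*n 2 e∣X)
          (∣m+n∣m⇒∣n (subst (e * e ∣_) eq′ (*-pres-∣ e∣Z e∣Z)) (∣n⇒∣m*n 4 (∣m⇒∣m*n (X * X) (*-pres-∣ e∣X e∣X))))
      even-z : ∀ X y z → z * z ≡ (X * 2) ⁴ + 4 * p * y ⁴ → 2 ∣ z
      even-z X y z eq = square-even⁻¹ z (subst (2 ∣_) (sym eq) (∣m∣n⇒∣m+n (∣-⁴ (X * 2) (divides X refl)) (∣m⇒∣m*n (y ⁴) (∣m⇒∣m*n p (divides 2 refl)))))
      by-parity : ∀ x y z → Dec (2 ∣ x) → y ≢ 0 → Coprime x y → z * z ≢ x ⁴ + 4 * p * y ⁴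
      by-parity x y z (no 2∤x) = odd x y z 2∤x
      by-parity x y z (yes (divides X refl)) y≢0 xy eq with even-z X y z eq
      ... | divides Z refl = even X y Z xy eq

-- From rational points to natural solutions.

module Points where

  open Polynomials using (*-cancelˡ-0; *-≢0; square≡0; NoRationalPoint; superirreducible; irreducible-x⁴+)
  open Descent using (_⁴; *-≢0ₙ; square-mono⁻¹; square-quotient; NoPlus; NoMinus)
  open import Data.Integer as ℤ using (ℤ; +_; -[1+_]; ∣_∣)
  import Data.Integer.Properties as ℤ
  open import Data.List.Membership.DecPropositional using () renaming (_∈?_ to member?)
  open import Data.Nat as ℕ using (ℕ; suc; _%_; s≤s; z≤n)
  import Data.Nat.Divisibility as ℕ
  import Data.Nat.DivMod as ℕ
  import Data.Nat.Properties as ℕ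
  open import Data.Rational using (ℚ; mkℚ; 0ℚ; _+_; _*_; -_; _/_; ↥_; ↧_; ↧ₙ_)
  open import Data.Rational.Properties using (↥p/↧p≡p; fromℚᵘ-cong; *-zeroˡ; neg-injective)
  open import Data.Rational.Solver using (module +-*-Solver)
  open import Data.Rational.Unnormalised using (mkℚᵘ; *≡*)

  -- n / 1 is normalised through a gcd that does not compute for a variable n; here numerator and
  -- denominator are visible.
  integer : ℤ → ℚ
  integer n = mkℚ n 0 (Coprimality.sym (Coprimality.1-coprimeTo ∣ n ∣))

  n/1≡integer : ∀ n → n / 1 ≡ integer n
  n/1≡integer n = ↥p/↧p≡p (integer n)

  ℕtoℚ-* : ∀ m n → ℕtoℚ (m ℕ.* n) ≡ ℕtoℚ m * ℕtoℚ n
  ℕtoℚ-* m n = trans (cong (_/ 1) (ℤ.pos-* m n)) (sym (cong₂ _*_ (n/1≡integer (+ m)) (n/1≡integer (+ n))))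

  ℕtoℚ-+ : ∀ m n → ℕtoℚ (m ℕ.+ n) ≡ ℕtoℚ m + ℕtoℚ n
  ℕtoℚ-+ m n = trans (cong (_/ 1) (cong₂ ℤ._+_ (sym (ℤ.*-identityʳ (+ m))) (sym (ℤ.*-identityʳ (+ n))))) (sym (cong₂ _+_ (n/1≡integer (+ m)) (n/1≡integer (+ n))))

  ℕtoℚ-injective : ∀ m n → ℕtoℚ m ≡ ℕtoℚ n → m ≡ n
  ℕtoℚ-injective m n eq = ℤ.+-injective (cong ↥_ (trans (sym (n/1≡integer (+ m))) (trans eq (n/1≡integer (+ n)))))

  square-∣∣ : ∀ i → i ℤ.* i ≡ + (∣ i ∣ ℕ.* ∣ i ∣)
  square-∣∣ (+ n) = sym (ℤ.pos-* n n)
  square-∣∣ -[1+ n ] = refl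

  clear-denominator : ∀ x → x * integer (↧ x) ≡ integer (↥ x)
  clear-denominator x@(mkℚ n d c) = trans (fromℚᵘ-cong {mkℚᵘ (n ℤ.* + suc d) (d ℕ.* 1)} {mkℚᵘ n 0} (*≡* (trans (ℤ.*-identityʳ (n ℤ.* + suc d))
    (cong (λ t → n ℤ.* + suc t) (sym (ℕ.*-identityʳ d)))))) (n/1≡integer n)

  -- x = ± a/b. Only squares of the coordinates occur, so passing to absolute values loses nothing.
  record SquareFraction (x : ℚ) : Set where
    constructor fraction
    field
      a b : ℕ
      b≢0 : b ≢ 0
      a≢0 : x ≢ 0ℚ → a ≢ 0
      equation : x * x * (ℕtoℚ b * ℕtoℚ b) ≡ ℕtoℚ a * ℕtoℚ a

  squareFraction : ∀ x → SquareFraction x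
  squareFraction x = fraction a b (λ ()) a≢0 eq
    where
    open ≡-Reasoning
    open +-*-Solver
    a b : ℕ
    a = ∣ ↥ x ∣
    b = ↧ₙ x
    eq : x * x * (ℕtoℚ b * ℕtoℚ b) ≡ ℕtoℚ a * ℕtoℚ a
    eq = begin
      x * x * (ℕtoℚ b * ℕtoℚ b)               ≡⟨ cong (λ t → x * x * (t * t)) (n/1≡integer (+ b)) ⟩
      x * x * (integer (↧ x) * integer (↧ x)) ≡⟨ solve 2 (λ x d → x :* x :* (d :* d) := (x :* d) :* (x :* d)) refl x (integer (↧ x)) ⟩
      (x * integer (↧ x)) * (x * integer (↧ x)) ≡⟨ cong (λ t → t * t) (clear-denominator x) ⟩
      integer (↥ x) * integer (↥ x)           ≡⟨ cong (_/ 1) (trans (square-∣∣ (↥ x)) (ℤ.pos-* a a)) ⟩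
      integer (+ a) * integer (+ a)           ≡⟨ cong (λ t → t * t) (n/1≡integer (+ a)) ⟨
      ℕtoℚ a * ℕtoℚ a                         ∎
    a≢0 : x ≢ 0ℚ → a ≢ 0
    a≢0 x≢0 a≡0 = x≢0 (square≡0 (*-cancelˡ-0 bb≢0 (trans (solve 2 (λ x b → b :* b :* (x :* x) := x :* x :* (b :* b)) refl x (ℕtoℚ b)) (trans eq (cong (λ t → ℕtoℚ t * ℕtoℚ t) a≡0)))))
      where
      b≢0 : ℕtoℚ b ≢ 0ℚ
      b≢0 e with () ← ℕtoℚ-injective b 0 e
      bb≢0 = *-≢0 b≢0 b≢0

  ℕtoℚ-² : ∀ n → ℕtoℚ (n ℕ.* n) ≡ ℕtoℚ n * ℕtoℚ n
  ℕtoℚ-² n = ℕtoℚ-* n n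

  ℕtoℚ-⁴ : ∀ n → ℕtoℚ (n ⁴) ≡ ℕtoℚ n * ℕtoℚ n * (ℕtoℚ n * ℕtoℚ n)
  ℕtoℚ-⁴ n = trans (ℕtoℚ-* (n ℕ.* n) (n ℕ.* n)) (cong (λ t → t * t) (ℕtoℚ-² n))

  -- The coefficient stays rational, so one clearing of denominators serves both signs of c.
  record ClearedPoint (c : ℚ) : Set where
    constructor cleared
    field
      x y z : ℕ
      x≢0 : x ≢ 0
      y≢0 : y ≢ 0
      equation : ℕtoℚ (z ℕ.* z) ≡ ℕtoℚ (x ⁴) + c * ℕtoℚ (y ⁴)

  clear-point : ∀ {c} x y z → x ≢ 0ℚ → y ≢ 0ℚ → z * z ≡ x * x * (x * x) + c * (y * y * (y * y)) → ClearedPoint c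
  clear-point {c} x y z x≢0 y≢0 eq = go (squareFraction x) (squareFraction y) (squareFraction z)
    where
    go : SquareFraction x → SquareFraction y → SquareFraction z → ClearedPoint c
    go (fraction a b b≢0 a≢0 e) (fraction a′ b′ b′≢0 a′≢0 e′) (fraction a″ b″ b″≢0 _ e″) = cleared X Y Z
        (*-≢0ₙ (a≢0 x≢0) (*-≢0ₙ b′≢0 b″≢0)) (*-≢0ₙ (a′≢0 y≢0) (*-≢0ₙ b≢0 b″≢0)) eqn
      where
      open ≡-Reasoning
      open +-*-Solver
      X Y Z : ℕ
      -- Up to sign, `X` and `Y` are x and y times the common denominator b b′ b″, and `Z` is z
      -- times its square.
      X = a ℕ.* (b′ ℕ.* b″)
      Y = a′ ℕ.* (b ℕ.* b″)
      Z = a″ ℕ.* (b″ ℕ.* (b ℕ.* b′ ℕ.* (b ℕ.* b′)))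
      A = ℕtoℚ a
      A′ = ℕtoℚ a′
      A″ = ℕtoℚ a″
      B = ℕtoℚ b
      B′ = ℕtoℚ b′
      B″ = ℕtoℚ b″
      νX : ℕtoℚ X ≡ A * (B′ * B″)
      νX = trans (ℕtoℚ-* a (b′ ℕ.* b″)) (cong (A *_) (ℕtoℚ-* b′ b″))
      νY : ℕtoℚ Y ≡ A′ * (B * B″)
      νY = trans (ℕtoℚ-* a′ (b ℕ.* b″)) (cong (A′ *_) (ℕtoℚ-* b b″))
      νZ : ℕtoℚ Z ≡ A″ * (B″ * (B * B′ * (B * B′)))
      νZ = trans (ℕtoℚ-* a″ _) (cong (A″ *_) (trans (ℕtoℚ-* b″ _) (cong (B″ *_)
        (trans (ℕtoℚ-² (b ℕ.* b′)) (cong (λ t → t * t) (ℕtoℚ-* b b′))))))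
      M = B * B * (B′ * B′)
      eqn : ℕtoℚ (Z ℕ.* Z) ≡ ℕtoℚ (X ⁴) + c * ℕtoℚ (Y ⁴)
      eqn = begin
        ℕtoℚ (Z ℕ.* Z)
          ≡⟨ trans (ℕtoℚ-² Z) (cong (λ t → t * t) νZ) ⟩
        A″ * (B″ * (B * B′ * (B * B′))) * (A″ * (B″ * (B * B′ * (B * B′))))
          ≡⟨ solve 4 (λ a b₂ b b₁ → a :* (b₂ :* (b :* b₁ :* (b :* b₁))) :* (a :* (b₂ :* (b :* b₁ :* (b :* b₁))))
               := a :* a :* (b₂ :* b₂ :* (b :* b :* (b₁ :* b₁) :* (b :* b :* (b₁ :* b₁))))) refl A″ B″ B B′ ⟩
        A″ * A″ * (B″ * B″ * (M * M))
          ≡⟨ cong (_* (B″ * B″ * (M * M))) (trans (sym e″) (cong (_* (B″ * B″)) eq)) ⟩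
        (x * x * (x * x) + c * (y * y * (y * y))) * (B″ * B″) * (B″ * B″ * (M * M))
          ≡⟨ solve 6 (λ u v c b b₁ b₂ → (u :* u :+ c :* (v :* v)) :* b₂ :* (b₂ :* (b :* b₁ :* (b :* b₁)))
               := (u :* b) :* (u :* b) :* (b₁ :* b₁ :* (b₂ :* b₂)) :+ c :* ((v :* b₁) :* (v :* b₁) :* (b :* b :* (b₂ :* b₂)))) refl
               (x * x) (y * y) c (B * B) (B′ * B′) (B″ * B″) ⟩
        (x * x * (B * B)) * (x * x * (B * B)) * (B′ * B′ * (B′ * B′) * (B″ * B″ * (B″ * B″))) + c * ((y * y * (B′ * B′)) * (y * y * (B′ * B′)) * (B * B * (B * B) * (B″ * B″ * (B″ * B″))))
          ≡⟨ cong₂ (λ s t → s * s * (B′ * B′ * (B′ * B′) * (B″ * B″ * (B″ * B″))) + c * (t * t * (B * B * (B * B) * (B″ * B″ * (B″ * B″))))) e e′ ⟩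
        (A * A) * (A * A) * (B′ * B′ * (B′ * B′) * (B″ * B″ * (B″ * B″))) + c * ((A′ * A′) * (A′ * A′) * (B * B * (B * B) * (B″ * B″ * (B″ * B″))))
          ≡⟨ cong₂ (λ s t → s + c * t) (fourth-power A B′ B″) (fourth-power A′ B B″) ⟩
        (A * (B′ * B″)) * (A * (B′ * B″)) * ((A * (B′ * B″)) * (A * (B′ * B″))) + c * ((A′ * (B * B″)) * (A′ * (B * B″)) * ((A′ * (B * B″)) * (A′ * (B * B″))))
          ≡⟨ cong₂ (λ s t → s * s * (s * s) + c * (t * t * (t * t))) νX νY ⟨
        ℕtoℚ X * ℕtoℚ X * (ℕtoℚ X * ℕtoℚ X) + c * (ℕtoℚ Y * ℕtoℚ Y * (ℕtoℚ Y * ℕtoℚ Y))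
          ≡⟨ cong₂ (λ s t → s + c * t) (ℕtoℚ-⁴ X) (ℕtoℚ-⁴ Y) ⟨
        ℕtoℚ (X ⁴) + c * ℕtoℚ (Y ⁴) ∎
        where
        fourth-power : ∀ a b c → (a * a) * (a * a) * (b * b * (b * b) * (c * c * (c * c))) ≡ (a * (b * c)) * (a * (b * c)) * ((a * (b * c)) * (a * (b * c)))
        fourth-power = solve 3 (λ a b c → (a :* a) :* (a :* a) :* (b :* b :* (b :* b) :* (c :* c :* (c :* c))) := (a :* (b :* c)) :* (a :* (b :* c)) :* ((a :* (b :* c)) :* (a :* (b :* c)))) refl

  noRationalPoint-plus : ∀ {c} → NoPlus c → NoRationalPoint (ℕtoℚ c)
  noRationalPoint-plus {c} none x y z x≢0 y≢0 eq = go (clear-point x y z x≢0 y≢0 eq)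
    where
    go : ¬ ClearedPoint (ℕtoℚ c)
    go (cleared X Y Z X≢0 Y≢0 e) = none X Y Z X≢0 Y≢0 (ℕtoℚ-injective _ _ (trans e
      (trans (cong (λ t → ℕtoℚ (X ⁴) + t) (sym (ℕtoℚ-* c (Y ⁴)))) (sym (ℕtoℚ-+ (X ⁴) (c ℕ.* Y ⁴))))))

  noRationalPoint-minus : ∀ {c} → NoMinus c → NoRationalPoint (- ℕtoℚ c)
  noRationalPoint-minus {c} none x y z x≢0 y≢0 eq = go (clear-point x y z x≢0 y≢0 eq)
    where
    open ≡-Reasoning
    open +-*-Solver
    go : ¬ ClearedPoint (- ℕtoℚ c)
    go (cleared X Y Z X≢0 Y≢0 e) = none X Y Z X≢0 Y≢0 (ℕtoℚ-injective _ _ (begin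
      ℕtoℚ (X ⁴)                                                        ≡⟨ solve 3 (λ x c y → x := (x :+ (:- c) :* y) :+ c :* y) refl (ℕtoℚ (X ⁴)) (ℕtoℚ c) (ℕtoℚ (Y ⁴)) ⟩
      (ℕtoℚ (X ⁴) + (- ℕtoℚ c) * ℕtoℚ (Y ⁴)) + ℕtoℚ c * ℕtoℚ (Y ⁴)      ≡⟨ cong₂ _+_ (sym e) (sym (ℕtoℚ-* c (Y ⁴))) ⟩
      ℕtoℚ (Z ℕ.* Z) + ℕtoℚ (c ℕ.* Y ⁴)                                 ≡⟨ ℕtoℚ-+ (Z ℕ.* Z) (c ℕ.* Y ⁴) ⟨
      ℕtoℚ (Z ℕ.* Z ℕ.+ c ℕ.* Y ⁴)                                      ∎))

  ℕtoℚ-≢0 : ∀ {n} → n ≢ 0 → ℕtoℚ n ≢ 0ℚ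
  ℕtoℚ-≢0 {n} n≢0 e = n≢0 (ℕtoℚ-injective n 0 e)

  -- Irreducibility of x⁴ + 1 and x⁴ + 2.

  square≢2 : ∀ n → 2 ≢ n ℕ.* n
  square≢2 0 ()
  square≢2 1 ()
  square≢2 (suc (suc n)) eq with s≤s (s≤s ()) ← ℕ.≤-trans (ℕ.*-mono-≤ {2} {suc (suc n)} {2} (s≤s (s≤s z≤n)) (s≤s (s≤s z≤n))) (ℕ.≤-reflexive (sym eq))

  -- By `square-quotient` the number 2 would be a natural square.
  √2-irrational : ∀ {n m} → m ≢ 0 → n ℕ.* n ≢ 2 ℕ.* (m ℕ.* m)
  √2-irrational {n} {m} m≢0 eq with r , e ← square-quotient {m} {2} {n} m≢0 (trans (ℕ.*-comm (m ℕ.* m) 2) (sym eq)) = square≢2 r e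

  no-square-ratio-2 : ∀ α γ → γ ≢ 0ℚ → α * α ≢ ℕtoℚ 2 * (γ * γ)
  no-square-ratio-2 α γ γ≢0 eq = go (squareFraction α) (squareFraction γ)
    where
    open ≡-Reasoning
    open +-*-Solver
    go : SquareFraction α → SquareFraction γ → ⊥
    go (fraction a b b≢0 _ e) (fraction c d d≢0 c≢0 e′) = √2-irrational {a ℕ.* d} {c ℕ.* b} (*-≢0ₙ (c≢0 γ≢0) b≢0) (ℕtoℚ-injective _ _ (begin
      ℕtoℚ (a ℕ.* d ℕ.* (a ℕ.* d))              ≡⟨ product² a d ⟩
      A * A * (D * D)                            ≡⟨ cong (_* (D * D)) (trans (sym e) (cong (_* (B * B)) eq)) ⟩
      ℕtoℚ 2 * (γ * γ) * (B * B) * (D * D)       ≡⟨ solve 4 (λ t g b d → t :* g :* b :* d := t :* (g :* d :* b)) refl (ℕtoℚ 2) (γ * γ) (B * B) (D * D) ⟩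
      ℕtoℚ 2 * (γ * γ * (D * D) * (B * B))       ≡⟨ cong (λ t → ℕtoℚ 2 * (t * (B * B))) e′ ⟩
      ℕtoℚ 2 * (C * C * (B * B))                 ≡⟨ cong (ℕtoℚ 2 *_) (product² c b) ⟨
      ℕtoℚ 2 * ℕtoℚ (c ℕ.* b ℕ.* (c ℕ.* b))     ≡⟨ ℕtoℚ-* 2 (c ℕ.* b ℕ.* (c ℕ.* b)) ⟨
      ℕtoℚ (2 ℕ.* (c ℕ.* b ℕ.* (c ℕ.* b)))       ∎))
      where
      A = ℕtoℚ a
      B = ℕtoℚ b
      C = ℕtoℚ c
      D = ℕtoℚ d
      product² : ∀ m n → ℕtoℚ (m ℕ.* n ℕ.* (m ℕ.* n)) ≡ ℕtoℚ m * ℕtoℚ m * (ℕtoℚ n * ℕtoℚ n)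
      product² m n = trans (ℕtoℚ-² (m ℕ.* n)) (trans (cong (λ t → t * t) (ℕtoℚ-* m n))
        (solve 2 (λ m n → m :* n :* (m :* n) := m :* m :* (n :* n)) refl (ℕtoℚ m) (ℕtoℚ n)))

  -- Clearing denominators leaves a sum of natural numbers whose second term is a product of nonzero
  -- factors.
  no-zero : ∀ {c} → c ≢ 0 → ∀ α δ → δ ≢ 0ℚ → α * α + ℕtoℚ c * (δ * δ) ≢ 0ℚ
  no-zero {c} c≢0 α δ δ≢0 eq = go (squareFraction α) (squareFraction δ)
    where
    open ≡-Reasoning
    open +-*-Solver
    go : SquareFraction α → SquareFraction δ → ⊥
    go (fraction a b b≢0 _ e) (fraction d f f≢0 d≢0 e′) = *-≢0ₙ c≢0 (*-≢0ₙ (*-≢0ₙ (d≢0 δ≢0) (d≢0 δ≢0)) (*-≢0ₙ b≢0 b≢0))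
        (ℕ.m+n≡0⇒n≡0 (a ℕ.* a ℕ.* (f ℕ.* f)) (ℕtoℚ-injective _ 0 (begin
      ℕtoℚ (a ℕ.* a ℕ.* (f ℕ.* f) ℕ.+ c ℕ.* (d ℕ.* d ℕ.* (b ℕ.* b)))    ≡⟨ ℕtoℚ-+ (a ℕ.* a ℕ.* (f ℕ.* f)) _ ⟩
      ℕtoℚ (a ℕ.* a ℕ.* (f ℕ.* f)) + ℕtoℚ (c ℕ.* (d ℕ.* d ℕ.* (b ℕ.* b))) ≡⟨ cong₂ _+_ (squares² a f) (trans (ℕtoℚ-* c _) (cong (ℕtoℚ c *_) (squares² d b))) ⟩
      A * A * (F * F) + ℕtoℚ c * (D * D * (B * B))                         ≡⟨ cong₂ (λ s t → s * (F * F) + ℕtoℚ c * (t * (B * B))) (sym e) (sym e′) ⟩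
      α * α * (B * B) * (F * F) + ℕtoℚ c * (δ * δ * (F * F) * (B * B))     ≡⟨ solve 5 (λ x b f c y → x :* b :* f :+ c :* (y :* f :* b) := (x :+ c :* y) :* (b :* f)) refl (α * α) (B * B) (F * F) (ℕtoℚ c) (δ * δ) ⟩
      (α * α + ℕtoℚ c * (δ * δ)) * (B * B * (F * F))                       ≡⟨ cong (_* (B * B * (F * F))) eq ⟩
      0ℚ * (B * B * (F * F))                                               ≡⟨ *-zeroˡ (B * B * (F * F)) ⟩
      0ℚ                                                                   ∎)))
      where
      A = ℕtoℚ a
      B = ℕtoℚ b
      D = ℕtoℚ d
      F = ℕtoℚ f
      squares² : ∀ m n → ℕtoℚ (m ℕ.* m ℕ.* (n ℕ.* n)) ≡ ℕtoℚ m * ℕtoℚ m * (ℕtoℚ n * ℕtoℚ n)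
      squares² m n = trans (ℕtoℚ-* (m ℕ.* m) (n ℕ.* n)) (cong₂ _*_ (ℕtoℚ-² m) (ℕtoℚ-² n))

  -- α² = γ² and 2αγ = δ² give (δ² − 2γ²)(δ² + 2γ²) = 0.
  no-square-1 : ∀ α γ δ → γ ≢ 0ℚ → α * α ≡ ℕtoℚ 1 * (γ * γ) → α * γ + γ * α ≢ δ * δ
  no-square-1 α γ δ γ≢0 αα≡ 2αγ≡ = *-≢0 plus≢0 minus≢0 (begin
      (δ * δ + ℕtoℚ 2 * (γ * γ)) * (δ * δ + - (ℕtoℚ 2 * (γ * γ)))
        ≡⟨ cong (λ t → (t + ℕtoℚ 2 * (γ * γ)) * (t + - (ℕtoℚ 2 * (γ * γ)))) (sym 2αγ≡) ⟩
      (α * γ + γ * α + ℕtoℚ 2 * (γ * γ)) * (α * γ + γ * α + - (ℕtoℚ 2 * (γ * γ)))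
        ≡⟨ solve 2 (λ α γ → (α :* γ :+ γ :* α :+ con (ℕtoℚ 2) :* (γ :* γ)) :* (α :* γ :+ γ :* α :+ :- (con (ℕtoℚ 2) :* (γ :* γ)))
             := con (ℕtoℚ 4) :* (γ :* γ) :* (α :* α :+ :- (con (ℕtoℚ 1) :* (γ :* γ)))) refl α γ ⟩
      ℕtoℚ 4 * (γ * γ) * (α * α + - (ℕtoℚ 1 * (γ * γ)))
        ≡⟨ cong (λ t → ℕtoℚ 4 * (γ * γ) * (t + - (ℕtoℚ 1 * (γ * γ)))) αα≡ ⟩
      ℕtoℚ 4 * (γ * γ) * (ℕtoℚ 1 * (γ * γ) + - (ℕtoℚ 1 * (γ * γ)))
        ≡⟨ solve 1 (λ g → con (ℕtoℚ 4) :* g :* (con (ℕtoℚ 1) :* g :+ :- (con (ℕtoℚ 1) :* g)) := con 0ℚ) refl (γ * γ) ⟩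
      0ℚ ∎)
    where
    open ≡-Reasoning
    open +-*-Solver
    plus≢0 : δ * δ + ℕtoℚ 2 * (γ * γ) ≢ 0ℚ
    plus≢0 = no-zero {2} (λ ()) δ γ γ≢0
    minus≢0 : δ * δ + - (ℕtoℚ 2 * (γ * γ)) ≢ 0ℚ
    minus≢0 e = no-square-ratio-2 δ γ γ≢0 (begin
      δ * δ                                                              ≡⟨ solve 2 (λ d g → d := (d :+ :- g) :+ g) refl (δ * δ) (ℕtoℚ 2 * (γ * γ)) ⟩
      (δ * δ + - (ℕtoℚ 2 * (γ * γ))) + ℕtoℚ 2 * (γ * γ)                  ≡⟨ cong (_+ ℕtoℚ 2 * (γ * γ)) e ⟩
      0ℚ + ℕtoℚ 2 * (γ * γ)                                              ≡⟨ solve 1 (λ g → con 0ℚ :+ g := g) refl (ℕtoℚ 2 * (γ * γ)) ⟩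
      ℕtoℚ 2 * (γ * γ)                                                   ∎)

  irreducible-x⁴+1 : Irreducible (x⁴+ (ℕtoℚ 1))
  irreducible-x⁴+1 = irreducible-x⁴+ (ℕtoℚ 1) (no-zero {1} (λ ())) no-square-1

  irreducible-x⁴+2 : Irreducible (x⁴+ (ℕtoℚ 2))
  irreducible-x⁴+2 = irreducible-x⁴+ (ℕtoℚ 2) (no-zero {2} (λ ())) (λ α γ δ γ≢0 eq _ → no-square-ratio-2 α γ γ≢0 eq)

  superirreducible-plus : ∀ c → c ≢ 0 → NoPlus c → Irreducible (x⁴+ (ℕtoℚ c)) → Superirreducible 2 (x⁴+ (ℕtoℚ c))
  superirreducible-plus c c≢0 none = superirreducible (ℕtoℚ-≢0 c≢0) (noRationalPoint-plus {c} none)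

  superirreducible-minus : ∀ c → c ≢ 0 → NoMinus c → Irreducible (x⁴+ (- ℕtoℚ c)) → Superirreducible 2 (x⁴+ (- ℕtoℚ c))
  superirreducible-minus c c≢0 none = superirreducible
    (λ e → ℕtoℚ-≢0 c≢0 (neg-injective {ℕtoℚ c} {0ℚ} e)) (noRationalPoint-minus {c} none)

  residues-i : ∀ p → p % 16 ≡ 7 ⊎ p % 16 ≡ 11 → p % 16 ∈ 7 ∷ 11 ∷ []
  residues-i p (inj₁ e) = here e
  residues-i p (inj₂ e) = there (here e)

  residues-iii : ∀ p → p % 16 ≡ 3 ⊎ p % 16 ≡ 13 ⊎ p % 16 ≡ 11 → p % 16 ∈ 3 ∷ 11 ∷ 13 ∷ []
  residues-iii p (inj₁ e) = here e
  residues-iii p (inj₂ (inj₁ e)) = there (there (here e))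
  residues-iii p (inj₂ (inj₂ e)) = there (here e)

  residues-ii : ∀ p → p % 8 ≡ 3 ⊎ p % 8 ≡ 5 → p % 16 ∈ 3 ∷ 5 ∷ 11 ∷ 13 ∷ []
  residues-ii p h = checked (ℕ.m%n<n p 16) (Sum.map (trans p%16%8≡) (trans p%16%8≡) h)
    where
    p%16%8≡ : p % 16 % 8 ≡ p % 8
    p%16%8≡ = ℕ.m∣n⇒o%n%m≡o%m 8 16 p (ℕ.divides 2 refl)
    checked : ∀ {i} → i ℕ.< 16 → i % 8 ≡ 3 ⊎ i % 8 ≡ 5 → i ∈ 3 ∷ 5 ∷ 11 ∷ 13 ∷ []
    checked = from-yes (ℕ.allUpTo? (λ i → (i % 8 ℕ.≟ 3 ⊎-dec i % 8 ℕ.≟ 5) →-dec member? ℕ._≟_ i (3 ∷ 5 ∷ 11 ∷ 13 ∷ [])) 16)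

open import Data.Nat using (ℕ; _*_; _%_)
open import Data.Rational using (-_)
open Descent using (noPlus-1; noPlus-2; noPlus-p; noPlus-2p; noPlus-4p; noMinus-p; prime≢0; *-≢0ₙ)
open Points

theorem1p3 : (Superirreducible 2 (x⁴+ (ℕtoℚ 1)) × Superirreducible 2 (x⁴+ (ℕtoℚ 2)))
    × (∀ (p : ℕ) → Prime p → (p % 16 ≡ 7 ⊎ p % 16 ≡ 11)
    → Irreducible (x⁴+ (ℕtoℚ p)) → Superirreducible 2 (x⁴+ (ℕtoℚ p)))
    × (∀ (p : ℕ) → Prime p → (p % 8 ≡ 3 ⊎ p % 8 ≡ 5)
    → Irreducible (x⁴+ (ℕtoℚ (2 * p))) → Superirreducible 2 (x⁴+ (ℕtoℚ (2 * p))))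
    × (∀ (p : ℕ) → Prime p → (p % 16 ≡ 3 ⊎ p % 16 ≡ 13 ⊎ p % 16 ≡ 11)
    → (Irreducible (x⁴+ (ℕtoℚ (4 * p))) → Superirreducible 2 (x⁴+ (ℕtoℚ (4 * p))))
    × (Irreducible (x⁴+ (- ℕtoℚ p)) → Superirreducible 2 (x⁴+ (- ℕtoℚ p))))
theorem1p3 =
    (superirreducible-plus 1 (λ ()) noPlus-1 irreducible-x⁴+1 , superirreducible-plus 2 (λ ()) noPlus-2 irreducible-x⁴+2)
  , (λ p pp h → superirreducible-plus p (prime≢0 pp) (noPlus-p pp (residues-i p h)))
  , (λ p pp h → superirreducible-plus (2 * p) (*-≢0ₙ {2} (λ ()) (prime≢0 pp)) (noPlus-2p pp (residues-ii p h)))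
  , (λ p pp h → superirreducible-plus (4 * p) (*-≢0ₙ {4} (λ ()) (prime≢0 pp)) (noPlus-4p pp (residues-iii p h))
              , superirreducible-minus p (prime≢0 pp) (noMinus-p pp (residues-iii p h)))
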